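{- For all $n \geq 0$, $$p_{\xi}(3n) \equiv \begin{cases} 1 \pmod{8}, & \text{if } n=0,\\ 6(-1)^k \pmod{8}, & \text{if } n=k^2 \text{ with } k\ge1,\\ 4 \pmod{8}, & \text{if } n = 2k^2,\ n = 3k^2, \text{ or } n = 6k^2 \text{ with } k\ge 1,\\ 0 \pmod{8}, & \text{otherwise}.\end{cases}$$
   Context: $(a;q)_n=(1-a)(1-aq)\cdots(1-aq^{n-1})$, $(a;q)_0=1$. The coefficients $p_\xi(n)$ are defined by $\sum_{n\ge0}p_\xi(n)q^n=\xi(q)=1+2\sum_{n\ge1}\frac{q^{6n^2-6n+1}}{(q;q^6)_n(q^5;q^6)_n}$. -}

module Defs where

open import Data.Nat using (ℕ; zero; suc; _+_; _*_; _∸_; _≤ᵇ_; _≡ᵇ_)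
open import Data.Nat.DivMod using (_%_)
open import Data.Bool using (if_then_else_)

-- Formal power series in q with natural-number coefficients,
-- represented by their coefficient function.
Series : Set
Series = ℕ → ℕ

sumTo : ℕ → (ℕ → ℕ) → ℕ
sumTo zero    f = f 0
sumTo (suc m) f = sumTo m f + f (suc m)

one : Series
one zero    = 1
one (suc _) = 0

_⊛_ : Series → Series → Series
(f ⊛ g) m = sumTo m (λ i → f i * g (m ∸ i))

-- the series 1/(1 - q^(suc b)) = Σ_{k≥0} q^{(suc b) k}
geomInv : ℕ → Series
geomInv b k = if (k % suc b) ≡ᵇ 0 then 1 else 0

-- 1 / ((q;q^6)_n (q^5;q^6)_n) = ∏_{j=0}^{n-1} 1/((1-q^{6j+1})(1-q^{6j+5}))
pochInv : ℕ → Series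
pochInv zero    = one
pochInv (suc j) = pochInv j ⊛ (geomInv (6 * j) ⊛ geomInv (6 * j + 4))

shift : ℕ → Series → Series
shift e f m = if e ≤ᵇ m then f (m ∸ e) else 0

summand : ℕ → Series
summand n = shift (6 * n * n ∸ 6 * n + 1) (pochInv n)

-- p_ξ(m) = [q^m] ξ(q), ξ(q) = 1 + 2 Σ_{n≥1} summand n.
-- Only n ≤ m contribute to the coefficient of q^m, since
-- 6n^2-6n+1 ≥ n for n ≥ 1.
pξ : ℕ → ℕ
pξ m = one m + 2 * sumTo m (λ n → if n ≡ᵇ 0 then 0 else summand n m)

{-# OPTIONS --safe #-}

-- Write E_c = (q^c; q^c)_∞, φ_c = Σ_{k∈ℤ} (-1)^k q^{ck²}, and T(q) = Σ p_ξ(3n) qⁿ. The congruence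
-- is read off the identity T φ_1 = φ_3².
--
-- The Bailey lemma, applied in base q⁶ to a partial-fraction Bailey pair, expresses E_6 (ξ - 1) / 2
-- as a Lambert series Σ_k (-1)^k q^{9k²+9k+1} (1/(1 - q^{6k+1}) + q^{6k+5}/(1 - q^{6k+5})).
-- Keeping the exponents divisible by 3 gives T E_2 on one side; term by term the other side is the
-- same trisection of Σ_k (-1)^k q^{k²+k} (1 + q^{2k+1})/(1 - q^{2k+1}), which a partial-fraction pair
-- in base q² identifies with ψ², where ψ = Σ q^{k(k+1)/2}. As ψ = g(q³) + q ψ(q⁹) with
-- g = Σ_{k∈ℤ} q^{k(3k+1)/2}, this trisection is g². The triple product gives g E_1 = φ_3 E_2 and
-- E_1² = E_2 φ_1, so T E_2 = g² becomes T φ_1 = φ_3².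
--
-- With φ_c = 1 + 2 S_c one gets T ≡ 1 - 2 S_1 + 4 (S_1² + S_3 + S_3²) modulo 8, and modulo 2 the
-- square of a series is obtained by squaring its monomials, so S_1², S_3 and S_3² contribute the
-- exponents 2k², 3k² and 6k². The four families of exponents are disjoint as √2, √3, √6 ∉ ℚ.
module Submission where

open import Algebra.Bundles using (CommutativeRing)
import Algebra.Properties.AbelianGroup
import Algebra.Properties.CommutativeSemiring.Exp
import Algebra.Properties.Ring
import Algebra.Properties.Semiring.Exp
import Algebra.Properties.Semiring.Mult.TCOptimised
import Algebra.Solver.Ring
open import Algebra.Solver.Ring.AlmostCommutativeRing using (_-Raw-AlmostCommutative⟶_; fromCommutativeRing)
open import Algebra.Structures using (IsCommutativeRing)
open import Data.Bool using (if_then_else_)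
import Data.Integer as ℤ
import Data.Integer.Divisibility as ℤᵤ
import Data.Integer.Divisibility.Signed as ℤ
import Data.Integer.Properties as ℤ
import Data.Integer.Tactic.RingSolver as ℤSolver
import Data.Maybe as Maybe
open import Data.Nat using (ℕ; zero; suc; z≤n; s≤s)
import Data.Nat as ℕ
import Data.Nat.Divisibility as ℕ
open import Data.Nat.DivMod using (_%_; m<n⇒m%n≡m; [m+n]%n≡m%n)
open import Data.Nat.Induction using (<-rec)
open import Data.Nat.Primality using (Prime; prime?; prime[2]; euclidsLemma; prime⇒nonZero; prime⇒nonTrivial)
import Data.Nat.Properties as ℕ
import Data.Nat.Tactic.RingSolver as ℕSolver
open import Data.Product using (_,_; ∃-syntax; proj₁; proj₂)
open import Data.Sum using (_⊎_; inj₁; inj₂; reduce)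
open import Defs
open import Function using (_∘_)
open import Level using (_⊔_)
open import Relation.Binary.PropositionalEquality as ≡ using (_≡_; _≢_)
import Relation.Binary.Reasoning.Setoid
open import Relation.Nullary using (¬_; yes; no; contradiction)
open import Relation.Nullary.Decidable using (dec⇒maybe; from-yes; from-no)

-- The two Lambert series match because trisection leaves their denominators alone: 1/(1 - a) = (1 +
-- a + a²)/(1 - a³), and for a power a of q the factor 1/(1 - a³) becomes 1/(1 - a) again. The
-- exponents 6k + 1 and 6k + 5 are the numbers 2j + 1 for j = 3k and j = 3k + 2, while the terms
-- with j = 3k + 1 disappear. What is still missing, the passage from 2a/(1 - a) to (1 + a)/(1 - a),
-- is supplied by the constant 1 of ξ, which contributes the pentagonal series E_2. The parameters
-- of a partial-fraction pair satisfy x y = Q: x = q, y = q⁵ for Q = q⁶, and x = y = q for Q = q².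
-- The first pair is summed with the weights Q^(n²+n); for the second only the limit of its β is
-- taken. Infinite products enter only as limits of finite ones. The finite identities are proved in
-- a general commutative ring and then carried to q-adic limits; E_c is defined by its pentagonal
-- series and inverted by `W`.

-- Ring normalisation with integer coefficients in an arbitrary commutative ring

module IntegerCoefficients {c ℓ} (R : CommutativeRing c ℓ) where
  open CommutativeRing R
  open Algebra.Properties.AbelianGroup +-abelianGroup using (⁻¹-∙-comm; ⁻¹-involutive; ε⁻¹≈ε)
  open Algebra.Properties.Ring ring using (-‿distribˡ-*)
  open Algebra.Properties.Semiring.Mult.TCOptimised semiring using (_×_; 1+×; ×-homo-+; ×1-homo-*)
  open Relation.Binary.Reasoning.Setoid setoid

  ⟦_⟧ℤ : ℤ.ℤ → Carrier
  ⟦ ℤ.+ n ⟧ℤ      = n × 1#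
  ⟦ ℤ.-[1+ n ] ⟧ℤ = - (suc n × 1#)

  neg-homo : ∀ i → ⟦ ℤ.- i ⟧ℤ ≈ - ⟦ i ⟧ℤ
  neg-homo (ℤ.+ zero)    = sym ε⁻¹≈ε
  neg-homo (ℤ.+ suc n)   = refl
  neg-homo (ℤ.-[1+ n ])  = sym (⁻¹-involutive _)

  ⊖-homo : ∀ m n → ⟦ m ℤ.⊖ n ⟧ℤ ≈ m × 1# + - (n × 1#)
  ⊖-homo m       zero    = begin
    m × 1#               ≈⟨ +-identityʳ _ ⟨
    m × 1# + 0#          ≈⟨ +-congˡ ε⁻¹≈ε ⟨
    m × 1# + - 0#        ∎
  ⊖-homo zero    (suc n) = sym (+-identityˡ _)
  ⊖-homo (suc m) (suc n) = begin
    ⟦ suc m ℤ.⊖ suc n ⟧ℤ                    ≡⟨ ≡.cong ⟦_⟧ℤ (ℤ.[1+m]⊖[1+n]≡m⊖n m n) ⟩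
    ⟦ m ℤ.⊖ n ⟧ℤ                            ≈⟨ ⊖-homo m n ⟩
    m × 1# + - (n × 1#)                     ≈⟨ +-congʳ (+-identityˡ _) ⟨
    (0# + m × 1#) + - (n × 1#)              ≈⟨ +-congʳ (+-congʳ (-‿inverseʳ 1#)) ⟨
    ((1# + - 1#) + m × 1#) + - (n × 1#)     ≈⟨ +-congʳ (+-assoc _ _ _) ⟩
    (1# + (- 1# + m × 1#)) + - (n × 1#)     ≈⟨ +-congʳ (+-congˡ (+-comm _ _)) ⟩
    (1# + (m × 1# + - 1#)) + - (n × 1#)     ≈⟨ +-congʳ (+-assoc _ _ _) ⟨
    ((1# + m × 1#) + - 1#) + - (n × 1#)     ≈⟨ +-assoc _ _ _ ⟩
    (1# + m × 1#) + (- 1# + - (n × 1#))     ≈⟨ +-congˡ (⁻¹-∙-comm _ _) ⟩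
    (1# + m × 1#) + - (1# + n × 1#)         ≈⟨ +-cong (1+× m 1#) (-‿cong (1+× n 1#)) ⟨
    suc m × 1# + - (suc n × 1#)             ∎

  +-homoℤ : ∀ i j → ⟦ i ℤ.+ j ⟧ℤ ≈ ⟦ i ⟧ℤ + ⟦ j ⟧ℤ
  +-homoℤ (ℤ.+ m)      (ℤ.+ n)      = ×-homo-+ 1# m n
  +-homoℤ (ℤ.+ m)      (ℤ.-[1+ n ]) = ⊖-homo m (suc n)
  +-homoℤ (ℤ.-[1+ m ]) (ℤ.+ n)      = trans (⊖-homo n (suc m)) (+-comm _ _)
  +-homoℤ (ℤ.-[1+ m ]) (ℤ.-[1+ n ]) = begin
    - (suc (suc (m ℕ.+ n)) × 1#)             ≡⟨ ≡.cong (λ k → - (suc k × 1#)) (ℕ.+-suc m n) ⟨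
    - ((suc (m ℕ.+ suc n)) × 1#)             ≈⟨ -‿cong (×-homo-+ 1# (suc m) (suc n)) ⟩
    - (suc m × 1# + suc n × 1#)              ≈⟨ ⁻¹-∙-comm _ _ ⟨
    - (suc m × 1#) + - (suc n × 1#)          ∎

  *-homo⁺ : ∀ m j → ⟦ ℤ.+ m ℤ.* j ⟧ℤ ≈ ⟦ ℤ.+ m ⟧ℤ * ⟦ j ⟧ℤ
  *-homo⁺ m (ℤ.+ n) = begin
    ⟦ ℤ.+ m ℤ.* ℤ.+ n ⟧ℤ     ≡⟨ ≡.cong ⟦_⟧ℤ (ℤ.pos-* m n) ⟨
    (m ℕ.* n) × 1#            ≈⟨ ×1-homo-* m n ⟩
    (m × 1#) * (n × 1#)       ∎
  *-homo⁺ m (ℤ.-[1+ n ]) = begin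
    ⟦ ℤ.+ m ℤ.* ℤ.- (ℤ.+ suc n) ⟧ℤ    ≡⟨ ≡.cong ⟦_⟧ℤ (ℤ.neg-distribʳ-* (ℤ.+ m) (ℤ.+ suc n)) ⟨
    ⟦ ℤ.- (ℤ.+ m ℤ.* ℤ.+ suc n) ⟧ℤ    ≈⟨ neg-homo (ℤ.+ m ℤ.* ℤ.+ suc n) ⟩
    - ⟦ ℤ.+ m ℤ.* ℤ.+ suc n ⟧ℤ        ≈⟨ -‿cong (*-homo⁺ m (ℤ.+ suc n)) ⟩
    - ((m × 1#) * (suc n × 1#))        ≈⟨ -‿cong (*-comm _ _) ⟩
    - ((suc n × 1#) * (m × 1#))        ≈⟨ -‿distribˡ-* _ _ ⟩
    - (suc n × 1#) * (m × 1#)          ≈⟨ *-comm _ _ ⟩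
    (m × 1#) * - (suc n × 1#)          ∎

  *-homoℤ : ∀ i j → ⟦ i ℤ.* j ⟧ℤ ≈ ⟦ i ⟧ℤ * ⟦ j ⟧ℤ
  *-homoℤ (ℤ.+ m)      j = *-homo⁺ m j
  *-homoℤ (ℤ.-[1+ m ]) j = begin
    ⟦ ℤ.- (ℤ.+ suc m) ℤ.* j ⟧ℤ    ≡⟨ ≡.cong ⟦_⟧ℤ (ℤ.neg-distribˡ-* (ℤ.+ suc m) j) ⟨
    ⟦ ℤ.- (ℤ.+ suc m ℤ.* j) ⟧ℤ    ≈⟨ neg-homo (ℤ.+ suc m ℤ.* j) ⟩
    - ⟦ ℤ.+ suc m ℤ.* j ⟧ℤ        ≈⟨ -‿cong (*-homo⁺ (suc m) j) ⟩
    - ((suc m × 1#) * ⟦ j ⟧ℤ)      ≈⟨ -‿distribˡ-* _ _ ⟩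
    - (suc m × 1#) * ⟦ j ⟧ℤ        ∎

  morphismℤ : ℤ.+-*-rawRing -Raw-AlmostCommutative⟶ fromCommutativeRing R
  morphismℤ = record
    { ⟦_⟧ = ⟦_⟧ℤ ; +-homo = +-homoℤ ; *-homo = *-homoℤ ; -‿homo = neg-homo
    ; 0-homo = refl ; 1-homo = refl }

  private
    _≟ℤ_ : ∀ i j → Maybe.Maybe (⟦ i ⟧ℤ ≈ ⟦ j ⟧ℤ)
    i ≟ℤ j = Maybe.map (λ eq → reflexive (≡.cong ⟦_⟧ℤ eq)) (dec⇒maybe (i ℤ.≟ j))

    module Solver = Algebra.Solver.Ring ℤ.+-*-rawRing (fromCommutativeRing R) morphismℤ _≟ℤ_

  open Solver public using (Polynomial; solve; _:=_; _:+_; _:*_; _:-_; :-_)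

  :0 :1 : ∀ {n} → Polynomial n
  :0 = Solver.con (ℤ.+ 0)
  :1 = Solver.con (ℤ.+ 1)

-- Finite sums and finite q-Pochhammer products

module FiniteSums {c ℓ} (R : CommutativeRing c ℓ) where
  open CommutativeRing R
  open Algebra.Properties.CommutativeSemiring.Exp commutativeSemiring using (_^_; ^-homo-*; ^-congˡ; ^-assocʳ; ^-distrib-*)
  open IntegerCoefficients R
  open Relation.Binary.Reasoning.Setoid setoid

  psum : ℕ → (ℕ → Carrier) → Carrier
  psum zero    f = 0#
  psum (suc n) f = psum n f + f n

  psum-cong : ∀ n {f g : ℕ → Carrier} → (∀ k → f k ≈ g k) → psum n f ≈ psum n g
  psum-cong zero    eq = refl
  psum-cong (suc n) eq = +-cong (psum-cong n eq) (eq n)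

  psum-+ : ∀ n f g → psum n (λ k → f k + g k) ≈ psum n f + psum n g
  psum-+ zero    f g = sym (+-identityˡ 0#)
  psum-+ (suc n) f g = trans (+-congʳ (psum-+ n f g))
    (solve 4 (λ a b c d → (a :+ b) :+ (c :+ d) := (a :+ c) :+ (b :+ d)) refl _ _ _ _)

  psum-* : ∀ n a f → psum n (λ k → a * f k) ≈ a * psum n f
  psum-* zero    a f = sym (zeroʳ a)
  psum-* (suc n) a f = trans (+-congʳ (psum-* n a f)) (sym (distribˡ a _ _))

  psum-head : ∀ n f → psum (suc n) f ≈ f 0 + psum n (λ k → f (suc k))
  psum-head zero    f = +-comm _ _
  psum-head (suc n) f = trans (+-congʳ (psum-head n f)) (+-assoc _ _ _)

  psum-pairs : ∀ n f → psum (n ℕ.+ n) f ≈ psum n (λ k → f (k ℕ.+ k) + f (suc (k ℕ.+ k)))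
  psum-pairs zero    f = refl
  psum-pairs (suc n) f rewrite ℕ.+-suc n n =
    trans (+-assoc _ _ _) (+-congʳ (psum-pairs n f))

  psum-triples : ∀ n f → psum (3 ℕ.* n) f ≈
    psum n (λ k → f (3 ℕ.* k) + f (1 ℕ.+ 3 ℕ.* k) + f (2 ℕ.+ 3 ℕ.* k))
  psum-triples zero    f = refl
  psum-triples (suc n) f = trans (reflexive (≡.cong (λ j → psum j f) (ℕ.*-suc 3 n))) (
    trans (solve 4 (λ a b c d → ((a :+ b) :+ c) :+ d := a :+ ((b :+ c) :+ d)) refl _ _ _ _) (+-congʳ (psum-triples n f)))

  -- Summing over pairs with k + m = n keeps n - k at hand as m, so that no truncated subtraction
  -- appears.
  diag : ℕ → (ℕ → ℕ → Carrier) → Carrier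
  diag zero    f = f 0 0
  diag (suc n) f = f 0 (suc n) + diag n (λ k m → f (suc k) m)

  diag-cong : ∀ n {f g : ℕ → ℕ → Carrier} → (∀ k m → k ℕ.+ m ≡ n → f k m ≈ g k m) → diag n f ≈ diag n g
  diag-cong zero    eq = eq 0 0 ≡.refl
  diag-cong (suc n) eq = +-cong (eq 0 (suc n) ≡.refl) (diag-cong n (λ k m p → eq (suc k) m (≡.cong suc p)))

  diag-+ : ∀ n f g → diag n (λ k m → f k m + g k m) ≈ diag n f + diag n g
  diag-+ zero    f g = refl
  diag-+ (suc n) f g = trans (+-congˡ (diag-+ n _ _))
    (solve 4 (λ a b c d → (a :+ b) :+ (c :+ d) := (a :+ c) :+ (b :+ d)) refl _ _ _ _)

  diag-* : ∀ n a f → diag n (λ k m → a * f k m) ≈ a * diag n f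
  diag-* zero    a f = refl
  diag-* (suc n) a f = trans (+-congˡ (diag-* n a _)) (sym (distribˡ _ _ _))

  diag-last : ∀ n f → diag (suc n) f ≈ diag n (λ k m → f k (suc m)) + f (suc n) 0
  diag-last zero    f = refl
  diag-last (suc n) f = trans (+-congˡ (diag-last n (λ k m → f (suc k) m))) (sym (+-assoc _ _ _))

  -- The triangle k + m ≤ N is cut into its row k = 0 and the triangle of the remaining rows: the
  -- induction step for interchanging two summations.
  psum-diag : ∀ N F → psum (suc N) (λ n → diag n F) ≈ psum (suc N) (F 0) + psum N (λ n → diag n (λ k m → F (suc k) m))
  psum-diag zero    F = sym (+-identityʳ _)
  psum-diag (suc N) F = trans (+-congʳ (psum-diag N F))
    (solve 4 (λ a b c d → (a :+ b) :+ (c :+ d) := (a :+ c) :+ (b :+ d)) refl _ _ _ _)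

  -- rising Q x n is (x; Q)_n.
  rising : Carrier → Carrier → ℕ → Carrier
  rising Q x zero    = 1#
  rising Q x (suc n) = rising Q x n * (1# - x * Q ^ n)

  rising-cong : ∀ {Q Q′ x x′} → Q ≈ Q′ → x ≈ x′ → ∀ n → rising Q x n ≈ rising Q′ x′ n
  rising-cong Q≈ x≈ zero    = refl
  rising-cong Q≈ x≈ (suc n) = *-cong (rising-cong Q≈ x≈ n) (+-congˡ (-‿cong (*-cong x≈ (^-congˡ n Q≈))))

  -- (1 - z)(1 + z) = 1 - z², factor by factor.
  rising-negate : ∀ Q x n → rising Q x n * rising Q (- x) n ≈ rising (Q * Q) (x * x) n
  rising-negate Q x zero    = *-identityˡ 1#
  rising-negate Q x (suc n) = begin
    (rising Q x n * (1# - x * Q ^ n)) * (rising Q (- x) n * (1# - (- x) * Q ^ n))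
      ≈⟨ solve 4 (λ a b x p → (a :* (:1 :- x :* p)) :* (b :* (:1 :- (:- x) :* p)) := (a :* b) :* (:1 :- (x :* x) :* (p :* p))) refl _ _ _ _ ⟩
    (rising Q x n * rising Q (- x) n) * (1# - (x * x) * (Q ^ n * Q ^ n))
      ≈⟨ *-cong (rising-negate Q x n) (+-congˡ (-‿cong (*-congˡ (sym (^-distrib-* Q Q n))))) ⟩
    rising (Q * Q) (x * x) n * (1# - (x * x) * (Q * Q) ^ n) ∎

  -- The factors with even and with odd powers of r interleave.
  rising-pairs : ∀ r x n → rising (r * r) x n * rising (r * r) (x * r) n ≈ rising r x (n ℕ.+ n)
  rising-pairs r x zero    = *-identityˡ 1#
  rising-pairs r x (suc n) rewrite ℕ.+-suc n n = begin
    (rising (r * r) x n * (1# - x * (r * r) ^ n)) * (rising (r * r) (x * r) n * (1# - (x * r) * (r * r) ^ n))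
      ≈⟨ solve 5 (λ a b x r p → (a :* (:1 :- x :* p)) :* (b :* (:1 :- (x :* r) :* p)) := ((a :* b) :* (:1 :- x :* p)) :* (:1 :- x :* (r :* p))) refl _ _ _ _ _ ⟩
    ((rising (r * r) x n * rising (r * r) (x * r) n) * (1# - x * (r * r) ^ n)) * (1# - x * (r * (r * r) ^ n))
      ≈⟨ *-cong (*-cong (rising-pairs r x n) (+-congˡ (-‿cong (*-congˡ pow)))) (+-congˡ (-‿cong (*-congˡ (*-congˡ pow)))) ⟩
    (rising r x (n ℕ.+ n) * (1# - x * r ^ (n ℕ.+ n))) * (1# - x * r ^ suc (n ℕ.+ n)) ∎
    where
    pow : (r * r) ^ n ≈ r ^ (n ℕ.+ n)
    pow = trans (^-distrib-* r r n) (sym (^-homo-* r n n))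

  rising-pairs-suc : ∀ r x n → rising (r * r) x (suc n) * rising (r * r) (x * r) n ≈ rising r x (suc (n ℕ.+ n))
  rising-pairs-suc r x n = begin
    (rising (r * r) x n * (1# - x * (r * r) ^ n)) * rising (r * r) (x * r) n
      ≈⟨ solve 3 (λ a b c → (a :* b) :* c := (a :* c) :* b) refl _ _ _ ⟩
    (rising (r * r) x n * rising (r * r) (x * r) n) * (1# - x * (r * r) ^ n)
      ≈⟨ *-cong (rising-pairs r x n) (+-congˡ (-‿cong (*-congˡ (trans (^-distrib-* r r n) (sym (^-homo-* r n n)))))) ⟩
    rising r x (n ℕ.+ n) * (1# - x * r ^ (n ℕ.+ n)) ∎

  -- The three residue classes of exponents modulo 3 interleave. The class of 1 has one factor more,
  -- since the exponents run from 1 to 3n + 1.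
  rising-triples-suc : ∀ r n → let r³ = r * (r * r) in
    (rising r³ r (suc n) * rising r³ (r * r) n) * rising r³ r³ n ≈ rising r r (suc (3 ℕ.* n))
  rising-triples-suc r zero    = solve 1 (λ r → ((:1 :* (:1 :- r :* :1)) :* :1) :* :1 := :1 :* (:1 :- r :* :1)) refl r
  rising-triples-suc r (suc n) = begin
    ((A * (1# - r * r³ ^ suc n)) * (B * (1# - (r * r) * p))) * (C * (1# - r³ * p))
      ≈⟨ solve 6 (λ A B C r p q → ((A :* (:1 :- r :* q)) :* (B :* (:1 :- (r :* r) :* p))) :* (C :* (:1 :- (r :* (r :* r)) :* p)) :=
           ((((A :* B) :* C) :* (:1 :- r :* (r :* p))) :* (:1 :- r :* (r :* (r :* p)))) :* (:1 :- r :* q)) refl A B C r p (r³ ^ suc n) ⟩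
    ((((A * B) * C) * (1# - r * (r * p))) * (1# - r * (r * (r * p)))) * (1# - r * r³ ^ suc n)
      ≈⟨ *-cong (*-cong (*-cong (rising-triples-suc r n) (1-r* (*-congˡ pow))) (1-r* (*-congˡ (*-congˡ pow))))
                (1-r* (trans (solve 2 (λ r p → (r :* (r :* r)) :* p := r :* (r :* (r :* p))) refl r p) (*-congˡ (*-congˡ (*-congˡ pow))))) ⟩
    rising r r (suc (3 ℕ.+ 3 ℕ.* n))
      ≡⟨ ≡.cong (λ j → rising r r (suc j)) (ℕ.*-suc 3 n) ⟨
    rising r r (suc (3 ℕ.* suc n)) ∎
    where
    r³ A B C p : Carrier
    r³ = r * (r * r)
    A = rising r³ r (suc n)
    B = rising r³ (r * r) n
    C = rising r³ r³ n
    p = r³ ^ n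
    pow : p ≈ r ^ (3 ℕ.* n)
    pow = trans (^-congˡ n (*-congˡ (*-congˡ (sym (*-identityʳ r))))) (^-assocʳ r 3 n)
    1-r* : ∀ {a b} → a ≈ b → 1# - r * a ≈ 1# - r * b
    1-r* eq = +-congˡ (-‿cong (*-congˡ eq))

-- Bailey pairs in a commutative ring

module BaileyTerms {c ℓ} (R : CommutativeRing c ℓ)
  (Q : CommutativeRing.Carrier R) (i : ℕ → CommutativeRing.Carrier R) where
  open CommutativeRing R
  open Algebra.Properties.Semiring.Exp semiring using (_^_)
  open FiniteSums R

  -- For e = 1 this is the n-th entry β of the Bailey pair with α = T (relative to a = Q).
  β : ℕ → ℕ → (ℕ → Carrier) → Carrier
  β e n T = diag n (λ k m → T k * (i m * i (e ℕ.+ (m ℕ.+ (k ℕ.+ k)))))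

  -- This is (-1)^k Q^(k(k-1)/2). Up to the normalising factor 1 - Q, `u` is then the α of the unit
  -- Bailey pair relative to a = Q.
  u₀ : ℕ → Carrier
  u₀ zero    = 1#
  u₀ (suc k) = - (Q ^ k * u₀ k)

  u : ℕ → Carrier
  u k = u₀ k * (1# - Q ^ suc (k ℕ.+ k))

  -- The generating function of partitions whose Durfee rectangle is m × (m + a).
  durfee : ℕ → ℕ → Carrier
  durfee a m = Q ^ (m ℕ.* m ℕ.+ a ℕ.* m) * (i m * i (m ℕ.+ a))

-- i n = 1 / (Q; Q)_n
record IsReciprocalFactorial {c ℓ} (R : CommutativeRing c ℓ)
  (Q : CommutativeRing.Carrier R) (i : ℕ → CommutativeRing.Carrier R) : Set (c ⊔ ℓ) where
  open CommutativeRing R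
  open Algebra.Properties.Semiring.Exp semiring using (_^_)
  field
    i-zero : i 0 ≈ 1#
    i-suc  : ∀ n → (1# - Q ^ suc n) * i (suc n) ≈ i n
    -- The closed forms below are proved after multiplication by such a factor.
    cancel : ∀ n {u v} → (1# - Q ^ suc n) * u ≈ (1# - Q ^ suc n) * v → u ≈ v

module BaileyPairs {c ℓ} (R : CommutativeRing c ℓ)
  (Q : CommutativeRing.Carrier R) (i : ℕ → CommutativeRing.Carrier R) (F : IsReciprocalFactorial R Q i) where
  open CommutativeRing R
  open IsReciprocalFactorial F
  open BaileyTerms R Q i
  open Algebra.Properties.Semiring.Exp semiring using (_^_; ^-homo-*; ^-congʳ)
  open IntegerCoefficients R
  open FiniteSums R
  open Relation.Binary.Reasoning.Setoid setoid

  -- i (n - 1), with i (-1) = 0.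
  i⁻ : ℕ → Carrier
  i⁻ zero    = 0#
  i⁻ (suc n) = i n

  i-pred : ∀ n → (1# - Q ^ n) * i n ≈ i⁻ n
  i-pred zero    = trans (*-congʳ (-‿inverseʳ 1#)) (zeroˡ _)
  i-pred (suc n) = i-suc n

  diag-i⁻-suc : ∀ n (f : ℕ → ℕ → Carrier) → diag (suc n) (λ k m → f k m * i⁻ m) ≈ diag n (λ k m → f k (suc m) * i m)
  diag-i⁻-suc n f = trans (diag-last n (λ k m → f k m * i⁻ m)) (trans (+-congˡ (zeroʳ (f (suc n) 0))) (+-identityʳ _))

  private
    pow-2n : ∀ e k m → Q ^ (e ℕ.+ ((k ℕ.+ m) ℕ.+ (k ℕ.+ m))) ≈ Q ^ m * Q ^ (e ℕ.+ (m ℕ.+ (k ℕ.+ k)))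
    pow-2n e k m = trans (^-congʳ Q (lem e k m)) (^-homo-* Q m _)
      where
      lem : ∀ e k m → e ℕ.+ ((k ℕ.+ m) ℕ.+ (k ℕ.+ m)) ≡ m ℕ.+ (e ℕ.+ (m ℕ.+ (k ℕ.+ k)))
      lem = ℕSolver.solve-∀

    -- 1 - uw = (1 - w) + w (1 - u): one part lowers the index of the factorial in `b`, the other
    -- that in `a`. The opposite order, 1 - uw = (1 - u) + u (1 - w), is `splitʳ`.
    splitˡ : ∀ {T a b c d u w p} → (1# - u) * a ≈ d → (1# - w) * b ≈ c → p ≈ u * w →
             (1# - p) * (T * (a * b)) ≈ T * (a * c) + ((T * w) * b) * d
    splitˡ {T} {a} {b} {c} {d} {u} {w} {p} du dw dp = begin
      (1# - p) * (T * (a * b))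
        ≈⟨ *-congʳ (+-congˡ (-‿cong dp)) ⟩
      (1# - u * w) * (T * (a * b))
        ≈⟨ solve 5 (λ T a b u w → (:1 :- u :* w) :* (T :* (a :* b)) :=
             T :* (a :* ((:1 :- w) :* b)) :+ ((T :* w) :* b) :* ((:1 :- u) :* a)) refl T a b u w ⟩
      T * (a * ((1# - w) * b)) + ((T * w) * b) * ((1# - u) * a)
        ≈⟨ +-cong (*-congˡ (*-congˡ dw)) (*-congˡ du) ⟩
      T * (a * c) + ((T * w) * b) * d ∎

    splitʳ : ∀ {T a b c d u w p} → (1# - u) * a ≈ d → (1# - w) * b ≈ c → p ≈ u * w →
             (1# - p) * (T * (a * b)) ≈ (T * b) * d + (T * u) * (a * c)
    splitʳ {T} {a} {b} {c} {d} {u} {w} {p} du dw dp = begin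
      (1# - p) * (T * (a * b))
        ≈⟨ *-congʳ (+-congˡ (-‿cong dp)) ⟩
      (1# - u * w) * (T * (a * b))
        ≈⟨ solve 5 (λ T a b u w → (:1 :- u :* w) :* (T :* (a :* b)) :=
             (T :* b) :* ((:1 :- u) :* a) :+ (T :* u) :* (a :* ((:1 :- w) :* b))) refl T a b u w ⟩
      (T * b) * ((1# - u) * a) + (T * u) * (a * ((1# - w) * b))
        ≈⟨ +-cong (*-congˡ du) (*-congˡ (*-congˡ dw)) ⟩
      (T * b) * d + (T * u) * (a * c) ∎

  -- The factor splits as (1 - Q^(m+2k+e+1)) + Q^(m+2k+e+1) (1 - Q^m). The first part gives
  -- `β e n T`. In the second, m drops by one and the recurrence of T lets the pair be read as (k +
  -- 1, m - 1) in `β e n T`, where only the term k = 0 is missed; it is subtracted at the end.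
  β-lowerˡ : ∀ e z (T : ℕ → Carrier) → (∀ k → T k * Q ^ (suc e ℕ.+ k) ≈ z * T (suc k)) → ∀ n →
    (1# - Q ^ suc (e ℕ.+ (n ℕ.+ n))) * β (suc e) n T ≈
    β e n T + (z * Q ^ n) * (β e n T - T 0 * (i n * i (e ℕ.+ n)))
  β-lowerˡ e z T rec n = begin
    (1# - Q ^ suc (e ℕ.+ (n ℕ.+ n))) * β (suc e) n T
      ≈⟨ diag-* n _ _ ⟨
    diag n (λ k m → (1# - Q ^ suc (e ℕ.+ (n ℕ.+ n))) * (T k * (i m * i (suc e ℕ.+ (m ℕ.+ (k ℕ.+ k))))))
      ≈⟨ diag-cong n (λ { k m ≡.refl → splitˡ {T k} (i-pred m) (i-suc _) (pow-2n (suc e) k m) }) ⟩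
    diag n (λ k m → T k * (i m * i (e ℕ.+ (m ℕ.+ (k ℕ.+ k)))) + rest k m * i⁻ m)
      ≈⟨ diag-+ n (λ k m → T k * (i m * i (e ℕ.+ (m ℕ.+ (k ℕ.+ k))))) (λ k m → rest k m * i⁻ m) ⟩
    β e n T + diag n (λ k m → rest k m * i⁻ m)
      ≈⟨ +-congˡ (tail n) ⟩
    β e n T + (z * Q ^ n) * (β e n T - T 0 * (i n * i (e ℕ.+ n))) ∎
    where
    rest : ℕ → ℕ → Carrier
    rest k m = (T k * Q ^ (suc e ℕ.+ (m ℕ.+ (k ℕ.+ k)))) * i (suc e ℕ.+ (m ℕ.+ (k ℕ.+ k)))

    head-cancel : ∀ w a b → w * b ≈ w * ((a + b) - a)
    head-cancel = solve 3 (λ w a b → w :* b := w :* ((a :+ b) :- a)) refl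

    lemᵢ : ∀ e k m → suc e ℕ.+ (suc m ℕ.+ (k ℕ.+ k)) ≡ e ℕ.+ (m ℕ.+ (suc k ℕ.+ suc k))
    lemᵢ = ℕSolver.solve-∀

    lemₚ : ∀ e k m → suc e ℕ.+ (suc m ℕ.+ (k ℕ.+ k)) ≡ (suc e ℕ.+ k) ℕ.+ (suc (k ℕ.+ m))
    lemₚ = ℕSolver.solve-∀

    tail : ∀ n → diag n (λ k m → rest k m * i⁻ m) ≈
                 (z * Q ^ n) * (β e n T - T 0 * (i n * i (e ℕ.+ n)))
    tail zero    = trans (zeroʳ _) (sym (trans (*-congˡ (-‿inverseʳ _)) (zeroʳ _)))
    tail (suc n) = begin
      diag (suc n) (λ k m → rest k m * i⁻ m)
        ≈⟨ diag-i⁻-suc n rest ⟩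
      diag n (λ k m → rest k (suc m) * i m)
        ≈⟨ diag-cong n (λ { k m ≡.refl → begin
             ((T k * Q ^ (suc e ℕ.+ (suc m ℕ.+ (k ℕ.+ k)))) * i (suc e ℕ.+ (suc m ℕ.+ (k ℕ.+ k)))) * i m
               ≈⟨ *-congʳ (*-cong (*-congˡ (trans (^-congʳ Q (lemₚ e k m)) (^-homo-* Q (suc e ℕ.+ k) _)))
                                  (reflexive (≡.cong i (lemᵢ e k m)))) ⟩
             ((T k * (Q ^ (suc e ℕ.+ k) * Q ^ suc (k ℕ.+ m))) * i (e ℕ.+ (m ℕ.+ (suc k ℕ.+ suc k)))) * i m
               ≈⟨ solve 5 (λ t p q a b → ((t :* (p :* q)) :* a) :* b := (t :* p) :* (q :* (b :* a))) refl _ _ _ _ _ ⟩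
             (T k * Q ^ (suc e ℕ.+ k)) * (Q ^ suc (k ℕ.+ m) * (i m * i (e ℕ.+ (m ℕ.+ (suc k ℕ.+ suc k)))))
               ≈⟨ *-congʳ (rec k) ⟩
             (z * T (suc k)) * (Q ^ suc (k ℕ.+ m) * (i m * i (e ℕ.+ (m ℕ.+ (suc k ℕ.+ suc k)))))
               ≈⟨ solve 4 (λ z t q a → (z :* t) :* (q :* a) := (z :* q) :* (t :* a)) refl _ _ _ _ ⟩
             (z * Q ^ suc (k ℕ.+ m)) * (T (suc k) * (i m * i (e ℕ.+ (m ℕ.+ (suc k ℕ.+ suc k))))) ∎ }) ⟩
      diag n (λ k m → (z * Q ^ suc n) * (T (suc k) * (i m * i (e ℕ.+ (m ℕ.+ (suc k ℕ.+ suc k))))))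
        ≈⟨ diag-* n _ _ ⟩
      (z * Q ^ suc n) * diag n (λ k m → T (suc k) * (i m * i (e ℕ.+ (m ℕ.+ (suc k ℕ.+ suc k)))))
        ≈⟨ head-cancel _ _ _ ⟩
      (z * Q ^ suc n) * (β e (suc n) T - T 0 * (i (suc n) * i (e ℕ.+ (suc n ℕ.+ 0))))
        ≈⟨ *-congˡ (+-congˡ (-‿cong (*-congˡ (*-congˡ (reflexive (≡.cong (λ j → i (e ℕ.+ j)) (ℕ.+-identityʳ (suc n)))))))) ⟩
      (z * Q ^ suc n) * (β e (suc n) T - T 0 * (i (suc n) * i (e ℕ.+ suc n))) ∎

  -- The split (1 - Q^m) + Q^m (1 - Q^(e+m+2k)) lowers m in the first part, giving the pair (k, m -
  -- 1) of `β (suc e) n T`, and the other index in the second part, giving (k - 1, m). The term k =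
  -- 0 of the second part has no such partner and remains as the boundary term.
  β-lowerʳ : ∀ e z (T : ℕ → Carrier) → (∀ k → T (suc k) ≈ z * (Q ^ k * T k)) → ∀ n →
    (1# - Q ^ (e ℕ.+ (suc n ℕ.+ suc n))) * β e (suc n) T ≈
    β (suc e) n T + (T 0 * (Q ^ suc n * (i (suc n) * i⁻ (e ℕ.+ suc n))) + (z * Q ^ n) * β (suc e) n T)
  β-lowerʳ e z T rec n = begin
    (1# - Q ^ (e ℕ.+ (suc n ℕ.+ suc n))) * β e (suc n) T
      ≈⟨ diag-* (suc n) _ (λ k m → T k * (i m * i (e ℕ.+ (m ℕ.+ (k ℕ.+ k))))) ⟨
    diag (suc n) (λ k m → (1# - Q ^ (e ℕ.+ (suc n ℕ.+ suc n))) * (T k * (i m * i (e ℕ.+ (m ℕ.+ (k ℕ.+ k))))))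
      ≈⟨ diag-cong (suc n) (λ { k m p → splitʳ {T k} (i-pred m) (i-pred (e ℕ.+ (m ℕ.+ (k ℕ.+ k)))) (trans
           (reflexive (≡.cong (λ l → Q ^ (e ℕ.+ (l ℕ.+ l))) (≡.sym p))) (pow-2n e k m)) }) ⟩
    diag (suc n) (λ k m → (T k * i (e ℕ.+ (m ℕ.+ (k ℕ.+ k)))) * i⁻ m + rest k m)
      ≈⟨ diag-+ (suc n) (λ k m → lead k m * i⁻ m) rest ⟩
    diag (suc n) (λ k m → (T k * i (e ℕ.+ (m ℕ.+ (k ℕ.+ k)))) * i⁻ m) + diag (suc n) rest
      ≈⟨ +-cong (trans (diag-i⁻-suc n lead) (diag-cong n (λ k m p → first k m))) (+-cong head (diag-cong n tail)) ⟩
    β (suc e) n T + (T 0 * (Q ^ suc n * (i (suc n) * i⁻ (e ℕ.+ suc n))) +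
      diag n (λ k m → (z * Q ^ n) * (T k * (i m * i (suc e ℕ.+ (m ℕ.+ (k ℕ.+ k)))))))
      ≈⟨ +-congˡ (+-congˡ (diag-* n _ _)) ⟩
    β (suc e) n T + (T 0 * (Q ^ suc n * (i (suc n) * i⁻ (e ℕ.+ suc n))) + (z * Q ^ n) * β (suc e) n T) ∎
    where
    lead rest : ℕ → ℕ → Carrier
    lead k m = T k * i (e ℕ.+ (m ℕ.+ (k ℕ.+ k)))
    rest k m = (T k * Q ^ m) * (i m * i⁻ (e ℕ.+ (m ℕ.+ (k ℕ.+ k))))

    first : ∀ k m → (T k * i (e ℕ.+ (suc m ℕ.+ (k ℕ.+ k)))) * i m ≈ T k * (i m * i (suc e ℕ.+ (m ℕ.+ (k ℕ.+ k))))
    first k m = trans (*-congʳ (*-congˡ (reflexive (≡.cong i (ℕ.+-suc e _)))))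
      (solve 3 (λ t a b → (t :* a) :* b := t :* (b :* a)) refl _ _ _)

    head : rest 0 (suc n) ≈ T 0 * (Q ^ suc n * (i (suc n) * i⁻ (e ℕ.+ suc n)))
    head = trans (*-assoc _ _ _) (*-congˡ (*-congˡ (*-congˡ (reflexive (≡.cong (λ j → i⁻ (e ℕ.+ j)) (ℕ.+-identityʳ (suc n)))))))

    lemᵢ : ∀ e k m → e ℕ.+ (m ℕ.+ (suc k ℕ.+ suc k)) ≡ suc (suc e ℕ.+ (m ℕ.+ (k ℕ.+ k)))
    lemᵢ = ℕSolver.solve-∀

    tail : ∀ k m → k ℕ.+ m ≡ n → rest (suc k) m ≈ (z * Q ^ n) * (T k * (i m * i (suc e ℕ.+ (m ℕ.+ (k ℕ.+ k)))))
    tail k m ≡.refl = begin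
      (T (suc k) * Q ^ m) * (i m * i⁻ (e ℕ.+ (m ℕ.+ (suc k ℕ.+ suc k))))
        ≈⟨ *-cong (*-congʳ (rec k)) (*-congˡ (reflexive (≡.cong i⁻ (lemᵢ e k m)))) ⟩
      ((z * (Q ^ k * T k)) * Q ^ m) * (i m * i (suc e ℕ.+ (m ℕ.+ (k ℕ.+ k))))
        ≈⟨ solve 5 (λ z p t q a → ((z :* (p :* t)) :* q) :* a := (z :* (p :* q)) :* (t :* a)) refl _ _ _ _ _ ⟩
      (z * (Q ^ k * Q ^ m)) * (T k * (i m * i (suc e ℕ.+ (m ℕ.+ (k ℕ.+ k)))))
        ≈⟨ *-congʳ (*-congˡ (^-homo-* Q k m)) ⟨
      (z * Q ^ (k ℕ.+ m)) * (T k * (i m * i (suc e ℕ.+ (m ℕ.+ (k ℕ.+ k))))) ∎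

  private
    -- The terms k ≥ K of β 1 (K + n) u; unlike the full sum, these tails have a closed form for n > 0.
    tail-u : ℕ → ℕ → Carrier
    tail-u K n = diag n (λ k m → u (K ℕ.+ k) * (i m * i (suc (m ℕ.+ ((K ℕ.+ k) ℕ.+ (K ℕ.+ k))))))

    -- Splitting off the first term of the tail replaces (n + 1, K) by (n, K + 1). The factor 1 -
    -- Q^(n+K) thus stays the same throughout the induction, and each step is a polynomial identity.
    tail-u-closed : ∀ n K → (1# - Q ^ (n ℕ.+ K)) * tail-u K n ≈ (u₀ K * (1# - Q ^ K)) * (i n * i (n ℕ.+ (K ℕ.+ K)))
    tail-u-closed zero    K = begin
      (1# - Q ^ K) * (u (K ℕ.+ 0) * (i 0 * i (suc ((K ℕ.+ 0) ℕ.+ (K ℕ.+ 0)))))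
        ≈⟨ *-congˡ (reflexive (≡.cong (λ j → u j * (i 0 * i (suc (j ℕ.+ j)))) (ℕ.+-identityʳ K))) ⟩
      (1# - Q ^ K) * ((u₀ K * (1# - Q ^ suc (K ℕ.+ K))) * (i 0 * i (suc (K ℕ.+ K))))
        ≈⟨ solve 5 (λ a b c d e → a :* ((b :* c) :* (d :* e)) := (b :* a) :* (d :* (c :* e))) refl _ _ _ _ _ ⟩
      (u₀ K * (1# - Q ^ K)) * (i 0 * ((1# - Q ^ suc (K ℕ.+ K)) * i (suc (K ℕ.+ K))))
        ≈⟨ *-congˡ (*-congˡ (i-suc _)) ⟩
      (u₀ K * (1# - Q ^ K)) * (i 0 * i (K ℕ.+ K)) ∎
    tail-u-closed (suc n) K = begin
      (1# - Q ^ (suc n ℕ.+ K)) * tail-u K (suc n)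
        ≈⟨ *-congˡ (+-cong
             (reflexive (≡.cong (λ j → u j * (i (suc n) * i (suc (suc n ℕ.+ (j ℕ.+ j))))) (ℕ.+-identityʳ K)))
             (diag-cong n (λ k m _ → reflexive (≡.cong (λ j → u j * (i m * i (suc (m ℕ.+ (j ℕ.+ j))))) (ℕ.+-suc K k))))) ⟩
      (1# - Q ^ (suc n ℕ.+ K)) * (u K * (a * b) + tail-u (suc K) n)
        ≈⟨ distribˡ _ _ _ ⟩
      (1# - Q ^ (suc n ℕ.+ K)) * (u K * (a * b)) + (1# - Q ^ (suc n ℕ.+ K)) * tail-u (suc K) n
        ≈⟨ +-congˡ (*-congʳ (reflexive (≡.cong (λ j → 1# - Q ^ j) (≡.sym (ℕ.+-suc n K))))) ⟩
      (1# - Q ^ (suc n ℕ.+ K)) * (u K * (a * b)) + (1# - Q ^ (n ℕ.+ suc K)) * tail-u (suc K) n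
        ≈⟨ +-congˡ (tail-u-closed n (suc K)) ⟩
      (1# - Q ^ (suc n ℕ.+ K)) * (u K * (a * b)) + (u₀ (suc K) * (1# - Q ^ suc K)) * (i n * i (n ℕ.+ (suc K ℕ.+ suc K)))
        ≈⟨ +-cong (*-cong (+-congˡ (-‿cong (^-homo-* Q (suc n) K))) (*-congʳ (*-congˡ (+-congˡ (-‿cong (*-congˡ (^-homo-* Q K K)))))))
                  (*-congˡ (*-cong (sym (i-suc n)) (reflexive (≡.cong i (lem₁ n K))))) ⟩
      (1# - x * y) * ((s * (1# - Q * (y * y))) * (a * b)) + (- (y * s) * (1# - Q * y)) * (((1# - x) * a) * b)
        ≈⟨ solve 6 (λ q x y s a b →
             (:1 :- x :* y) :* ((s :* (:1 :- q :* (y :* y))) :* (a :* b)) :+ ((:- (y :* s)) :* (:1 :- q :* y)) :* (((:1 :- x) :* a) :* b)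
             := (s :* (:1 :- y)) :* (a :* ((:1 :- q :* (x :* (y :* y))) :* b))) refl Q x y s a b ⟩
      (s * (1# - y)) * (a * ((1# - Q * (x * (y * y))) * b))
        ≈⟨ *-congˡ (*-congˡ (*-congʳ (+-congˡ (-‿cong (*-congˡ (trans (*-congˡ (sym (^-homo-* Q K K))) (sym (^-homo-* Q (suc n) (K ℕ.+ K))))))))) ⟩
      (s * (1# - y)) * (a * ((1# - Q ^ suc (suc n ℕ.+ (K ℕ.+ K))) * b))
        ≈⟨ *-congˡ (*-congˡ (i-suc _)) ⟩
      (s * (1# - y)) * (a * i (suc n ℕ.+ (K ℕ.+ K))) ∎
      where
      a b x y s : Carrier
      a = i (suc n)
      b = i (suc (suc n ℕ.+ (K ℕ.+ K)))
      x = Q ^ suc n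
      y = Q ^ K
      s = u₀ K
      lem₁ : ∀ n K → n ℕ.+ (suc K ℕ.+ suc K) ≡ suc (suc n ℕ.+ (K ℕ.+ K))
      lem₁ = ℕSolver.solve-∀

  β-u-zero : β 1 0 u ≈ 1#
  β-u-zero = begin
    (1# * (1# - Q ^ 1)) * (i 0 * i 1) ≈⟨ solve 3 (λ a b c → (:1 :* a) :* (b :* c) := b :* (a :* c)) refl _ _ _ ⟩
    i 0 * ((1# - Q ^ 1) * i 1)        ≈⟨ *-cong i-zero (trans (i-suc 0) i-zero) ⟩
    1# * 1#                           ≈⟨ *-identityˡ 1# ⟩
    1# ∎

  -- At K = 0 the closed form of the tail carries the factor 1 - Q^0 = 0.
  β-u-suc : ∀ n → β 1 (suc n) u ≈ 0#
  β-u-suc n = cancel n (begin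
    (1# - Q ^ suc n) * β 1 (suc n) u
      ≈⟨ *-congʳ (reflexive (≡.cong (λ j → 1# - Q ^ j) (ℕ.+-identityʳ (suc n)))) ⟨
    (1# - Q ^ (suc n ℕ.+ 0)) * tail-u 0 (suc n)
      ≈⟨ tail-u-closed (suc n) 0 ⟩
    (1# * (1# - 1#)) * (i (suc n) * i (suc n ℕ.+ 0))
      ≈⟨ solve 3 (λ a b c → (:1 :* (:1 :- :1)) :* (a :* b) := c :* :0) refl _ _ _ ⟩
    (1# - Q ^ suc n) * 0# ∎)

  -- Bailey pairs with β_n = 1/((x; Q)_(n+1) (y; Q)_(n+1))

  module PartialFractions (x y : Carrier) (xy : x * y ≈ Q) (Z : ℕ → Carrier)
    (Z-inv : ∀ k → ((1# - x * Q ^ k) * (1# - y * Q ^ k)) * Z k ≈ 1#) where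

    pf : ℕ → Carrier
    pf k = u k * (Q ^ k * Z k)

    private
      -- With w = Q^k and v = Q^m, (1 - xwv)(1 - ywv) = v (1 - xw)(1 - yw) + (1 - v)(1 - xy v w²).
      -- The first part cancels `Z k` and leaves the unit pair. In the second, xy = Q turns the last
      -- factor into 1 - Q^(m+2k+1), and both factorials drop by one, as in β of index n - 1.
      term : ∀ k m → let n = k ℕ.+ m in
        ((1# - x * Q ^ n) * (1# - y * Q ^ n)) * (pf k * (i m * i (suc (m ℕ.+ (k ℕ.+ k))))) ≈
        Q ^ n * (u k * (i m * i (suc (m ℕ.+ (k ℕ.+ k))))) + (pf k * i (m ℕ.+ (k ℕ.+ k))) * i⁻ m
      term k m = begin
        ((1# - x * Q ^ (k ℕ.+ m)) * (1# - y * Q ^ (k ℕ.+ m))) * (pf k * (a * b))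
          ≈⟨ *-congʳ (*-cong (+-congˡ (-‿cong (*-congˡ (^-homo-* Q k m)))) (+-congˡ (-‿cong (*-congˡ (^-homo-* Q k m))))) ⟩
        ((1# - x * (w * v)) * (1# - y * (w * v))) * ((u k * (w * Z k)) * (a * b))
          ≈⟨ solve 8 (λ x y w v t z a b →
               ((:1 :- x :* (w :* v)) :* (:1 :- y :* (w :* v))) :* ((t :* (w :* z)) :* (a :* b)) :=
               (w :* v) :* (((((:1 :- x :* w) :* (:1 :- y :* w)) :* z) :* t) :* (a :* b)) :+
               ((t :* (w :* z)) :* ((:1 :- (x :* y) :* (v :* (w :* w))) :* b)) :* ((:1 :- v) :* a)) refl x y w v (u k) (Z k) a b ⟩
        (w * v) * (((((1# - x * w) * (1# - y * w)) * Z k) * u k) * (a * b)) +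
          ((u k * (w * Z k)) * ((1# - (x * y) * (v * (w * w))) * b)) * ((1# - v) * a)
          ≈⟨ +-cong (*-cong (sym (^-homo-* Q k m)) (*-congʳ (trans (*-congʳ (Z-inv k)) (*-identityˡ _))))
                    (*-cong (*-congˡ (trans (*-congʳ (+-congˡ (-‿cong (trans (*-congʳ xy) (*-congˡ (trans (*-congˡ (sym (^-homo-* Q k k))) (sym (^-homo-* Q m _)))))))) (i-suc (m ℕ.+ (k ℕ.+ k)))))
                            (i-pred m)) ⟩
        Q ^ (k ℕ.+ m) * (u k * (a * b)) + (pf k * i (m ℕ.+ (k ℕ.+ k))) * i⁻ m ∎
        where
        a b w v : Carrier
        a = i m
        b = i (suc (m ℕ.+ (k ℕ.+ k)))
        w = Q ^ k
        v = Q ^ m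

      step : ∀ n → ((1# - x * Q ^ n) * (1# - y * Q ^ n)) * β 1 n pf ≈
             Q ^ n * β 1 n u + diag n (λ k m → (pf k * i (m ℕ.+ (k ℕ.+ k))) * i⁻ m)
      step n = begin
        ((1# - x * Q ^ n) * (1# - y * Q ^ n)) * β 1 n pf
          ≈⟨ diag-* n _ _ ⟨
        diag n (λ k m → ((1# - x * Q ^ n) * (1# - y * Q ^ n)) * (pf k * (i m * i (suc (m ℕ.+ (k ℕ.+ k))))))
          ≈⟨ diag-cong n (λ { k m ≡.refl → term k m }) ⟩
        diag n (λ k m → Q ^ n * (u k * (i m * i (suc (m ℕ.+ (k ℕ.+ k))))) + (pf k * i (m ℕ.+ (k ℕ.+ k))) * i⁻ m)
          ≈⟨ diag-+ n (λ k m → Q ^ n * (u k * (i m * i (suc (m ℕ.+ (k ℕ.+ k)))))) (λ k m → (pf k * i (m ℕ.+ (k ℕ.+ k))) * i⁻ m) ⟩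
        diag n (λ k m → Q ^ n * (u k * (i m * i (suc (m ℕ.+ (k ℕ.+ k)))))) + _
          ≈⟨ +-congʳ (diag-* n _ _) ⟩
        Q ^ n * β 1 n u + diag n (λ k m → (pf k * i (m ℕ.+ (k ℕ.+ k))) * i⁻ m) ∎

    Z-prod : ℕ → Carrier
    Z-prod zero    = Z 0
    Z-prod (suc n) = Z-prod n * Z (suc n)

    private
      solve-Z : ∀ n {b c} → ((1# - x * Q ^ n) * (1# - y * Q ^ n)) * b ≈ c → b ≈ c * Z n
      solve-Z n {b} {c} eq = begin
        b        ≈⟨ *-identityˡ b ⟨
        1# * b   ≈⟨ *-congʳ (Z-inv n) ⟨
        (_ * Z n) * b ≈⟨ solve 3 (λ p z b → (p :* z) :* b := (p :* b) :* z) refl _ _ _ ⟩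
        (_ * b) * Z n ≈⟨ *-congʳ eq ⟩
        c * Z n  ∎

    -- The unit pair contributes at n = 0 only, so afterwards β_n is `Z n` times β_(n-1).
    β-pf : ∀ n → β 1 n pf ≈ Z-prod n
    β-pf zero    = trans (solve-Z 0 (trans (step 0) (begin
      1# * β 1 0 u + (pf 0 * i 0) * 0# ≈⟨ +-cong (trans (*-identityˡ _) β-u-zero) (zeroʳ _) ⟩
      1# + 0#                          ≈⟨ +-identityʳ _ ⟩
      1#                               ∎))) (*-identityˡ (Z 0))
    β-pf (suc n) = solve-Z (suc n) (begin
      _ * β 1 (suc n) pf ≈⟨ step (suc n) ⟩
      Q ^ suc n * β 1 (suc n) u + diag (suc n) (λ k m → (pf k * i (m ℕ.+ (k ℕ.+ k))) * i⁻ m)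
        ≈⟨ +-cong (trans (*-congˡ (β-u-suc n)) (zeroʳ _)) (diag-i⁻-suc n (λ k m → pf k * i (m ℕ.+ (k ℕ.+ k)))) ⟩
      0# + diag n (λ k m → (pf k * i (suc m ℕ.+ (k ℕ.+ k))) * i m)
        ≈⟨ +-identityˡ _ ⟩
      diag n (λ k m → (pf k * i (suc m ℕ.+ (k ℕ.+ k))) * i m)
        ≈⟨ diag-cong n (λ k m _ → solve 3 (λ p a b → (p :* a) :* b := p :* (b :* a)) refl _ _ _) ⟩
      β 1 n pf           ≈⟨ β-pf n ⟩
      Z-prod n           ∎)

  -- The finite Jacobi triple product

  module TripleProduct (x y : Carrier) (xy : x * y ≈ Q) where

    private
      infix 8 _⟨_⟩
      _⟨_⟩ : Carrier → ℕ → Carrier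
      x ⟨ n ⟩ = rising Q x n

    -- `t k` is (-y)^k Q^(k(k-1)/2) and `- t′ k` is (-x)^(k+1) Q^(k(k+1)/2). With 1/y read as x/Q,
    -- these are the terms of index k and -(k + 1) of the bilateral series Σ_j (-y)^j Q^(j(j-1)/2).
    t t′ : ℕ → Carrier
    t zero     = 1#
    t (suc k)  = - y * (Q ^ k * t k)
    t′ zero    = x
    t′ (suc k) = - (x * Q) * (Q ^ k * t′ k)

    private
      t-rec : ∀ k → t k * Q ^ suc k ≈ - x * t (suc k)
      t-rec k = begin
        t k * (Q * Q ^ k)          ≈⟨ *-congˡ (*-congʳ xy) ⟨
        t k * ((x * y) * Q ^ k)    ≈⟨ solve 4 (λ t x y p → t :* ((x :* y) :* p) := (:- x) :* ((:- y) :* (p :* t))) refl _ _ _ _ ⟩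
        - x * (- y * (Q ^ k * t k)) ∎

      t′-rec : ∀ k → t′ k * Q ^ suc (suc k) ≈ - y * t′ (suc k)
      t′-rec k = begin
        t′ k * (Q * (Q * Q ^ k))       ≈⟨ *-congˡ (*-congʳ xy) ⟨
        t′ k * ((x * y) * (Q * Q ^ k)) ≈⟨ solve 5 (λ t x y q p → t :* ((x :* y) :* (q :* p)) := (:- y) :* ((:- (x :* q)) :* (p :* t))) refl _ _ _ _ _ ⟩
        - y * (- (x * Q) * (Q ^ k * t′ k)) ∎

      -- `even` and `odd` are the sums of the q-binomial theorem for products of 2n and 2n + 1
      -- factors, with the indices j ≥ 0 in t and j < 0 in t′. For 2n factors the negative indices
      -- run from -1 to -n only, hence the lower index and the 2 in `β 2 n t′`.
      even : ℕ → Carrier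
      even zero    = β 0 0 t
      even (suc n) = β 0 (suc n) t - β 2 n t′

      odd : ℕ → Carrier
      odd n = β 1 n t - β 1 n t′

      -- One step from 2n to 2n + 1 factors, adding 1 - xQ^n; `odd→even` goes on to 2n + 2 by adding
      -- 1 - yQ^n. The lowering rules are applied to t and t′ in opposite directions, and their
      -- boundary terms cancel.
      even→odd : ∀ n → (1# - Q ^ suc (n ℕ.+ n)) * odd n ≈ (1# - x * Q ^ n) * even n
      even→odd zero = begin
        (1# - Q ^ 1) * (1# * (i 0 * i 1) - x * (i 0 * i 1))
          ≈⟨ solve 4 (λ p x a b → p :* (:1 :* (a :* b) :- x :* (a :* b)) := (:1 :- x :* :1) :* (:1 :* (a :* (p :* b)))) refl _ _ _ _ ⟩
        (1# - x * 1#) * (1# * (i 0 * ((1# - Q ^ 1) * i 1)))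
          ≈⟨ *-congˡ (*-congˡ (*-congˡ (i-suc 0))) ⟩
        (1# - x * 1#) * (1# * (i 0 * i 0)) ∎
      even→odd (suc n) = begin
        p * (β 1 (suc n) t - β 1 (suc n) t′)
          ≈⟨ solve 3 (λ p a b → p :* (a :- b) := p :* a :- p :* b) refl _ _ _ ⟩
        p * β 1 (suc n) t - p * β 1 (suc n) t′
          ≈⟨ +-cong (β-lowerˡ 0 (- x) t t-rec (suc n)) (-‿cong (β-lowerʳ 1 (- (x * Q)) t′ (λ _ → refl) n)) ⟩
        (G + (- x * Q ^ suc n) * (G - 1# * (i (suc n) * i (suc n)))) -
          (G′ + (x * (Q ^ suc n * (i (suc n) * i (suc n))) + (- (x * Q) * Q ^ n) * G′))
          ≈⟨ solve 6 (λ g h x q r a →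
               (g :+ ((:- x) :* (q :* r)) :* (g :- :1 :* (a :* a))) :- (h :+ (x :* ((q :* r) :* (a :* a)) :+ ((:- (x :* q)) :* r) :* h))
               := (:1 :- x :* (q :* r)) :* (g :- h)) refl G G′ x Q (Q ^ n) (i (suc n)) ⟩
        (1# - x * Q ^ suc n) * (G - G′) ∎
        where
        p G G′ : Carrier
        p  = 1# - Q ^ suc (suc n ℕ.+ suc n)
        G  = β 0 (suc n) t
        G′ = β 2 n t′

      odd→even : ∀ n → (1# - Q ^ (suc n ℕ.+ suc n)) * even (suc n) ≈ (1# - y * Q ^ n) * odd n
      odd→even n = begin
        p * (β 0 (suc n) t - β 2 n t′)
          ≈⟨ solve 3 (λ p a b → p :* (a :- b) := p :* a :- p :* b) refl _ _ _ ⟩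
        p * β 0 (suc n) t - p * β 2 n t′
          ≈⟨ +-cong (β-lowerʳ 0 (- y) t (λ _ → refl) n)
                    (-‿cong (trans (*-congʳ (reflexive (≡.cong (λ j → 1# - Q ^ suc j) (ℕ.+-suc n n)))) (β-lowerˡ 1 (- y) t′ t′-rec n))) ⟩
        (P + (1# * (Q ^ suc n * (i (suc n) * i n)) + (- y * Q ^ n) * P)) -
          (P′ + (- y * Q ^ n) * (P′ - x * (i n * i (suc n))))
          ≈⟨ solve 8 (λ g h x y q r a b →
               (g :+ (:1 :* ((q :* r) :* (a :* b)) :+ ((:- y) :* r) :* g)) :- (h :+ ((:- y) :* r) :* (h :- x :* (b :* a)))
               := (:1 :- y :* r) :* (g :- h) :+ (q :- x :* y) :* (r :* (a :* b))) refl P P′ x y Q (Q ^ n) (i (suc n)) (i n) ⟩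
        (1# - y * Q ^ n) * (P - P′) + (Q - x * y) * (Q ^ n * (i (suc n) * i n))
          -- The two boundary terms cancel because x y = Q.
          ≈⟨ +-congˡ (trans (*-congʳ (trans (+-congˡ (-‿cong xy)) (-‿inverseʳ Q))) (zeroˡ _)) ⟩
        (1# - y * Q ^ n) * (P - P′) + 0#
          ≈⟨ +-identityʳ _ ⟩
        (1# - y * Q ^ n) * (P - P′) ∎
        where
        p P P′ : Carrier
        p  = 1# - Q ^ (suc n ℕ.+ suc n)
        P  = β 1 n t
        P′ = β 1 n t′

      even-closed : ∀ n → even n ≈ i (n ℕ.+ n) * (x ⟨ n ⟩ * y ⟨ n ⟩)
      odd-closed  : ∀ n → odd n ≈ i (suc (n ℕ.+ n)) * (x ⟨ suc n ⟩ * y ⟨ n ⟩)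

      even-closed zero    = begin
        1# * (i 0 * i 0)       ≈⟨ *-congˡ (*-congʳ i-zero) ⟩
        1# * (1# * i 0)        ≈⟨ solve 1 (λ a → :1 :* (:1 :* a) := a :* (:1 :* :1)) refl _ ⟩
        i 0 * (1# * 1#)        ∎
      even-closed (suc n) = cancel (n ℕ.+ suc n) (begin
        (1# - Q ^ (suc n ℕ.+ suc n)) * even (suc n)
          ≈⟨ odd→even n ⟩
        (1# - y * Q ^ n) * odd n
          ≈⟨ *-congˡ (odd-closed n) ⟩
        (1# - y * Q ^ n) * (i (suc (n ℕ.+ n)) * (x ⟨ suc n ⟩ * y ⟨ n ⟩))
          ≈⟨ solve 4 (λ p a b c → p :* (a :* (b :* c)) := a :* (b :* (c :* p))) refl _ _ _ _ ⟩
        i (suc (n ℕ.+ n)) * (x ⟨ suc n ⟩ * y ⟨ suc n ⟩)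
          ≈⟨ *-congʳ (trans (i-suc (n ℕ.+ suc n)) (reflexive (≡.cong i (ℕ.+-suc n n)))) ⟨
        ((1# - Q ^ (suc n ℕ.+ suc n)) * i (suc n ℕ.+ suc n)) * (x ⟨ suc n ⟩ * y ⟨ suc n ⟩)
          ≈⟨ *-assoc _ _ _ ⟩
        (1# - Q ^ (suc n ℕ.+ suc n)) * (i (suc n ℕ.+ suc n) * (x ⟨ suc n ⟩ * y ⟨ suc n ⟩)) ∎)
      odd-closed n = cancel (n ℕ.+ n) (begin
        (1# - Q ^ suc (n ℕ.+ n)) * odd n
          ≈⟨ even→odd n ⟩
        (1# - x * Q ^ n) * even n
          ≈⟨ *-congˡ (even-closed n) ⟩
        (1# - x * Q ^ n) * (i (n ℕ.+ n) * (x ⟨ n ⟩ * y ⟨ n ⟩))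
          ≈⟨ solve 4 (λ p a b c → p :* (a :* (b :* c)) := a :* ((b :* p) :* c)) refl _ _ _ _ ⟩
        i (n ℕ.+ n) * (x ⟨ suc n ⟩ * y ⟨ n ⟩)
          ≈⟨ *-congʳ (i-suc (n ℕ.+ n)) ⟨
        ((1# - Q ^ suc (n ℕ.+ n)) * i (suc (n ℕ.+ n))) * (x ⟨ suc n ⟩ * y ⟨ n ⟩)
          ≈⟨ *-assoc _ _ _ ⟩
        (1# - Q ^ suc (n ℕ.+ n)) * (i (suc (n ℕ.+ n)) * (x ⟨ suc n ⟩ * y ⟨ n ⟩)) ∎)

    β-triple : ∀ n → β 1 n (λ k → t k - t′ k) ≈ i (suc (n ℕ.+ n)) * (rising Q x (suc n) * rising Q y n)
    β-triple n = begin
      β 1 n (λ k → t k - t′ k)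
        ≈⟨ diag-cong n (λ k m _ → solve 3 (λ a b c → (a :- b) :* c := a :* c :+ (:- :1) :* (b :* c)) refl _ _ _) ⟩
      diag n (λ k m → t k * term k m + - 1# * (t′ k * term k m))
        ≈⟨ diag-+ n (λ k m → t k * term k m) (λ k m → - 1# * (t′ k * term k m)) ⟩
      β 1 n t + diag n (λ k m → - 1# * (t′ k * term k m))
        ≈⟨ +-congˡ (diag-* n _ _) ⟩
      β 1 n t + - 1# * β 1 n t′
        ≈⟨ solve 2 (λ a b → a :+ (:- :1) :* b := a :- b) refl _ _ ⟩
      odd n
        ≈⟨ odd-closed n ⟩
      i (suc (n ℕ.+ n)) * (x ⟨ suc n ⟩ * y ⟨ n ⟩) ∎
      where
      term : ℕ → ℕ → Carrier
      term k m = i m * i (suc (m ℕ.+ (k ℕ.+ k)))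

  -- The boundary term vanishes as M → ∞, so that the Durfee sums for a and a + 2 agree.
  durfee-shift : ∀ a M → psum M (durfee (suc (suc a))) ≈
    psum (suc M) (durfee a) -
    (1# - Q ^ suc a) * (Q ^ (M ℕ.* M ℕ.+ (suc (suc a)) ℕ.* M) * (i M * i (suc (M ℕ.+ a))))
  durfee-shift a zero    = begin
    0#
      ≈⟨ solve 3 (λ p x y → :0 := (:0 :+ p :* (x :* y)) :- p :* (x :* y)) refl (Q ^ (a ℕ.* 0)) (i 0) (i a) ⟩
    (0# + Q ^ (a ℕ.* 0) * (i 0 * i a)) - Q ^ (a ℕ.* 0) * (i 0 * i a)
      ≈⟨ +-congˡ (-‿cong (*-congˡ (*-congˡ (i-suc a)))) ⟨
    (0# + Q ^ (a ℕ.* 0) * (i 0 * i a)) - Q ^ (a ℕ.* 0) * (i 0 * ((1# - Q ^ suc a) * i (suc a)))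
      ≈⟨ +-congˡ (-‿cong (solve 4 (λ p x y z → p :* (x :* (y :* z)) := y :* (p :* (x :* z))) refl _ _ _ _)) ⟩
    (0# + Q ^ (a ℕ.* 0) * (i 0 * i a)) - (1# - Q ^ suc a) * (Q ^ (a ℕ.* 0) * (i 0 * i (suc a))) ∎
  durfee-shift a (suc M) = begin
    psum M (durfee (suc (suc a))) + P * (i M * i (M ℕ.+ suc (suc a)))
      ≈⟨ +-cong (durfee-shift a M) (*-congˡ (*-cong (sym (i-suc M)) (reflexive (≡.cong i (lem₁ M a))))) ⟩
    (S - (1# - y) * (P * (i M * i (suc (M ℕ.+ a))))) + P * (((1# - x) * v) * w)
      ≈⟨ +-congʳ (+-congˡ (-‿cong (*-congˡ (*-congˡ (*-cong (sym (i-suc M)) w-suc))))) ⟩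
    (S - (1# - y) * (P * (((1# - x) * v) * ((1# - x * y) * w)))) + P * (((1# - x) * v) * w)
      ≈⟨ solve 6 (λ s x y p v w →
           (s :- (:1 :- y) :* (p :* (((:1 :- x) :* v) :* ((:1 :- x :* y) :* w)))) :+ p :* (((:1 :- x) :* v) :* w)
           := (s :+ (p :* y) :* (v :* ((:1 :- x :* y) :* w))) :- (:1 :- y) :* ((p :* ((x :* x) :* y)) :* (v :* w))) refl S x y P v w ⟩
    (S + (P * y) * (v * ((1# - x * y) * w))) - (1# - y) * ((P * ((x * x) * y)) * (v * w))
      ≈⟨ +-cong (+-congˡ (*-cong (trans (sym (^-homo-* Q e (suc a))) (^-congʳ Q (lem₂ M a))) (*-congˡ (sym w-suc))))
                (-‿cong (*-congˡ (*-congʳ (trans (*-congˡ (trans (*-congʳ (sym (^-homo-* Q (suc M) (suc M)))) (sym (^-homo-* Q (suc M ℕ.+ suc M) (suc a))))) (trans (sym (^-homo-* Q e _)) (^-congʳ Q (lem₃ M a))))))) ⟩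
    (S + durfee a (suc M)) - (1# - y) * (Q ^ (suc M ℕ.* suc M ℕ.+ suc (suc a) ℕ.* suc M) * (v * w)) ∎
    where
    e = M ℕ.* M ℕ.+ suc (suc a) ℕ.* M
    S P x y v w : Carrier
    S = psum (suc M) (durfee a)
    P = Q ^ e
    x = Q ^ suc M
    y = Q ^ suc a
    v = i (suc M)
    w = i (suc (suc (M ℕ.+ a)))
    lem₁ : ∀ M a → M ℕ.+ suc (suc a) ≡ suc (suc (M ℕ.+ a))
    lem₁ = ℕSolver.solve-∀
    lem₂ : ∀ M a → (M ℕ.* M ℕ.+ suc (suc a) ℕ.* M) ℕ.+ suc a ≡ suc M ℕ.* suc M ℕ.+ a ℕ.* suc M
    lem₂ = ℕSolver.solve-∀
    lem₃ : ∀ M a → (M ℕ.* M ℕ.+ suc (suc a) ℕ.* M) ℕ.+ ((suc M ℕ.+ suc M) ℕ.+ suc a) ≡ suc M ℕ.* suc M ℕ.+ suc (suc a) ℕ.* suc M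
    lem₃ = ℕSolver.solve-∀
    lem₄ : ∀ M a → suc M ℕ.+ suc a ≡ suc (suc (M ℕ.+ a))
    lem₄ = ℕSolver.solve-∀
    w-suc : i (suc (M ℕ.+ a)) ≈ (1# - x * y) * w
    w-suc = sym (trans (*-congʳ (+-congˡ (-‿cong (trans (sym (^-homo-* Q (suc M) (suc a))) (^-congʳ Q (lem₄ M a)))))) (i-suc _))

-- The ring of formal power series over the integers

module Series where
  open ≡.≡-Reasoning

  ℤ⟦q⟧ : Set
  ℤ⟦q⟧ = ℕ → ℤ.ℤ

  infix  4 _≈ₛ_
  infixl 6 _+ₛ_
  infixl 7 _*ₛ_
  infix  8 -ₛ_

  record _≈ₛ_ (f g : ℤ⟦q⟧) : Set where
    constructor pointwise
    field
      coeff : ∀ n → f n ≡ g n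
  open _≈ₛ_ public

  opaque
    _+ₛ_ : ℤ⟦q⟧ → ℤ⟦q⟧ → ℤ⟦q⟧
    (f +ₛ g) n = f n ℤ.+ g n

    -ₛ_ : ℤ⟦q⟧ → ℤ⟦q⟧
    (-ₛ f) n = ℤ.- f n

    +-coeff : ∀ f g n → (f +ₛ g) n ≡ f n ℤ.+ g n
    +-coeff f g n = ≡.refl

    neg-coeff : ∀ f n → (-ₛ f) n ≡ ℤ.- f n
    neg-coeff f n = ≡.refl

  0ₛ 1ₛ : ℤ⟦q⟧
  0ₛ n       = ℤ.+ 0
  1ₛ zero    = ℤ.+ 1
  1ₛ (suc n) = ℤ.+ 0

  tail : ℤ⟦q⟧ → ℤ⟦q⟧
  tail f n = f (suc n)

  opaque
    unfolding _+ₛ_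

    -- The Cauchy product by recursion along the left factor, f g = f₀ g + q (tail f) g, so that the
    -- ring laws follow by induction on the degree.
    _*ₛ_ : ℤ⟦q⟧ → ℤ⟦q⟧ → ℤ⟦q⟧
    (f *ₛ g) zero    = f 0 ℤ.* g 0
    (f *ₛ g) (suc n) = f 0 ℤ.* g (suc n) ℤ.+ (tail f *ₛ g) n

    *-zero : ∀ f g → (f *ₛ g) 0 ≡ f 0 ℤ.* g 0
    *-zero f g = ≡.refl

    *-suc : ∀ f g n → (f *ₛ g) (suc n) ≡ f 0 ℤ.* g (suc n) ℤ.+ (tail f *ₛ g) n
    *-suc f g n = ≡.refl

    *-cong-≤ : ∀ n {f f′ g g′} → (∀ k → k ℕ.≤ n → f k ≡ f′ k) → (∀ k → k ℕ.≤ n → g k ≡ g′ k) →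
               (f *ₛ g) n ≡ (f′ *ₛ g′) n
    *-cong-≤ zero    p r = ≡.cong₂ ℤ._*_ (p 0 z≤n) (r 0 z≤n)
    *-cong-≤ (suc n) p r = ≡.cong₂ ℤ._+_ (≡.cong₂ ℤ._*_ (p 0 z≤n) (r (suc n) ℕ.≤-refl))
      (*-cong-≤ n (λ k k≤n → p (suc k) (s≤s k≤n)) (λ k k≤n → r k (ℕ.m≤n⇒m≤1+n k≤n)))

    *-distribʳ : ∀ h f g → ∀ n → ((f +ₛ g) *ₛ h) n ≡ (f *ₛ h +ₛ g *ₛ h) n
    *-distribʳ h f g zero    = ℤ.*-distribʳ-+ (h 0) (f 0) (g 0)
    *-distribʳ h f g (suc n) = ≡.trans (≡.cong (λ r → (f 0 ℤ.+ g 0) ℤ.* h (suc n) ℤ.+ r) (*-distribʳ h (tail f) (tail g) n))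
      (lem (f 0) (g 0) (h (suc n)) _ _)
      where
      lem : ∀ a b c d e → (a ℤ.+ b) ℤ.* c ℤ.+ (d ℤ.+ e) ≡ (a ℤ.* c ℤ.+ d) ℤ.+ (b ℤ.* c ℤ.+ e)
      lem = ℤSolver.solve-∀

    *-scale : ∀ a f g n → ((λ k → a ℤ.* f k) *ₛ g) n ≡ a ℤ.* (f *ₛ g) n
    *-scale a f g zero    = ℤ.*-assoc a (f 0) (g 0)
    *-scale a f g (suc n) = ≡.trans (≡.cong (λ r → a ℤ.* f 0 ℤ.* g (suc n) ℤ.+ r) (*-scale a (tail f) g n)) (lem a (f 0) _ _)
      where
      lem : ∀ a b c d → a ℤ.* b ℤ.* c ℤ.+ a ℤ.* d ≡ a ℤ.* (b ℤ.* c ℤ.+ d)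
      lem = ℤSolver.solve-∀

    *-assoc : ∀ f g h → ∀ n → ((f *ₛ g) *ₛ h) n ≡ (f *ₛ (g *ₛ h)) n
    *-assoc f g h zero    = ℤ.*-assoc (f 0) (g 0) (h 0)
    *-assoc f g h (suc n) = begin
      f 0 ℤ.* g 0 ℤ.* h (suc n) ℤ.+ ((λ k → f 0 ℤ.* tail g k ℤ.+ (tail f *ₛ g) k) *ₛ h) n
        ≡⟨ ≡.cong (λ r → f 0 ℤ.* g 0 ℤ.* h (suc n) ℤ.+ r) (*-distribʳ h (λ k → f 0 ℤ.* tail g k) (tail f *ₛ g) n) ⟩
      f 0 ℤ.* g 0 ℤ.* h (suc n) ℤ.+ (((λ k → f 0 ℤ.* tail g k) *ₛ h) n ℤ.+ ((tail f *ₛ g) *ₛ h) n)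
        ≡⟨ ≡.cong₂ (λ a b → f 0 ℤ.* g 0 ℤ.* h (suc n) ℤ.+ (a ℤ.+ b)) (*-scale (f 0) (tail g) h n) (*-assoc (tail f) g h n) ⟩
      f 0 ℤ.* g 0 ℤ.* h (suc n) ℤ.+ (f 0 ℤ.* (tail g *ₛ h) n ℤ.+ (tail f *ₛ (g *ₛ h)) n)
        ≡⟨ lem (f 0) (g 0) _ _ _ ⟩
      f 0 ℤ.* (g 0 ℤ.* h (suc n) ℤ.+ (tail g *ₛ h) n) ℤ.+ (tail f *ₛ (g *ₛ h)) n ∎
      where
      lem : ∀ a b c d e → a ℤ.* b ℤ.* c ℤ.+ (a ℤ.* d ℤ.+ e) ≡ a ℤ.* (b ℤ.* c ℤ.+ d) ℤ.+ e
      lem = ℤSolver.solve-∀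

    *-suc′ : ∀ f g n → (f *ₛ g) (suc n) ≡ (f *ₛ tail g) n ℤ.+ f (suc n) ℤ.* g 0
    *-suc′ f g zero    = ≡.refl
    *-suc′ f g (suc n) = ≡.trans (≡.cong (λ r → f 0 ℤ.* g (suc (suc n)) ℤ.+ r) (*-suc′ (tail f) g n)) (≡.sym (ℤ.+-assoc (f 0 ℤ.* g (suc (suc n))) _ _))

    *-comm : ∀ f g → ∀ n → (f *ₛ g) n ≡ (g *ₛ f) n
    *-comm f g zero    = ℤ.*-comm (f 0) (g 0)
    *-comm f g (suc n) = begin
      f 0 ℤ.* g (suc n) ℤ.+ (tail f *ₛ g) n  ≡⟨ ≡.cong₂ ℤ._+_ (ℤ.*-comm (f 0) _) (*-comm (tail f) g n) ⟩
      g (suc n) ℤ.* f 0 ℤ.+ (g *ₛ tail f) n  ≡⟨ ℤ.+-comm (g (suc n) ℤ.* f 0) _ ⟩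
      (g *ₛ tail f) n ℤ.+ g (suc n) ℤ.* f 0  ≡⟨ *-suc′ g f n ⟨
      (g *ₛ f) (suc n) ∎

    *-zeroˡ : ∀ f → ∀ n → (0ₛ *ₛ f) n ≡ (0ₛ) n
    *-zeroˡ f zero    = ≡.refl
    *-zeroˡ f (suc n) = ≡.trans (ℤ.+-identityˡ _) (*-zeroˡ f n)

    *-identityˡ : ∀ f → ∀ n → (1ₛ *ₛ f) n ≡ (f) n
    *-identityˡ f zero    = ℤ.*-identityˡ (f 0)
    *-identityˡ f (suc n) = ≡.trans (≡.cong₂ ℤ._+_ (ℤ.*-identityˡ (f (suc n))) (*-zeroˡ f n)) (ℤ.+-identityʳ _)

    isCommutativeRing : IsCommutativeRing _≈ₛ_ _+ₛ_ _*ₛ_ -ₛ_ 0ₛ 1ₛ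
    isCommutativeRing = record
      { isRing = record
        { +-isAbelianGroup = record
          { isGroup = record
            { isMonoid = record
              { isSemigroup = record
                { isMagma = record
                  { isEquivalence = record
                    { refl = pointwise (λ _ → ≡.refl)
                    ; sym = λ p → pointwise (λ n → ≡.sym (coeff p n))
                    ; trans = λ p r → pointwise (λ n → ≡.trans (coeff p n) (coeff r n)) }
                  ; ∙-cong = λ p r → pointwise (λ n → ≡.cong₂ ℤ._+_ (coeff p n) (coeff r n)) }
                ; assoc = λ f g h → pointwise (λ n → ℤ.+-assoc (f n) (g n) (h n)) }
              ; identity = (λ f → pointwise (λ n → ℤ.+-identityˡ (f n))) , (λ f → pointwise (λ n → ℤ.+-identityʳ (f n))) }
            ; inverse = (λ f → pointwise (λ n → ℤ.+-inverseˡ (f n))) , (λ f → pointwise (λ n → ℤ.+-inverseʳ (f n)))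
            ; ⁻¹-cong = λ p → pointwise (λ n → ≡.cong (λ a → ℤ.- a) (coeff p n)) }
          ; comm = λ f g → pointwise (λ n → ℤ.+-comm (f n) (g n)) }
        ; *-cong = λ p r → pointwise (λ n → *-cong-≤ n (λ k _ → coeff p k) (λ k _ → coeff r k))
        ; *-assoc = λ f g h → pointwise (*-assoc f g h)
        ; *-identity = (λ f → pointwise (*-identityˡ f)) , (λ f → pointwise (λ n → ≡.trans (*-comm f 1ₛ n) (*-identityˡ f n)))
        ; distrib = (λ f g h → pointwise (λ n → ≡.trans (*-comm f (g +ₛ h) n) (≡.trans (*-distribʳ f g h n) (≡.cong₂ ℤ._+_ (*-comm g f n) (*-comm h f n)))))
                  , (λ h f g → pointwise (*-distribʳ h f g)) }
      ; *-comm = λ f g → pointwise (*-comm f g) }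

  ring : CommutativeRing _ _
  ring = record { isCommutativeRing = isCommutativeRing }

  opaque
    unfolding _*ₛ_

    *-order : ∀ a b {f g} → (∀ n → n ℕ.< a → f n ≡ ℤ.+ 0) → (∀ n → n ℕ.< b → g n ≡ ℤ.+ 0) →
              ∀ n → n ℕ.< a ℕ.+ b → (f *ₛ g) n ≡ ℤ.+ 0
    *-order zero    b {f} {g} p r n n<b = ≡.trans (*-cong-≤ n {f} {f} {g} {0ₛ} (λ _ _ → ≡.refl) (λ k k≤n → r k (ℕ.≤-<-trans k≤n n<b)))
      (≡.trans (*-comm f 0ₛ n) (*-zeroˡ f n))
    *-order (suc a) b {f} {g} p r zero    _         = ≡.cong (ℤ._* g 0) (p 0 (s≤s z≤n))
    *-order (suc a) b {f} {g} p r (suc n) (s≤s n<a+b) = ≡.cong₂ ℤ._+_ (≡.cong (ℤ._* g (suc n)) (p 0 (s≤s z≤n)))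
      (*-order a b {tail f} {g} (λ k k<a → p (suc k) (s≤s k<a)) r n n<a+b)

  X : ℤ⟦q⟧
  X zero    = ℤ.+ 0
  X (suc n) = 1ₛ n

  X-zero : ∀ f → (X *ₛ f) 0 ≡ ℤ.+ 0
  X-zero f = *-zero X f

  X-suc : ∀ f n → (X *ₛ f) (suc n) ≡ f n
  X-suc f n = ≡.trans (*-suc X f n) (≡.trans (ℤ.+-identityˡ _) (≡.trans (*-cong-≤ n {tail X} {1ₛ} {f} {f} (λ _ _ → ≡.refl) (λ _ _ → ≡.refl)) (*-identityˡ f n)))

-- Congruence modulo q^N and q-adic convergence

module Limits where
  open Series using (ℤ⟦q⟧; +-coeff; neg-coeff; pointwise; coeff; X; X-zero; X-suc; *-order; *-cong-≤)
  open CommutativeRing Series.ring hiding (zero)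
  open Algebra.Properties.CommutativeSemiring.Exp commutativeSemiring using (_^_)
  open IntegerCoefficients Series.ring using (solve; _:=_; _:+_; _:*_; _:-_; :-_)
  open FiniteSums Series.ring

  infix 4 _≈[_]_
  record _≈[_]_ (f : ℤ⟦q⟧) (N : ℕ) (g : ℤ⟦q⟧) : Set where
    constructor truncated
    field
      coeff< : ∀ n → n ℕ.< N → f n ≡ g n
  open _≈[_]_ public

  []-refl : ∀ {N f} → f ≈[ N ] f
  []-refl = truncated (λ _ _ → ≡.refl)

  []-sym : ∀ {N f g} → f ≈[ N ] g → g ≈[ N ] f
  []-sym p = truncated (λ n l → ≡.sym (coeff< p n l))

  []-trans : ∀ {N f g h} → f ≈[ N ] g → g ≈[ N ] h → f ≈[ N ] h
  []-trans p r = truncated (λ n l → ≡.trans (coeff< p n l) (coeff< r n l))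

  ≈⇒[] : ∀ {N f g} → f ≈ g → f ≈[ N ] g
  ≈⇒[] p = truncated (λ n _ → coeff p n)

  []⇒≈ : ∀ {f g} → (∀ N → f ≈[ N ] g) → f ≈ g
  []⇒≈ p = pointwise (λ n → coeff< (p (suc n)) n ℕ.≤-refl)

  []-weaken : ∀ {M N f g} → M ℕ.≤ N → f ≈[ N ] g → f ≈[ M ] g
  []-weaken M≤N p = truncated (λ n l → coeff< p n (ℕ.<-≤-trans l M≤N))

  []-+ : ∀ {N f f′ g g′} → f ≈[ N ] f′ → g ≈[ N ] g′ → f + g ≈[ N ] f′ + g′
  []-+ {f = f} {f′} {g} {g′} p r = truncated (λ n l →
    ≡.trans (+-coeff f g n) (≡.trans (≡.cong₂ ℤ._+_ (coeff< p n l) (coeff< r n l)) (≡.sym (+-coeff f′ g′ n))))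

  []-neg : ∀ {N f f′} → f ≈[ N ] f′ → - f ≈[ N ] - f′
  []-neg {f = f} {f′} p = truncated (λ n l →
    ≡.trans (neg-coeff f n) (≡.trans (≡.cong (λ a → ℤ.- a) (coeff< p n l)) (≡.sym (neg-coeff f′ n))))

  []-* : ∀ {N f f′ g g′} → f ≈[ N ] f′ → g ≈[ N ] g′ → f * g ≈[ N ] f′ * g′
  []-* p r = truncated (λ n l → *-cong-≤ n (λ k k≤n → coeff< p k (ℕ.≤-<-trans k≤n l)) (λ k k≤n → coeff< r k (ℕ.≤-<-trans k≤n l)))

  order-* : ∀ a b {f g} → f ≈[ a ] 0# → g ≈[ b ] 0# → f * g ≈[ a ℕ.+ b ] 0#
  order-* a b p r = truncated (*-order a b (coeff< p) (coeff< r))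

  -- The error f (g - h) has order at least a + b: a factor of order a gains a further digits of
  -- precision.
  []-*-shift : ∀ a b {f g h} → f ≈[ a ] 0# → g ≈[ b ] h → f * g ≈[ a ℕ.+ b ] f * h
  []-*-shift a b {f} {g} {h} f≈0 g≈h = []-trans (≈⇒[] (solve 3 (λ f g h → f :* g := f :* (g :- h) :+ f :* h) refl f g h))
    ([]-trans ([]-+ (order-* a b f≈0 ([]-trans ([]-+ g≈h []-refl) (≈⇒[] (-‿inverseʳ h)))) []-refl) (≈⇒[] (+-identityˡ _)))

  order-*ˡ : ∀ a {f} g → f ≈[ a ] 0# → f * g ≈[ a ] 0#
  order-*ˡ a g p = []-trans ([]-* p []-refl) (≈⇒[] (zeroˡ g))

  order-*ʳ : ∀ a f {g} → g ≈[ a ] 0# → f * g ≈[ a ] 0#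
  order-*ʳ a f p = []-trans ([]-* []-refl p) (≈⇒[] (zeroʳ f))

  X^-order : ∀ e → X ^ e ≈[ e ] 0#
  X^-order e = truncated (go e)
    where
    go : ∀ e n → n ℕ.< e → (X ^ e) n ≡ ℤ.+ 0
    go (suc e) zero    l       = X-zero _
    go (suc e) (suc n) (s≤s l) = ≡.trans (X-suc _ n) (go e n l)

  X^-≢ : ∀ e n → n ≢ e → (X ^ e) n ≡ ℤ.+ 0
  X^-≢ zero    zero    n≢e = contradiction ≡.refl n≢e
  X^-≢ zero    (suc n) n≢e = ≡.refl
  X^-≢ (suc e) zero    n≢e = X-zero _
  X^-≢ (suc e) (suc n) n≢e = ≡.trans (X-suc _ n) (X^-≢ e n (λ p → n≢e (≡.cong suc p)))

  X^-≡ : ∀ e → (X ^ e) e ≡ ℤ.+ 1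
  X^-≡ zero    = ≡.refl
  X^-≡ (suc e) = ≡.trans (X-suc _ e) (X^-≡ e)

  diag-[] : ∀ N {f g : ℕ → ℕ → ℤ⟦q⟧} n → (∀ k m → k ℕ.+ m ≡ n → f k m ≈[ N ] g k m) → diag n f ≈[ N ] diag n g
  diag-[] N zero    p = p 0 0 ≡.refl
  diag-[] N (suc n) p = []-+ (p 0 (suc n) ≡.refl) (diag-[] N n (λ k m eq → p (suc k) m (≡.cong suc eq)))

  infix 4 _⟶_
  record _⟶_ (a : ℕ → ℤ⟦q⟧) (s : ℤ⟦q⟧) : Set where
    constructor eventually
    field
      rate     : ℕ → ℕ
      close-to : ∀ N n → rate N ℕ.≤ n → a n ≈[ N ] s
  open _⟶_ public

  ⟶-id : ∀ {a s} → (∀ n → a n ≈[ n ] s) → a ⟶ s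
  ⟶-id p = eventually (λ N → N) (λ N n N≤n → []-weaken N≤n (p n))

  ⟶-const : ∀ s → (λ _ → s) ⟶ s
  ⟶-const s = ⟶-id (λ _ → []-refl)

  ⟶-cong : ∀ {a b s t} → (∀ n → a n ≈ b n) → s ≈ t → a ⟶ s → b ⟶ t
  ⟶-cong p r (eventually M c) = eventually M (λ N n l → []-trans ([]-sym (≈⇒[] (p n))) ([]-trans (c N n l) (≈⇒[] r)))

  ⟶-unique : ∀ {a s t} → a ⟶ s → a ⟶ t → s ≈ t
  ⟶-unique (eventually M c) (eventually M′ c′) = []⇒≈ (λ N →
    []-trans ([]-sym (c N (M N ℕ.+ M′ N) (ℕ.m≤m+n _ _))) (c′ N (M N ℕ.+ M′ N) (ℕ.m≤n+m _ _)))

  ⟶-+ : ∀ {a b s t} → a ⟶ s → b ⟶ t → (λ n → a n + b n) ⟶ s + t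
  ⟶-+ (eventually M c) (eventually M′ c′) = eventually (λ N → M N ℕ.+ M′ N) (λ N n l →
    []-+ (c N n (ℕ.m+n≤o⇒m≤o _ l)) (c′ N n (ℕ.m+n≤o⇒n≤o (M N) l)))

  ⟶-* : ∀ {a b s t} → a ⟶ s → b ⟶ t → (λ n → a n * b n) ⟶ s * t
  ⟶-* (eventually M c) (eventually M′ c′) = eventually (λ N → M N ℕ.+ M′ N) (λ N n l →
    []-* (c N n (ℕ.m+n≤o⇒m≤o _ l)) (c′ N n (ℕ.m+n≤o⇒n≤o (M N) l)))

  ⟶-subsequence : ∀ {a s} (φ : ℕ → ℕ) → (∀ n → n ℕ.≤ φ n) → a ⟶ s → (λ n → a (φ n)) ⟶ s
  ⟶-subsequence φ φ≥ (eventually M c) = eventually M (λ N n l → c N (φ n) (ℕ.≤-trans l (φ≥ n)))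

  -- If terms n and n + 1 always agree below degree n, the coefficient of qⁿ is settled from index n
  -- + 1 on, which is where it is read.
  lim : (ℕ → ℤ⟦q⟧) → ℤ⟦q⟧
  lim a n = a (suc n) n

  lim-close : ∀ {a} → (∀ n → a (suc n) ≈[ n ] a n) → ∀ n → a n ≈[ n ] lim a
  lim-close {a} p n = truncated (go n)
    where
    go : ∀ n k → k ℕ.< n → a n k ≡ a (suc k) k
    go (suc n) k (s≤s k≤n) with k ℕ.≟ n
    ... | yes ≡.refl = ≡.refl
    ... | no k≢n     = ≡.trans (coeff< (p n) k (ℕ.≤∧≢⇒< k≤n k≢n)) (go n k (ℕ.≤∧≢⇒< k≤n k≢n))

  Σ∞ : (ℕ → ℤ⟦q⟧) → ℤ⟦q⟧
  Σ∞ f = lim (λ n → psum n f)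

  Σ∞-close : ∀ {f} → (∀ k → f k ≈[ k ] 0#) → ∀ n → psum n f ≈[ n ] Σ∞ f
  Σ∞-close {f} p = lim-close {λ n → psum n f} (λ n → []-trans ([]-+ []-refl (p n)) (≈⇒[] (+-identityʳ _)))

  Σ∞-⟶ : ∀ {f} → (∀ k → f k ≈[ k ] 0#) → (λ n → psum n f) ⟶ Σ∞ f
  Σ∞-⟶ p = ⟶-id (Σ∞-close p)

  tail-order : ∀ {f} a n → (∀ k → f (suc k) ≈[ a ] 0#) → psum (suc n) f ≈[ a ] f 0
  tail-order {f} a n p = []-trans (≈⇒[] (psum-head n f)) ([]-trans ([]-+ []-refl (zeros n p)) (≈⇒[] (+-identityʳ _)))
    where
    zeros : ∀ n {g} → (∀ k → g k ≈[ a ] 0#) → psum n g ≈[ a ] 0#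
    zeros zero    p = []-refl
    zeros (suc n) p = []-trans ([]-+ (zeros n p) (p n)) (≈⇒[] (+-identityʳ _))

  -- The offset s is there for the induction, which splits off the first row of F.
  psum-diag-close : ∀ N s F g → (∀ k M → psum M (F k) ≈[ M ℕ.+ (k ℕ.+ s) ] g k) →
    psum N (λ n → diag n F) ≈[ N ℕ.+ s ] psum N g
  psum-diag-close zero    s F g p = []-refl
  psum-diag-close (suc N) s F g p =
    []-trans (≈⇒[] (psum-diag N F))
    ([]-trans ([]-+ (p 0 (suc N)) ([]-weaken (ℕ.≤-reflexive (≡.sym (ℕ.+-suc N s)))
      (psum-diag-close N (suc s) (λ k → F (suc k)) (λ k → g (suc k))
        (λ k M → []-weaken (ℕ.≤-reflexive (≡.cong (M ℕ.+_) (ℕ.+-suc k s))) (p (suc k) M)))))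
    (≈⇒[] (sym (psum-head N g))))

  Σ∞-cong : ∀ {f g : ℕ → ℤ⟦q⟧} → (∀ k → f k ≈ g k) → Σ∞ f ≈ Σ∞ g
  Σ∞-cong p = pointwise (λ n → coeff (psum-cong (suc n) p) n)

-- Geometric series and the embedding of series with natural coefficients

module Geometric where
  open Series using (ℤ⟦q⟧; +-coeff; neg-coeff; pointwise; coeff; X; X-suc; *-zero; *-suc; 1ₛ)
  open CommutativeRing Series.ring hiding (zero)
  open Algebra.Properties.CommutativeSemiring.Exp commutativeSemiring using (_^_)
  open IntegerCoefficients Series.ring using (solve; _:=_; _:*_; _:-_; :-_; :1)
  open FiniteSums Series.ring
  open Limits
  open Relation.Binary.Reasoning.Setoid setoid

  X^-+ : ∀ e f m → (X ^ e * f) (e ℕ.+ m) ≡ f m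
  X^-+ zero    f m = coeff (*-identityˡ f) m
  X^-+ (suc e) f m = ≡.trans (coeff (*-assoc X (X ^ e) f) (suc e ℕ.+ m)) (≡.trans (X-suc _ (e ℕ.+ m)) (X^-+ e f m))

  X^-< : ∀ e f m → m ℕ.< e → (X ^ e * f) m ≡ ℤ.+ 0
  X^-< e f m l = coeff< (order-*ˡ e f (X^-order e)) m l

  ι : Series → ℤ⟦q⟧
  ι f n = ℤ.+ f n

  ι-one : ι one ≈ 1#
  ι-one = pointwise (λ { zero → ≡.refl ; (suc n) → ≡.refl })

  private
    sumTo-head : ∀ m f → sumTo (suc m) f ≡ f 0 ℕ.+ sumTo m (λ i → f (suc i))
    sumTo-head zero    f = ≡.refl
    sumTo-head (suc m) f = ≡.trans (≡.cong (ℕ._+ f (suc (suc m))) (sumTo-head m f)) (ℕ.+-assoc (f 0) _ _)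

  ι-⊛ : ∀ f g → ι (f ⊛ g) ≈ ι f * ι g
  ι-⊛ f g = pointwise (go f)
    where
    go : ∀ f m → ι (f ⊛ g) m ≡ (ι f * ι g) m
    go f zero    = ≡.trans (ℤ.pos-* (f 0) (g 0)) (≡.sym (*-zero (ι f) (ι g)))
    go f (suc m) = ≡.trans (≡.cong ℤ.+_ (sumTo-head m (λ i → f i ℕ.* g (suc m ℕ.∸ i))))
      (≡.trans (≡.cong₂ ℤ._+_ (ℤ.pos-* (f 0) (g (suc m))) (go (λ i → f (suc i)) m)) (≡.sym (*-suc (ι f) (ι g) m)))

  ι-shift : ∀ e f → ι (shift e f) ≈ X ^ e * ι f
  ι-shift e f = pointwise (λ m → go e m)
    where
    go : ∀ e m → ι (shift e f) m ≡ (X ^ e * ι f) m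
    go zero          m       = ≡.sym (coeff (*-identityˡ (ι f)) m)
    go (suc e)       zero    = ≡.sym (X^-< (suc e) (ι f) 0 (s≤s z≤n))
    go (suc zero)    (suc m) = ≡.trans (go zero m) (≡.sym (≡.trans (coeff (*-assoc X 1# (ι f)) (suc m)) (X-suc _ m)))
    go (suc (suc e)) (suc m) = ≡.trans (go (suc e) m) (≡.sym (≡.trans (coeff (*-assoc X (X ^ suc e) (ι f)) (suc m)) (X-suc _ m)))

  -- 1 / (1 - q ^ (b + 1))
  geo : ℕ → ℤ⟦q⟧
  geo b = ι (geomInv b)

  -- The coefficients have period b + 1, and on the first period they are those of 1.
  geo-inverse : ∀ b → (1# - X ^ suc b) * geo b ≈ 1#
  geo-inverse b = begin
    (1# - X ^ suc b) * geo b         ≈⟨ solve 2 (λ p g → (:1 :- p) :* g := g :- p :* g) refl _ _ ⟩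
    geo b - X ^ suc b * geo b        ≈⟨ pointwise (λ m → ≡.trans (+-coeff _ _ m) (≡.trans (≡.cong (λ r → geo b m ℤ.+ r) (neg-coeff _ m)) (go m))) ⟩
    1#                               ∎
    where
    low : ∀ m → m ℕ.< suc b → geo b m ≡ 1ₛ m
    low m l rewrite m<n⇒m%n≡m l with m
    ... | zero  = ≡.refl
    ... | suc _ = ≡.refl
    periodic : ∀ m → geo b (suc b ℕ.+ m) ≡ geo b m
    periodic m = ≡.cong (λ r → ℤ.+ (if r ℕ.≡ᵇ 0 then 1 else 0))
      (≡.trans (≡.cong (_% suc b) (ℕ.+-comm (suc b) m)) ([m+n]%n≡m%n m (suc b)))
    go : ∀ m → geo b m ℤ.- (X ^ suc b * geo b) m ≡ 1ₛ m
    go m with m ℕ.<? suc b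
    ... | yes l = ≡.trans (≡.cong (λ r → geo b m ℤ.- r) (X^-< (suc b) (geo b) m l)) (≡.trans (ℤ.+-identityʳ _) (low m l))
    ... | no ¬l with ℕ.m≤n⇒∃[o]m+o≡n (ℕ.≮⇒≥ ¬l)
    ... | r , ≡.refl = ≡.trans (≡.cong (λ s → geo b (suc b ℕ.+ r) ℤ.- s) (X^-+ (suc b) (geo b) r))
                         (≡.trans (≡.cong (λ s → s ℤ.- geo b r) (periodic r)) (ℤ.+-inverseʳ (geo b r)))

-- Trisection and the dilation of q to q³

module Trisection where
  open Series using (ℤ⟦q⟧; +-coeff; neg-coeff; pointwise; coeff; X; X-zero; X-suc)
  open CommutativeRing Series.ring hiding (zero)
  open Algebra.Properties.CommutativeSemiring.Exp commutativeSemiring using (_^_; ^-homo-*; ^-congʳ)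
  open IntegerCoefficients Series.ring using (solve; _:=_; _:+_; _:*_; _:-_; :-_; :0; :1)
  open FiniteSums Series.ring
  open Limits
  open Geometric
  open Relation.Binary.Reasoning.Setoid setoid

  sec : ℤ⟦q⟧ → ℤ⟦q⟧
  sec f n = f (3 ℕ.* n)

  sec-cong : ∀ {f g} → f ≈ g → sec f ≈ sec g
  sec-cong p = pointwise (λ n → coeff p (3 ℕ.* n))

  sec-+ : ∀ f g → sec (f + g) ≈ sec f + sec g
  sec-+ f g = pointwise (λ n → ≡.trans (+-coeff f g (3 ℕ.* n)) (≡.sym (+-coeff (sec f) (sec g) n)))

  sec-neg : ∀ f → sec (- f) ≈ - sec f
  sec-neg f = pointwise (λ n → ≡.trans (neg-coeff f (3 ℕ.* n)) (≡.sym (neg-coeff (sec f) n)))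

  sec-⟶ : ∀ {a s} → a ⟶ s → (λ n → sec (a n)) ⟶ sec s
  sec-⟶ (eventually M c) = eventually (λ N → M (3 ℕ.* N)) (λ N n l →
    truncated (λ k k<N → coeff< (c (3 ℕ.* N) n l) (3 ℕ.* k) (ℕ.*-monoʳ-< 3 k<N)))

  sec-1 : sec 1# ≈ 1#
  sec-1 = pointwise (λ { zero → ≡.refl ; (suc n) → ≡.refl })

  sec-X : sec X ≈ 0#
  sec-X = pointwise (λ { zero → ≡.refl ; (suc n) → ≡.cong X (ℕ.*-suc 3 n) })

  sec-X² : sec (X * X) ≈ 0#
  sec-X² = pointwise (λ { zero → X-zero X ; (suc n) → ≡.trans (≡.cong (X * X) (ℕ.*-suc 3 n)) (X-suc X (2 ℕ.+ 3 ℕ.* n)) })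

  -- h′ ▹ h stands for h′(q) = h(q³), phrased through its action on trisections.
  infix 4 _▹_
  record _▹_ (h′ h : ℤ⟦q⟧) : Set where
    constructor dilation
    field
      sec-* : ∀ f → sec (h′ * f) ≈ h * sec f
  open _▹_ public

  ▹-cong : ∀ {h′ h k′ k} → h′ ≈ k′ → h ≈ k → h′ ▹ h → k′ ▹ k
  ▹-cong p r d = dilation (λ f → trans (sec-cong (*-congʳ (sym p))) (trans (sec-* d f) (*-congʳ r)))

  ▹-1 : 1# ▹ 1#
  ▹-1 = dilation (λ f → trans (sec-cong (*-identityˡ f)) (sym (*-identityˡ _)))

  ▹-+ : ∀ {h′ h k′ k} → h′ ▹ h → k′ ▹ k → h′ + k′ ▹ h + k
  ▹-+ d e = dilation (λ f → trans (sec-cong (distribʳ f _ _)) (trans (sec-+ _ _) (trans (+-cong (sec-* d f) (sec-* e f)) (sym (distribʳ (sec f) _ _)))))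

  ▹-neg : ∀ {h′ h} → h′ ▹ h → - h′ ▹ - h
  ▹-neg d = dilation (λ f → trans (sec-cong (neg-*ˡ _ f)) (trans (sec-neg _) (trans (-‿cong (sec-* d f)) (sym (neg-*ˡ _ _)))))
    where
    neg-*ˡ : ∀ a b → - a * b ≈ - (a * b)
    neg-*ˡ = solve 2 (λ a b → (:- a) :* b := :- (a :* b)) refl

  ▹-* : ∀ {h′ h k′ k} → h′ ▹ h → k′ ▹ k → h′ * k′ ▹ h * k
  ▹-* d e = dilation (λ f → trans (sec-cong (*-assoc _ _ f)) (trans (sec-* d _) (trans (*-congˡ (sec-* e f)) (sym (*-assoc _ _ _)))))

  ▹-X³ : X * (X * X) ▹ X
  ▹-X³ = dilation (λ f → trans (sec-cong (trans (*-assoc X (X * X) f) (*-congˡ (*-assoc X X f)))) (pointwise (λ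
    { zero → ≡.trans (X-zero _) (≡.sym (X-zero _))
    ; (suc n) → ≡.trans (≡.cong (X * (X * (X * f))) (ℕ.*-suc 3 n))
        (≡.trans (X-suc _ (2 ℕ.+ 3 ℕ.* n)) (≡.trans (X-suc _ (1 ℕ.+ 3 ℕ.* n)) (≡.trans (X-suc _ (3 ℕ.* n)) (≡.sym (X-suc (sec f) n))))) })))

  ▹-X^ : ∀ e → X ^ (3 ℕ.* e) ▹ X ^ e
  ▹-X^ zero    = ▹-1
  ▹-X^ (suc e) = ▹-cong (trans (solve 2 (λ x p → (x :* (x :* x)) :* p := x :* (x :* (x :* p))) refl X _)
    (^-congʳ X (≡.sym (ℕ.*-suc 3 e)))) refl (▹-* ▹-X³ (▹-X^ e))

  ▹-⟶ : ∀ {a s b t} → (∀ n → a n ▹ b n) → a ⟶ s → b ⟶ t → s ▹ t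
  ▹-⟶ d a⟶s b⟶t = dilation (λ f → ⟶-unique (sec-⟶ (⟶-* a⟶s (⟶-const f)))
    (⟶-cong (λ n → sym (sec-* (d n) f)) refl (⟶-* b⟶t (⟶-const (sec f)))))

  ▹-psum : ∀ {f′ f : ℕ → ℤ⟦q⟧} → (∀ k → f′ k ▹ f k) → ∀ n → psum n f′ ▹ psum n f
  -- The dilation of 0 is obtained from 0 = 1 - 1.
  ▹-psum d zero    = ▹-cong (solve 1 (λ x → :1 :- :1 := :0) refl 1#) (solve 1 (λ x → :1 :- :1 := :0) refl 1#) (▹-+ ▹-1 (▹-neg ▹-1))
  ▹-psum d (suc n) = ▹-+ (▹-psum d n) (d n)

  -- After multiplication by k h = 1, the factor h moves inside `sec` as h′ and cancels k′.
  ▹-inverse : ∀ {h′ h k′ k} → h′ ▹ h → h′ * k′ ≈ 1# → h * k ≈ 1# → k′ ▹ k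
  ▹-inverse {h′} {h} {k′} {k} d hk′ hk = dilation (λ f → begin
    sec (k′ * f)                   ≈⟨ *-identityˡ _ ⟨
    1# * sec (k′ * f)              ≈⟨ *-congʳ (trans (*-comm k h) hk) ⟨
    (k * h) * sec (k′ * f)         ≈⟨ *-assoc _ _ _ ⟩
    k * (h * sec (k′ * f))         ≈⟨ *-congˡ (sec-* d _) ⟨
    k * sec (h′ * (k′ * f))        ≈⟨ *-congˡ (sec-cong (trans (sym (*-assoc _ _ _)) (trans (*-congʳ hk′) (*-identityˡ f)))) ⟩
    k * sec f                      ∎)

  -- 1 / (1 - q^a) = (1 + q^a + q^2a) / (1 - q^3a), whose numerator is all that the trisection sees.
  geo₃ : ℕ → ℤ⟦q⟧
  geo₃ b = geo (2 ℕ.+ 3 ℕ.* b)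

  geo-triple : ∀ b → let a = X ^ suc b in geo b ≈ geo₃ b * (1# + (a + a * a))
  geo-triple b = begin
    geo b                                                  ≈⟨ *-identityˡ _ ⟨
    1# * geo b                                             ≈⟨ *-congʳ (geo-inverse (2 ℕ.+ 3 ℕ.* b)) ⟨
    ((1# - X ^ (3 ℕ.+ 3 ℕ.* b)) * geo₃ b) * geo b         ≈⟨ *-congʳ (*-congʳ (+-congˡ (-‿cong pow))) ⟩
    ((1# - a * (a * a)) * geo₃ b) * geo b                 ≈⟨ solve 3 (λ a g h → ((:1 :- a :* (a :* a)) :* g) :* h :=
                                                                ((:1 :- a) :* h) :* (g :* (:1 :+ (a :+ a :* a)))) refl _ _ _ ⟩
    ((1# - a) * geo b) * (geo₃ b * (1# + (a + a * a)))    ≈⟨ *-congʳ (geo-inverse b) ⟩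
    1# * (geo₃ b * (1# + (a + a * a)))                    ≈⟨ *-identityˡ _ ⟩
    geo₃ b * (1# + (a + a * a))                           ∎
    where
    a : ℤ⟦q⟧
    a = X ^ suc b
    pow : X ^ (3 ℕ.+ 3 ℕ.* b) ≈ a * (a * a)
    pow = trans (^-congʳ X (lem b)) (trans (^-homo-* X (suc b) _) (*-congˡ (^-homo-* X (suc b) (suc b))))
      where
      lem : ∀ b → 3 ℕ.+ 3 ℕ.* b ≡ suc b ℕ.+ (suc b ℕ.+ suc b)
      lem = ℕSolver.solve-∀

  ▹-geo : ∀ b → geo₃ b ▹ geo b
  ▹-geo b = ▹-inverse (▹-+ ▹-1 (▹-neg (▹-cong (^-congʳ X (ℕ.*-suc 3 b)) refl (▹-X^ (suc b)))))
    (geo-inverse (2 ℕ.+ 3 ℕ.* b)) (geo-inverse b)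

  sec-X^0 : ∀ e → sec (X ^ (3 ℕ.* e)) ≈ X ^ e
  sec-X^0 e = trans (sec-cong (sym (*-identityʳ _))) (trans (sec-* (▹-X^ e) 1#) (trans (*-congˡ sec-1) (*-identityʳ _)))

  sec-X^1 : ∀ e → sec (X ^ (1 ℕ.+ 3 ℕ.* e)) ≈ 0#
  sec-X^1 e = trans (sec-cong (*-comm X _)) (trans (sec-* (▹-X^ e) X) (trans (*-congˡ sec-X) (zeroʳ _)))

  sec-X^2 : ∀ e → sec (X ^ (2 ℕ.+ 3 ℕ.* e)) ≈ 0#
  sec-X^2 e = trans (sec-cong (trans (sym (*-assoc X X _)) (*-comm (X * X) _))) (trans (sec-* (▹-X^ e) (X * X)) (trans (*-congˡ sec-X²) (zeroʳ _)))

choose₂ : ℕ → ℕ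
choose₂ zero    = 0
choose₂ (suc k) = choose₂ k ℕ.+ k

-- The base Q = q^c: Durfee sums, the Bailey lemma and theta series

module Base (c′ : ℕ) where
  open Series using (ℤ⟦q⟧; X)
  open CommutativeRing Series.ring hiding (zero)
  open Algebra.Properties.CommutativeSemiring.Exp commutativeSemiring using (_^_; ^-homo-*; ^-congʳ; ^-assocʳ)
  open IntegerCoefficients Series.ring using (solve; _:=_; _:+_; _:*_; _:-_; :-_; :0; :1)
  open FiniteSums Series.ring
  open Limits
  open Geometric
  open Relation.Binary.Reasoning.Setoid setoid

  c : ℕ
  c = suc c′

  Q : ℤ⟦q⟧
  Q = X ^ c

  Q^≈ : ∀ n → Q ^ n ≈ X ^ (c ℕ.* n)
  Q^≈ n = ^-assocʳ X c n

  -- `geo b` inverts 1 - q^(b+1), and `suc (n + c′ * suc n)` is `c * suc n`, so the new factor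
  -- inverts 1 - Q^(n+1).
  i : ℕ → ℤ⟦q⟧
  i zero    = 1#
  i (suc n) = i n * geo (n ℕ.+ c′ ℕ.* suc n)

  private
    geo-Q : ∀ n → (1# - Q ^ suc n) * geo (n ℕ.+ c′ ℕ.* suc n) ≈ 1#
    geo-Q n = trans (*-congʳ (+-congˡ (-‿cong (Q^≈ (suc n))))) (geo-inverse (n ℕ.+ c′ ℕ.* suc n))

  i-suc : ∀ n → (1# - Q ^ suc n) * i (suc n) ≈ i n
  i-suc n = begin
    (1# - Q ^ suc n) * (i n * geo (n ℕ.+ c′ ℕ.* suc n))   ≈⟨ solve 3 (λ a b c → a :* (b :* c) := b :* (a :* c)) refl _ _ _ ⟩
    i n * ((1# - Q ^ suc n) * geo (n ℕ.+ c′ ℕ.* suc n))   ≈⟨ *-congˡ (geo-Q n) ⟩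
    i n * 1#                                              ≈⟨ *-identityʳ _ ⟩
    i n                                                   ∎

  cancel : ∀ n {u v} → (1# - Q ^ suc n) * u ≈ (1# - Q ^ suc n) * v → u ≈ v
  cancel n {u} {v} p = trans (sym (undo u)) (trans (*-congˡ p) (undo v))
    where
    undo : ∀ w → geo (n ℕ.+ c′ ℕ.* suc n) * ((1# - Q ^ suc n) * w) ≈ w
    undo w = trans (solve 3 (λ a b c → a :* (b :* c) := (b :* a) :* c) refl _ _ _) (trans (*-congʳ (geo-Q n)) (*-identityˡ w))

  i-reciprocal : IsReciprocalFactorial Series.ring Q i
  i-reciprocal = record { i-zero = refl ; i-suc = i-suc ; cancel = cancel }

  open BaileyTerms Series.ring Q i public
  open BaileyPairs Series.ring Q i i-reciprocal public hiding (i⁻; i-pred)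

  Q-order : ∀ {N e} → N ℕ.≤ e → Q ^ e ≈[ N ] 0#
  Q-order {N} {e} l = []-weaken (ℕ.≤-trans l (ℕ.m≤n*m e c)) ([]-trans (≈⇒[] (Q^≈ e)) (X^-order (c ℕ.* e)))

  -- 1/(Q; Q)_∞
  W : ℤ⟦q⟧
  W = lim i

  i-close : ∀ n → i n ≈[ n ] W
  i-close = lim-close {i} (λ n → []-trans (≈⇒[] (step n))
    ([]-trans ([]-+ []-refl (order-*ˡ n (i (suc n)) (Q-order (ℕ.n≤1+n n)))) (≈⇒[] (+-identityʳ _))))
    where
    step : ∀ n → i (suc n) ≈ i n + Q ^ suc n * i (suc n)
    step n = trans (solve 2 (λ a b → a := (:1 :- b) :* a :+ b :* a) refl (i (suc n)) (Q ^ suc n)) (+-congʳ (i-suc n))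

  i-close-≤ : ∀ {N n} → N ℕ.≤ n → i n ≈[ N ] W
  i-close-≤ l = []-weaken l (i-close _)

  i⟶W : i ⟶ W
  i⟶W = ⟶-id i-close

  durfee-order : ∀ a m → durfee a m ≈[ m ] 0#
  durfee-order a zero      = truncated (λ _ ())
  durfee-order a m@(suc _) = order-*ˡ m _ (Q-order (ℕ.≤-trans (ℕ.m≤m*n m m) (ℕ.m≤m+n (m ℕ.* m) (a ℕ.* m))))

  private
    D : ℕ → ℤ⟦q⟧
    D a = Σ∞ (durfee a)

    D-close : ∀ a n → psum n (durfee a) ≈[ n ] D a
    D-close a = Σ∞-close (durfee-order a)

    D-shift : ∀ a → D (suc (suc a)) ≈ D a
    D-shift a = []⇒≈ (λ M →
      []-trans ([]-sym (D-close (suc (suc a)) M))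
      ([]-trans (≈⇒[] (durfee-shift a M))
      ([]-trans ([]-+ ([]-weaken (ℕ.n≤1+n M) (D-close a (suc M)))
                      ([]-neg (order-*ʳ M (1# - Q ^ suc a) (order-*ˡ M _ (Q-order (big M))))))
      (≈⇒[] (trans (+-congˡ (solve 1 (λ x → :- :0 := :0) refl 1#)) (+-identityʳ _))))))
      where
      big : ∀ M → M ℕ.≤ M ℕ.* M ℕ.+ suc (suc a) ℕ.* M
      big M = ℕ.≤-trans (ℕ.m≤m+n M _) (ℕ.m≤n+m (suc (suc a) ℕ.* M) (M ℕ.* M))

    -- Modulo q^a only the term m = 0 survives, and it equals `i a`.
    D-far : ∀ a → D a ≈[ a ] W
    D-far a = []-trans ([]-weaken (ℕ.n≤1+n a) ([]-sym (D-close a (suc a))))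
      ([]-trans (tail-order a a (λ k → order-*ˡ a _ (Q-order (ℕ.≤-trans (ℕ.m≤m*n a (suc k)) (ℕ.m≤n+m (a ℕ.* suc k) (suc k ℕ.* suc k))))))
      ([]-trans (≈⇒[] (trans (*-congʳ (^-congʳ Q (ℕ.*-zeroʳ a))) (trans (*-identityˡ _) (*-identityˡ _)))) (i-close a)))

    D-farther : ∀ t a → D a ≈[ a ℕ.+ (t ℕ.+ t) ] W
    D-farther zero    a = []-weaken (ℕ.≤-reflexive (ℕ.+-identityʳ a)) (D-far a)
    D-farther (suc t) a = []-trans (≈⇒[] (sym (D-shift a))) ([]-weaken (ℕ.≤-reflexive (lem a t)) (D-farther t (suc (suc a))))
      where
      lem : ∀ a t → a ℕ.+ (suc t ℕ.+ suc t) ≡ suc (suc a) ℕ.+ (t ℕ.+ t)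
      lem = ℕSolver.solve-∀

  -- By `D-shift` the sum is the same for a and a + 2t, and by `D-far` it is then W modulo q^(a+2t).
  -- As t is arbitrary, D a = W, which is the Durfee rectangle identity.
  durfee-sum : ∀ a n → psum n (durfee a) ≈[ n ] W
  durfee-sum a n = []-trans (D-close a n) (≈⇒[] ([]⇒≈ (λ t → []-weaken (ℕ.≤-trans (ℕ.m≤m+n t t) (ℕ.m≤n+m (t ℕ.+ t) a)) (D-farther t a))))

  -- The Bailey lemma in the form Σ Q^{n²+n} βₙ = W Σ Q^{k²+k} αₖ.
  bailey-sum : ∀ α N → psum N (λ n → Q ^ (n ℕ.* n ℕ.+ n) * β 1 n α) ≈[ N ] psum N (λ k → (Q ^ (k ℕ.* k ℕ.+ k) * α k) * W)
  -- Row k carries the weight Q^(k²+k), of order at least k, so after M terms of its Durfee sum the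
  -- error has order at least k + M. This allows the triangle k + m < N to be summed row by row
  -- modulo q^N.
  bailey-sum α N = []-trans (≈⇒[] (psum-cong N rows)) ([]-weaken (ℕ.≤-reflexive (≡.sym (ℕ.+-identityʳ N)))
    (psum-diag-close N 0 F _ (λ k M → []-weaken (ℕ.≤-reflexive (lem M k))
      ([]-trans (≈⇒[] (psum-* M _ _)) ([]-*-shift k M (order-*ˡ k (α k) (Q-order (ℕ.m≤n+m k (k ℕ.* k)))) (durfee-sum _ M))))))
    where
    F : ℕ → ℕ → ℤ⟦q⟧
    F k m = (Q ^ (k ℕ.* k ℕ.+ k) * α k) * durfee (suc (k ℕ.+ k)) m

    lem : ∀ M k → M ℕ.+ (k ℕ.+ 0) ≡ k ℕ.+ M
    lem = ℕSolver.solve-∀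

    -- For n = k + m the weight Q^(n²+n) splits into Q^(k²+k) and Q^(m²+(2k+1)m), the Durfee weight
    -- for a = 2k + 1.
    square : ∀ k m → (k ℕ.+ m) ℕ.* (k ℕ.+ m) ℕ.+ (k ℕ.+ m) ≡ (k ℕ.* k ℕ.+ k) ℕ.+ (m ℕ.* m ℕ.+ suc (k ℕ.+ k) ℕ.* m)
    square = ℕSolver.solve-∀

    rows : ∀ n → Q ^ (n ℕ.* n ℕ.+ n) * β 1 n α ≈ diag n F
    rows n = trans (sym (diag-* n _ _)) (diag-cong n (λ { k m ≡.refl → begin
      Q ^ ((k ℕ.+ m) ℕ.* (k ℕ.+ m) ℕ.+ (k ℕ.+ m)) * (α k * (i m * i (suc (m ℕ.+ (k ℕ.+ k)))))
        ≈⟨ *-cong (trans (^-congʳ Q (square k m)) (^-homo-* Q (k ℕ.* k ℕ.+ k) _))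
                  (*-congˡ (*-congˡ (reflexive (≡.cong i (≡.sym (ℕ.+-suc m (k ℕ.+ k))))))) ⟩
      (Q ^ (k ℕ.* k ℕ.+ k) * Q ^ (m ℕ.* m ℕ.+ suc (k ℕ.+ k) ℕ.* m)) * (α k * (i m * i (m ℕ.+ suc (k ℕ.+ k))))
        ≈⟨ solve 4 (λ a b c d → (a :* b) :* (c :* d) := (a :* c) :* (b :* d)) refl _ _ _ _ ⟩
      F k m ∎ }))

  β-cong : ∀ {α α′} → (∀ k → α k ≈ α′ k) → ∀ n → β 1 n α ≈ β 1 n α′
  β-cong p n = diag-cong n (λ k m _ → *-congʳ (p k))

  -- For fixed k both reciprocal factorials tend to W. The rate 2N suffices: if k + m ≥ 2N, either k
  -- ≥ N and the term vanishes modulo q^N on both sides, or m ≥ N and both factors agree with W.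
  bailey-limit : ∀ α → (∀ k → α k ≈[ k ] 0#) → (λ n → β 1 n α) ⟶ (W * W) * Σ∞ α
  bailey-limit α α-order = eventually (λ N → N ℕ.+ N) (λ N n l →
    []-trans (diag-[] N n (term N n l))
    ([]-trans (≈⇒[] (trans (diag-* n (W * W) (λ k _ → α k)) (*-congˡ (diag-row n α))))
    ([]-* []-refl ([]-weaken (ℕ.m≤n⇒m≤1+n (ℕ.m+n≤o⇒m≤o N l)) (Σ∞-close α-order (suc n))))))
    where
    diag-row : ∀ n α → diag n (λ k _ → α k) ≈ psum (suc n) α
    diag-row zero    α = sym (+-identityˡ _)
    diag-row (suc n) α = trans (+-congˡ (diag-row n (λ k → α (suc k)))) (sym (psum-head (suc n) α))

    term : ∀ N n → N ℕ.+ N ℕ.≤ n → ∀ k m → k ℕ.+ m ≡ n →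
           α k * (i m * i (suc (m ℕ.+ (k ℕ.+ k)))) ≈[ N ] (W * W) * α k
    term N n l k m ≡.refl with N ℕ.≤? k
    ... | yes N≤k = []-trans ([]-* ([]-weaken N≤k (α-order k)) []-refl)
                      ([]-trans (≈⇒[] (trans (zeroˡ _) (sym (zeroʳ (W * W))))) ([]-* []-refl ([]-weaken N≤k ([]-sym (α-order k)))))
    ... | no N≰k = []-trans ([]-* []-refl ([]-* (i-close-≤ N≤m) (i-close-≤ (ℕ.m≤n⇒m≤1+n (ℕ.m≤n⇒m≤n+o (k ℕ.+ k) N≤m)))))
                     (≈⇒[] (*-comm _ _))
      where
      N≤m : N ℕ.≤ m
      N≤m = ℕ.+-cancelˡ-≤ k N m (ℕ.≤-trans (ℕ.+-monoˡ-≤ N (ℕ.<⇒≤ (ℕ.≰⇒> N≰k))) l)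

  -- The terms (-1)^k Q^(k(3k+1)/2) (1 - Q^(2k+1)) of the pentagonal series, arising as Bailey
  -- weight times the α of the unit pair.
  euler : ℕ → ℤ⟦q⟧
  euler k = Q ^ (k ℕ.* k ℕ.+ k) * u k

  E : ℤ⟦q⟧
  E = Σ∞ euler

  euler-order : ∀ k → euler k ≈[ k ] 0#
  euler-order k = order-*ˡ k (u k) (Q-order (ℕ.m≤n+m k (k ℕ.* k)))

  -- The pentagonal number theorem: the Bailey lemma for the pair with β = (1, 0, 0, …)
  EW : E * W ≈ 1#
  EW = ⟶-unique
    (⟶-* (⟶-subsequence suc ℕ.n≤1+n (Σ∞-⟶ euler-order)) (⟶-const W))
    -- N + 1 terms are summed, so that the term of index 0, the only non-zero one on the β side, is
    -- always present.
    (⟶-id (λ N → []-weaken (ℕ.n≤1+n N) ([]-trans (≈⇒[] (trans (*-comm _ _) (trans (sym (psum-* (suc N) W euler)) (psum-cong (suc N) (λ k → *-comm W _)))))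
      ([]-trans ([]-sym (bailey-sum u (suc N)))
      ([]-trans (tail-order (suc N) N (λ k → ≈⇒[] (trans (*-congˡ (β-u-suc k)) (zeroʳ _))))
      (≈⇒[] (trans (*-identityˡ _) β-u-zero)))))))

  rising-i : ∀ n → rising Q Q n * i n ≈ 1#
  rising-i zero    = *-identityˡ 1#
  rising-i (suc n) = trans (*-assoc _ _ _) (trans (*-congˡ (i-suc n)) (rising-i n))

  -- In (Q; Q)_n = (Q; Q)_n E W the factor W may be replaced by `i n`. This identifies the
  -- pentagonal series with the product (Q; Q)_∞.
  rising⟶E : rising Q Q ⟶ E
  rising⟶E = ⟶-id (λ n → []-trans (≈⇒[] (trans (sym (*-identityʳ _)) (*-congˡ (sym EW))))
    ([]-trans ([]-* []-refl ([]-* []-refl ([]-sym (i-close n))))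
    (≈⇒[] (trans (solve 3 (λ r e i → r :* (e :* i) := (r :* i) :* e) refl _ _ _) (trans (*-congʳ (rising-i n)) (*-identityˡ E))))))

  -- Jacobi's triple product for x = -ε q^a, y = -ε q^b with b > 0
  module Theta (ε : ℤ⟦q⟧) (ε² : ε * ε ≈ 1#) (a b′ : ℕ) (a+b : a ℕ.+ suc b′ ≡ c) where
    b : ℕ
    b = suc b′

    x y : ℤ⟦q⟧
    x = - (ε * X ^ a)
    y = - (ε * X ^ b)

    xy : x * y ≈ Q
    xy = begin
      (- (ε * X ^ a)) * (- (ε * X ^ b)) ≈⟨ solve 3 (λ e p q → (:- (e :* p)) :* (:- (e :* q)) := (e :* e) :* (p :* q)) refl ε _ _ ⟩
      (ε * ε) * (X ^ a * X ^ b)         ≈⟨ *-cong ε² (sym (^-homo-* X a b)) ⟩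
      1# * X ^ (a ℕ.+ b)                ≈⟨ trans (*-identityˡ _) (^-congʳ X a+b) ⟩
      X ^ c                             ∎

    -- The terms of index k and -(k + 1) of the bilateral series Σ_j ε^j q^(c j(j-1)/2 + b j), using
    -- 1/ε = ε and c - b = a.
    θ : ℕ → ℤ⟦q⟧
    θ k = ε ^ k * X ^ (c ℕ.* choose₂ k ℕ.+ b ℕ.* k) + ε ^ suc k * X ^ (c ℕ.* choose₂ (suc k) ℕ.+ a ℕ.* suc k)

    θ-order : ∀ k → θ k ≈[ k ] 0#
    θ-order k = []-trans ([]-+
      (order-*ʳ k _ ([]-weaken (ℕ.≤-trans (ℕ.m≤n*m k b) (ℕ.m≤n+m (b ℕ.* k) (c ℕ.* choose₂ k))) (X^-order _)))
      (order-*ʳ k _ ([]-weaken (ℕ.≤-trans (ℕ.m≤n+m k (choose₂ k)) (ℕ.≤-trans (ℕ.m≤n*m (choose₂ (suc k)) c) (ℕ.m≤m+n (c ℕ.* choose₂ (suc k)) _))) (X^-order _))))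
      (≈⇒[] (+-identityˡ _))

    open TripleProduct x y xy

    private
      t≈ : ∀ k → t k ≈ ε ^ k * X ^ (c ℕ.* choose₂ k ℕ.+ b ℕ.* k)
      t≈ zero    = sym (trans (*-identityˡ _) (^-congʳ X (lem c b)))
        where
        lem : ∀ c b → c ℕ.* 0 ℕ.+ b ℕ.* 0 ≡ 0
        lem = ℕSolver.solve-∀
      t≈ (suc k) = begin
        - y * (Q ^ k * t k)
          ≈⟨ *-congˡ (*-cong (Q^≈ k) (t≈ k)) ⟩
        - (- (ε * X ^ b)) * (X ^ (c ℕ.* k) * (ε ^ k * X ^ e))
          ≈⟨ solve 5 (λ ε p q r s → (:- (:- (ε :* p))) :* (q :* (r :* s)) := (ε :* r) :* (p :* (q :* s))) refl ε _ _ _ _ ⟩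
        ε ^ suc k * (X ^ b * (X ^ (c ℕ.* k) * X ^ e))
          ≈⟨ *-congˡ (trans (*-congˡ (sym (^-homo-* X (c ℕ.* k) e))) (trans (sym (^-homo-* X b _)) (^-congʳ X (lem c b k (choose₂ k))))) ⟩
        ε ^ suc k * X ^ (c ℕ.* choose₂ (suc k) ℕ.+ b ℕ.* suc k) ∎
        where
        e = c ℕ.* choose₂ k ℕ.+ b ℕ.* k
        lem : ∀ c b k z → b ℕ.+ (c ℕ.* k ℕ.+ (c ℕ.* z ℕ.+ b ℕ.* k)) ≡ c ℕ.* (z ℕ.+ k) ℕ.+ b ℕ.* suc k
        lem = ℕSolver.solve-∀

      t′≈ : ∀ k → t′ k ≈ - (ε ^ suc k * X ^ (c ℕ.* choose₂ (suc k) ℕ.+ a ℕ.* suc k))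
      t′≈ zero    = -‿cong (*-cong (sym (*-identityʳ ε)) (^-congʳ X (lem c a)))
        where
        lem : ∀ c a → a ≡ c ℕ.* 0 ℕ.+ a ℕ.* 1
        lem = ℕSolver.solve-∀
      t′≈ (suc k) = begin
        - (x * Q) * (Q ^ k * t′ k)
          ≈⟨ *-congˡ (*-cong (Q^≈ k) (t′≈ k)) ⟩
        - ((- (ε * X ^ a)) * X ^ c) * (X ^ (c ℕ.* k) * - (ε ^ suc k * X ^ e))
          ≈⟨ solve 6 (λ ε p q r s w → (:- ((:- (ε :* p)) :* w)) :* (q :* (:- (r :* s))) := :- ((ε :* r) :* (p :* (w :* (q :* s))))) refl ε _ _ _ _ _ ⟩
        - (ε ^ suc (suc k) * (X ^ a * (X ^ c * (X ^ (c ℕ.* k) * X ^ e))))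
          ≈⟨ -‿cong (*-congˡ (trans (*-congˡ (trans (*-congˡ (sym (^-homo-* X (c ℕ.* k) e))) (sym (^-homo-* X c _))))
               (trans (sym (^-homo-* X a _)) (^-congʳ X (lem c a k (choose₂ (suc k))))))) ⟩
        - (ε ^ suc (suc k) * X ^ (c ℕ.* choose₂ (suc (suc k)) ℕ.+ a ℕ.* suc (suc k))) ∎
        where
        e = c ℕ.* choose₂ (suc k) ℕ.+ a ℕ.* suc k
        lem : ∀ c a k z → a ℕ.+ (c ℕ.+ (c ℕ.* k ℕ.+ (c ℕ.* z ℕ.+ a ℕ.* suc k))) ≡ c ℕ.* (z ℕ.+ suc k) ℕ.+ a ℕ.* suc (suc k)
        lem = ℕSolver.solve-∀

    -- `β-triple` has the denominator (Q; Q)_(2n+1). Multiplying it back contributes a factor E in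
    -- the limit, and E W² = W.
    triple-product : (λ n → rising Q x (suc n) * rising Q y n) ⟶ W * Σ∞ θ
    triple-product = ⟶-cong
      (λ n → begin
        rising Q Q (suc (n ℕ.+ n)) * β 1 n θ
          ≈⟨ *-congˡ (trans (β-cong (λ k → sym (t-t′ k)) n) (β-triple n)) ⟩
        rising Q Q (suc (n ℕ.+ n)) * (i (suc (n ℕ.+ n)) * (rising Q x (suc n) * rising Q y n))
          ≈⟨ *-assoc _ _ _ ⟨
        (rising Q Q (suc (n ℕ.+ n)) * i (suc (n ℕ.+ n))) * (rising Q x (suc n) * rising Q y n)
          ≈⟨ *-congʳ (rising-i (suc (n ℕ.+ n))) ⟩
        1# * (rising Q x (suc n) * rising Q y n)
          ≈⟨ *-identityˡ _ ⟩
        rising Q x (suc n) * rising Q y n ∎)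
      (begin
        E * ((W * W) * Σ∞ θ)    ≈⟨ solve 3 (λ e w t → e :* ((w :* w) :* t) := (e :* w) :* (w :* t)) refl E W (Σ∞ θ) ⟩
        (E * W) * (W * Σ∞ θ)    ≈⟨ trans (*-congʳ EW) (*-identityˡ _) ⟩
        W * Σ∞ θ                ∎)
      (⟶-* (⟶-subsequence (λ n → suc (n ℕ.+ n)) (λ n → ℕ.m≤n⇒m≤1+n (ℕ.m≤m+n n n)) rising⟶E) (bailey-limit θ θ-order))
      where
      t-t′ : ∀ k → t k - t′ k ≈ θ k
      t-t′ k = +-cong (t≈ k) (trans (-‿cong (t′≈ k)) (solve 1 (λ z → :- (:- z) := z) refl _))

-- Product formulas for φ, ψ and g

module EtaQuotients where
  open Series using (ℤ⟦q⟧; X)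
  open CommutativeRing Series.ring hiding (zero)
  open Algebra.Properties.CommutativeSemiring.Exp commutativeSemiring using (_^_; ^-homo-*)
  open IntegerCoefficients Series.ring using (solve; _:=_; _:*_; _:-_; :-_; :1)
  open FiniteSums Series.ring
  open Limits
  open Geometric
  open Relation.Binary.Reasoning.Setoid setoid

  module B₁ = Base 0
  module B₂ = Base 1
  module B₃ = Base 2
  module B₄ = Base 3
  module B₆ = Base 5

  private
    X² X³ X⁴ X⁶ : ℤ⟦q⟧
    X² = X * X
    X³ = X * X²
    X⁴ = X² * X²
    X⁶ = X³ * X³

    X^1 : X ^ 1 ≈ X
    X^1 = *-identityʳ X

    X^2 : X ^ 2 ≈ X²
    X^2 = *-congˡ X^1

    X^3 : X ^ 3 ≈ X³
    X^3 = *-congˡ X^2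

    X^4 : X ^ 4 ≈ X⁴
    X^4 = trans (^-homo-* X 2 2) (*-cong X^2 X^2)

    X^6 : X ^ 6 ≈ X⁶
    X^6 = trans (^-homo-* X 3 3) (*-cong X^3 X^3)

  -- (q^c; q^2c)_∞
  odd-product : ∀ c′ → rising (Base.Q (c′ ℕ.+ suc c′)) (X ^ suc c′) ⟶ Base.W (c′ ℕ.+ suc c′) * Base.E c′
  odd-product c′ = ⟶-cong
    (λ n → begin
      D.i n * rising r r (n ℕ.+ n)
        ≈⟨ *-congˡ (rising-pairs r r n) ⟨
      D.i n * (rising (r * r) r n * rising (r * r) (r * r) n)
        ≈⟨ *-congˡ (*-cong (rising-cong (sym Q≈) refl n) (rising-cong (sym Q≈) (sym Q≈) n)) ⟩
      D.i n * (rising D.Q r n * rising D.Q D.Q n)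
        ≈⟨ solve 3 (λ a b c → a :* (b :* c) := (c :* a) :* b) refl _ _ _ ⟩
      (rising D.Q D.Q n * D.i n) * rising D.Q r n
        ≈⟨ trans (*-congʳ (D.rising-i n)) (*-identityˡ _) ⟩
      rising D.Q r n ∎)
    refl
    (⟶-* D.i⟶W (⟶-subsequence (λ n → n ℕ.+ n) (λ n → ℕ.m≤m+n n n) (Base.rising⟶E c′)))
    where
    module D = Base (c′ ℕ.+ suc c′)
    r : ℤ⟦q⟧
    r = X ^ suc c′
    Q≈ : D.Q ≈ r * r
    Q≈ = ^-homo-* X (suc c′) (suc c′)

  -- (q^c; q^3c)_∞ (q^2c; q^3c)_∞
  nonmultiples-of-3-product : ∀ c′ → let Q = Base.Q (c′ ℕ.+ (suc c′ ℕ.+ suc c′)) ; r = X ^ suc c′ in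
    (λ n → rising Q r (suc n) * rising Q (r * r) n) ⟶ Base.W (c′ ℕ.+ (suc c′ ℕ.+ suc c′)) * Base.E c′
  nonmultiples-of-3-product c′ = ⟶-cong
    (λ n → begin
      T.i n * rising r r (suc (3 ℕ.* n))
        ≈⟨ *-congˡ (rising-triples-suc r n) ⟨
      T.i n * ((rising r³ r (suc n) * rising r³ (r * r) n) * rising r³ r³ n)
        ≈⟨ *-congˡ (*-cong (*-cong (rising-cong (sym Q≈) refl (suc n)) (rising-cong (sym Q≈) refl n)) (rising-cong (sym Q≈) (sym Q≈) n)) ⟩
      T.i n * ((rising T.Q r (suc n) * rising T.Q (r * r) n) * rising T.Q T.Q n)
        ≈⟨ solve 3 (λ a b c → a :* (b :* c) := (c :* a) :* b) refl _ _ _ ⟩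
      (rising T.Q T.Q n * T.i n) * (rising T.Q r (suc n) * rising T.Q (r * r) n)
        ≈⟨ trans (*-congʳ (T.rising-i n)) (*-identityˡ _) ⟩
      rising T.Q r (suc n) * rising T.Q (r * r) n ∎)
    refl
    (⟶-* T.i⟶W (⟶-subsequence (λ n → suc (3 ℕ.* n)) (λ n → ℕ.m≤n⇒m≤1+n (ℕ.m≤m+n n (2 ℕ.* n))) (Base.rising⟶E c′)))
    where
    module T = Base (c′ ℕ.+ (suc c′ ℕ.+ suc c′))
    r r³ : ℤ⟦q⟧
    r = X ^ suc c′
    r³ = r * (r * r)
    Q≈ : T.Q ≈ r³
    Q≈ = trans (^-homo-* X (suc c′) _) (*-congˡ (^-homo-* X (suc c′) (suc c′)))

  -1² : - 1# * - 1# ≈ 1#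
  -1² = solve 1 (λ z → (:- :1) :* (:- :1) := :1) refl 1#

  -- φ(-q^c), where φ(q) = Σ_{k∈ℤ} q^{k²}
  module Φ (c′ : ℕ) where
    private
      module D = Base (c′ ℕ.+ suc c′)
      module C = Base c′
    module Th = D.Theta (- 1#) -1² (suc c′) c′ ≡.refl

    φ : ℤ⟦q⟧
    φ = Σ∞ Th.θ

    -- In base q^(2c) with x = y = q^c, both factors of the triple product are (q^c; q^(2c))_∞ =
    -- E_c/E_(2c).
    E²≈ : C.E * C.E ≈ D.E * φ
    E²≈ = begin
      C.E * C.E                                       ≈⟨ trans (sym (*-identityˡ _)) (*-congʳ (sym (trans (*-cong D.EW D.EW) (*-identityˡ 1#)))) ⟩
      ((D.E * D.W) * (D.E * D.W)) * (C.E * C.E)       ≈⟨ solve 3 (λ d w e → ((d :* w) :* (d :* w)) :* (e :* e) := (d :* d) :* ((w :* e) :* (w :* e))) refl D.E D.W C.E ⟩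
      (D.E * D.E) * ((D.W * C.E) * (D.W * C.E))       ≈⟨ *-congˡ (⟶-unique square Th.triple-product) ⟩
      (D.E * D.E) * (D.W * φ)                         ≈⟨ solve 3 (λ d w p → (d :* d) :* (w :* p) := (d :* w) :* (d :* p)) refl D.E D.W φ ⟩
      (D.E * D.W) * (D.E * φ)                         ≈⟨ trans (*-congʳ D.EW) (*-identityˡ _) ⟩
      D.E * φ                                         ∎
      where
      x≈ : X ^ suc c′ ≈ - (- 1# * X ^ suc c′)
      x≈ = solve 1 (λ z → z := :- ((:- :1) :* z)) refl _
      square : (λ n → rising D.Q Th.x (suc n) * rising D.Q Th.y n) ⟶ (D.W * C.E) * (D.W * C.E)
      square = ⟶-cong (λ n → *-cong (rising-cong refl x≈ (suc n)) (rising-cong refl x≈ n)) refl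
        (⟶-* (⟶-subsequence suc ℕ.n≤1+n (odd-product c′)) (odd-product c′))

  open Φ 0 public using () renaming (φ to φ₁; E²≈ to E₁²≈)
  open Φ 2 public using () renaming (φ to φ₃; E²≈ to E₃²≈)

  1² : 1# * 1# ≈ 1#
  1² = *-identityˡ 1#

  -- ψ(q) = Σ q^{k(k+1)/2}, with the terms taken in pairs
  module ΨTheta = B₄.Theta 1# 1² 1 2 ≡.refl

  ψ : ℤ⟦q⟧
  ψ = Σ∞ ΨTheta.θ

  -- The triple product gives ψ = (-q; q²)_∞ (q⁴; q⁴)_∞, and (-q; q²)_∞ (q; q²)_∞ = (q²; q⁴)_∞
  -- removes the sign, leaving E_2²/E_1.
  ψ≈ : ψ ≈ (B₂.E * B₂.E) * B₁.W
  ψ≈ = begin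
    ψ
      ≈⟨ trans (sym (*-identityˡ ψ)) (*-congʳ (sym (trans (*-cong B₄.EW (*-cong B₂.EW B₁.EW)) (trans (*-identityˡ _) (*-identityˡ 1#))))) ⟩
    ((B₄.E * B₄.W) * ((B₂.E * B₂.W) * (B₁.E * B₁.W))) * ψ
      ≈⟨ solve 7 (λ a b c d e f p → ((a :* b) :* ((c :* d) :* (e :* f))) :* p := ((a :* c) :* f) :* ((b :* p) :* (d :* e))) refl B₄.E B₄.W B₂.E B₂.W B₁.E B₁.W ψ ⟩
    ((B₄.E * B₂.E) * B₁.W) * ((B₄.W * ψ) * (B₂.W * B₁.E))
      ≈⟨ *-congˡ (⟶-unique (⟶-* ΨTheta.triple-product (⟶-subsequence (λ n → suc (n ℕ.+ n)) 2n+1≥ (odd-product 0)))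
           (⟶-cong product refl (⟶-subsequence (λ n → suc (n ℕ.+ n)) 2n+1≥ (odd-product 1)))) ⟩
    ((B₄.E * B₂.E) * B₁.W) * (B₄.W * B₂.E)
      ≈⟨ solve 4 (λ a b c d → ((a :* c) :* d) :* (b :* c) := (a :* b) :* ((c :* c) :* d)) refl B₄.E B₄.W B₂.E B₁.W ⟩
    (B₄.E * B₄.W) * ((B₂.E * B₂.E) * B₁.W)
      ≈⟨ trans (*-congʳ B₄.EW) (*-identityˡ _) ⟩
    (B₂.E * B₂.E) * B₁.W ∎
    where
    2n+1≥ : ∀ n → n ℕ.≤ suc (n ℕ.+ n)
    2n+1≥ n = ℕ.m≤n⇒m≤1+n (ℕ.m≤m+n n n)

    product : ∀ n → rising B₄.Q (X ^ 2) (suc (n ℕ.+ n)) ≈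
      (rising B₄.Q ΨTheta.x (suc n) * rising B₄.Q ΨTheta.y n) * rising B₂.Q (X ^ 1) (suc (n ℕ.+ n))
    product n = begin
      rising B₄.Q (X ^ 2) (suc (n ℕ.+ n))
        ≈⟨ rising-cong X^4 X^2 (suc (n ℕ.+ n)) ⟩
      rising X⁴ X² (suc (n ℕ.+ n))
        ≈⟨ rising-negate X² X (suc (n ℕ.+ n)) ⟨
      rising X² X (suc (n ℕ.+ n)) * rising X² (- X) (suc (n ℕ.+ n))
        ≈⟨ *-congˡ (rising-pairs-suc X² (- X) n) ⟨
      rising X² X (suc (n ℕ.+ n)) * (rising X⁴ (- X) (suc n) * rising X⁴ (- X * X²) n)
        ≈⟨ *-comm _ _ ⟩
      (rising X⁴ (- X) (suc n) * rising X⁴ (- X * X²) n) * rising X² X (suc (n ℕ.+ n))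
        ≈⟨ *-cong (*-cong (rising-cong (sym X^4) x≈ (suc n)) (rising-cong (sym X^4) y≈ n))
                  (rising-cong (sym X^2) (sym X^1) (suc (n ℕ.+ n))) ⟩
      (rising B₄.Q ΨTheta.x (suc n) * rising B₄.Q ΨTheta.y n) * rising B₂.Q (X ^ 1) (suc (n ℕ.+ n)) ∎
      where
      x≈ : - X ≈ - (1# * X ^ 1)
      x≈ = -‿cong (trans (sym X^1) (sym (*-identityˡ _)))
      y≈ : - X * X² ≈ - (1# * X ^ 3)
      y≈ = trans (solve 2 (λ a b → (:- a) :* b := :- (a :* b)) refl X X²) (-‿cong (trans (sym X^3) (sym (*-identityˡ _))))

  -- f(q, q²) = Σ_{k∈ℤ} q^{k(3k+1)/2}
  module GTheta = B₃.Theta 1# 1² 1 1 ≡.refl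

  g : ℤ⟦q⟧
  g = Σ∞ GTheta.θ

  -- The triple product gives g/E_3 = (-q; q³)_∞ (-q²; q³)_∞. Multiplying by (q; q³)_∞ (q²; q³)_∞ =
  -- E_1/E_3 yields (q²; q⁶)_∞ (q⁴; q⁶)_∞ = E_2/E_6, and E_3² = E_6 φ_3 removes the remaining
  -- factors.
  gE₁≈ : g * B₁.E ≈ φ₃ * B₂.E
  gE₁≈ = begin
    g * B₁.E
      ≈⟨ trans (sym (*-identityˡ _)) (*-congʳ (sym (trans (*-cong B₃.EW B₃.EW) (*-identityˡ 1#)))) ⟩
    ((B₃.E * B₃.W) * (B₃.E * B₃.W)) * (g * B₁.E)
      ≈⟨ solve 4 (λ a b g e → ((a :* b) :* (a :* b)) :* (g :* e) := (a :* a) :* ((b :* g) :* (b :* e))) refl B₃.E B₃.W g B₁.E ⟩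
    (B₃.E * B₃.E) * ((B₃.W * g) * (B₃.W * B₁.E))
      ≈⟨ *-cong E₃²≈ (⟶-unique (⟶-* GTheta.triple-product (nonmultiples-of-3-product 0))
           (⟶-cong product refl (nonmultiples-of-3-product 1))) ⟩
    (B₆.E * φ₃) * (B₆.W * B₂.E)
      ≈⟨ solve 4 (λ a b c d → (a :* c) :* (b :* d) := (a :* b) :* (c :* d)) refl B₆.E B₆.W φ₃ B₂.E ⟩
    (B₆.E * B₆.W) * (φ₃ * B₂.E)
      ≈⟨ trans (*-congʳ B₆.EW) (*-identityˡ _) ⟩
    φ₃ * B₂.E ∎
    where
    product : ∀ n → rising B₆.Q (X ^ 2) (suc n) * rising B₆.Q (X ^ 2 * X ^ 2) n ≈
      (rising B₃.Q GTheta.x (suc n) * rising B₃.Q GTheta.y n) * (rising B₃.Q (X ^ 1) (suc n) * rising B₃.Q (X ^ 1 * X ^ 1) n)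
    product n = begin
      rising B₆.Q (X ^ 2) (suc n) * rising B₆.Q (X ^ 2 * X ^ 2) n
        ≈⟨ *-cong (rising-cong X^6 X^2 (suc n)) (rising-cong X^6 (*-cong X^2 X^2) n) ⟩
      rising X⁶ X² (suc n) * rising X⁶ X⁴ n
        ≈⟨ *-cong (rising-negate X³ X (suc n)) (rising-negate X³ X² n) ⟨
      (rising X³ X (suc n) * rising X³ (- X) (suc n)) * (rising X³ X² n * rising X³ (- X²) n)
        ≈⟨ solve 4 (λ a b c d → (a :* b) :* (c :* d) := (b :* d) :* (a :* c)) refl _ _ _ _ ⟩
      (rising X³ (- X) (suc n) * rising X³ (- X²) n) * (rising X³ X (suc n) * rising X³ X² n)
        ≈⟨ *-cong (*-cong (rising-cong Q≈ (-‿cong (trans (sym X^1) (sym (*-identityˡ _)))) (suc n))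
                          (rising-cong Q≈ (-‿cong (trans (sym X^2) (sym (*-identityˡ _)))) n))
                  (*-cong (rising-cong Q≈ (sym X^1) (suc n)) (rising-cong Q≈ (*-cong (sym X^1) (sym X^1)) n)) ⟩
      (rising B₃.Q GTheta.x (suc n) * rising B₃.Q GTheta.y n) * (rising B₃.Q (X ^ 1) (suc n) * rising B₃.Q (X ^ 1 * X ^ 1) n) ∎
      where
      Q≈ : X³ ≈ B₃.Q
      Q≈ = sym X^3

  -- The Lambert series of ψ²

  module ΨSquare where
    1-XQ^ : ∀ k → 1# - X * B₂.Q ^ k ≈ 1# - X ^ suc (2 ℕ.* k)
    1-XQ^ k = +-congˡ (-‿cong (*-congˡ (B₂.Q^≈ k)))

    Z : ℕ → ℤ⟦q⟧
    Z k = geo (2 ℕ.* k) * geo (2 ℕ.* k)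

    Z-inverse : ∀ k → ((1# - X * B₂.Q ^ k) * (1# - X * B₂.Q ^ k)) * Z k ≈ 1#
    Z-inverse k = begin
      ((1# - X * B₂.Q ^ k) * (1# - X * B₂.Q ^ k)) * Z k
        ≈⟨ *-congʳ (*-cong (1-XQ^ k) (1-XQ^ k)) ⟩
      ((1# - X ^ suc (2 ℕ.* k)) * (1# - X ^ suc (2 ℕ.* k))) * Z k
        ≈⟨ solve 2 (λ a b → (a :* a) :* (b :* b) := (a :* b) :* (a :* b)) refl _ _ ⟩
      ((1# - X ^ suc (2 ℕ.* k)) * geo (2 ℕ.* k)) * ((1# - X ^ suc (2 ℕ.* k)) * geo (2 ℕ.* k))
        ≈⟨ trans (*-cong (geo-inverse (2 ℕ.* k)) (geo-inverse (2 ℕ.* k))) (*-identityˡ 1#) ⟩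
      1# ∎

    open B₂.PartialFractions X X (sym X^2) Z Z-inverse public

    pf-order : ∀ k → pf k ≈[ k ] 0#
    pf-order k = order-*ʳ k (B₂.u k) (order-*ˡ k (Z k) (B₂.Q-order ℕ.≤-refl))

    lambert : ℤ⟦q⟧
    lambert = Σ∞ pf

    Z-prod-inverse : ∀ n → Z-prod n * (rising B₂.Q X (suc n) * rising B₂.Q X (suc n)) ≈ 1#
    Z-prod-inverse zero    = trans (solve 2 (λ z p → z :* ((:1 :* p) :* (:1 :* p)) := (p :* p) :* z) refl _ _) (Z-inverse 0)
    Z-prod-inverse (suc n) = begin
      (Z-prod n * Z (suc n)) * ((r * p) * (r * p))
        ≈⟨ solve 4 (λ a z r p → (a :* z) :* ((r :* p) :* (r :* p)) := ((p :* p) :* z) :* (a :* (r :* r))) refl _ _ _ _ ⟩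
      ((p * p) * Z (suc n)) * (Z-prod n * (r * r))
        ≈⟨ trans (*-cong (Z-inverse (suc n)) (Z-prod-inverse n)) (*-identityˡ 1#) ⟩
      1# ∎
      where
      r p : ℤ⟦q⟧
      r = rising B₂.Q X (suc n)
      p = 1# - X * B₂.Q ^ suc n

    -- For x = y = q the entry β_n is the inverse square of (q; q²)_(n+1), which tends to E_1/E_2 by
    -- `odd-product`; the α side tends to W_2² times the Lambert series.
    lambert-limit : ((B₂.W * B₂.W) * lambert) * ((B₂.W * B₁.E) * (B₂.W * B₁.E)) ≈ 1#
    lambert-limit = ⟶-unique
      (⟶-* (B₂.bailey-limit pf pf-order) (⟶-* rising-limit rising-limit))
      (⟶-cong (λ n → sym (trans (*-congʳ (β-pf n)) (Z-prod-inverse n))) refl (⟶-const 1#))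
      where
      rising-limit : (λ n → rising B₂.Q X (suc n)) ⟶ B₂.W * B₁.E
      rising-limit = ⟶-cong (λ n → rising-cong refl X^1 (suc n)) refl (⟶-subsequence suc ℕ.n≤1+n (odd-product 0))

    -- Solving `lambert-limit` gives E_2⁴/E_1², the square of the quotient in `ψ≈`.
    lambert≈ψ² : lambert ≈ ψ * ψ
    lambert≈ψ² = begin
      lambert
        ≈⟨ trans (sym (*-identityˡ _)) (*-congʳ (sym ones)) ⟩
      ((((B₂.E * B₂.W) * (B₂.E * B₂.W)) * ((B₂.E * B₂.W) * (B₂.E * B₂.W))) * ((B₁.E * B₁.W) * (B₁.E * B₁.W))) * lambert
        ≈⟨ solve 5 (λ a w e v l → ((((a :* w) :* (a :* w)) :* ((a :* w) :* (a :* w))) :* ((e :* v) :* (e :* v))) :* l :=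
             (((a :* a) :* v) :* ((a :* a) :* v)) :* (((w :* w) :* l) :* ((w :* e) :* (w :* e)))) refl B₂.E B₂.W B₁.E B₁.W lambert ⟩
      (((B₂.E * B₂.E) * B₁.W) * ((B₂.E * B₂.E) * B₁.W)) * (((B₂.W * B₂.W) * lambert) * ((B₂.W * B₁.E) * (B₂.W * B₁.E)))
        ≈⟨ *-cong (*-cong (sym ψ≈) (sym ψ≈)) lambert-limit ⟩
      (ψ * ψ) * 1#
        ≈⟨ *-identityʳ _ ⟩
      ψ * ψ ∎
      where
      sq : ∀ {a} → a ≈ 1# → a * a ≈ 1#
      sq p = trans (*-cong p p) (*-identityˡ 1#)
      ones : (((B₂.E * B₂.W) * (B₂.E * B₂.W)) * ((B₂.E * B₂.W) * (B₂.E * B₂.W))) * ((B₁.E * B₁.W) * (B₁.E * B₁.W)) ≈ 1#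
      ones = trans (*-cong (sq (sq B₂.EW)) (sq B₁.EW)) (*-identityˡ 1#)

-- Arithmetic of the quadratic exponents

choose₂-square : ∀ k → k ℕ.* k ≡ (choose₂ k ℕ.+ choose₂ k) ℕ.+ k
choose₂-square zero    = ≡.refl
choose₂-square (suc k) = ≡.trans (lem₁ k) (≡.trans (≡.cong (λ s → s ℕ.+ k ℕ.+ suc k) (choose₂-square k)) (lem₂ (choose₂ k) k))
  where
  lem₁ : ∀ k → suc k ℕ.* suc k ≡ k ℕ.* k ℕ.+ k ℕ.+ suc k
  lem₁ = ℕSolver.solve-∀
  lem₂ : ∀ t k → ((t ℕ.+ t) ℕ.+ k) ℕ.+ k ℕ.+ suc k ≡ ((t ℕ.+ k) ℕ.+ (t ℕ.+ k)) ℕ.+ suc k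
  lem₂ = ℕSolver.solve-∀

choose₂-pair : ∀ k → choose₂ (k ℕ.+ k) ≡ 4 ℕ.* choose₂ k ℕ.+ k
choose₂-pair zero    = ≡.refl
choose₂-pair (suc k) rewrite ℕ.+-suc k k | choose₂-pair k = lem (choose₂ k) k
  where
  lem : ∀ t k → (4 ℕ.* t ℕ.+ k ℕ.+ (k ℕ.+ k)) ℕ.+ suc (k ℕ.+ k) ≡ 4 ℕ.* (t ℕ.+ k) ℕ.+ suc k
  lem = ℕSolver.solve-∀

choose₂-triple : ∀ k → choose₂ (3 ℕ.* k) ≡ 9 ℕ.* choose₂ k ℕ.+ 3 ℕ.* k
choose₂-triple zero    = ≡.refl
choose₂-triple (suc k) = ≡.trans (≡.cong choose₂ (ℕ.*-suc 3 k))
  (≡.trans (≡.cong (λ s → s ℕ.+ 3 ℕ.* k ℕ.+ suc (3 ℕ.* k) ℕ.+ suc (suc (3 ℕ.* k))) (choose₂-triple k)) (lem (choose₂ k) k))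
  where
  lem : ∀ t k → 9 ℕ.* t ℕ.+ 3 ℕ.* k ℕ.+ 3 ℕ.* k ℕ.+ suc (3 ℕ.* k) ℕ.+ suc (suc (3 ℕ.* k)) ≡ 9 ℕ.* (t ℕ.+ k) ℕ.+ 3 ℕ.* suc k
  lem = ℕSolver.solve-∀

-- The Lambert series of ξ and its trisection

module Watson where
  open Series using (ℤ⟦q⟧; pointwise; coeff; +-coeff; X; 1ₛ)
  open CommutativeRing Series.ring hiding (zero)
  open Algebra.Properties.CommutativeSemiring.Exp commutativeSemiring using (_^_; ^-homo-*; ^-congʳ)
  open IntegerCoefficients Series.ring using (solve; _:=_; _:+_; _:*_; _:-_; :-_; :0; :1)
  open FiniteSums Series.ring
  open Limits
  open Geometric
  open Trisection
  open EtaQuotients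
  open Relation.Binary.Reasoning.Setoid setoid

  σ : ℕ → ℤ⟦q⟧
  σ k = (- 1#) ^ k

  u₀≈ : ∀ c′ k → Base.u₀ c′ k ≈ σ k * X ^ (suc c′ ℕ.* choose₂ k)
  u₀≈ c′ zero    = trans (sym (*-identityˡ 1#)) (*-congˡ (^-congʳ X (≡.sym (ℕ.*-zeroʳ c′))))
  u₀≈ c′ (suc k) = begin
    - (Base.Q c′ ^ k * Base.u₀ c′ k)
      ≈⟨ -‿cong (*-cong (Base.Q^≈ c′ k) (u₀≈ c′ k)) ⟩
    - (X ^ (suc c′ ℕ.* k) * (σ k * X ^ (suc c′ ℕ.* choose₂ k)))
      ≈⟨ solve 3 (λ a s b → :- (a :* (s :* b)) := ((:- :1) :* s) :* (b :* a)) refl _ _ _ ⟩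
    σ (suc k) * (X ^ (suc c′ ℕ.* choose₂ k) * X ^ (suc c′ ℕ.* k))
      ≈⟨ *-congˡ (trans (sym (^-homo-* X (suc c′ ℕ.* choose₂ k) _)) (^-congʳ X (≡.sym (ℕ.*-distribˡ-+ (suc c′) (choose₂ k) k)))) ⟩
    σ (suc k) * X ^ (suc c′ ℕ.* choose₂ (suc k)) ∎

  X^3* : ∀ a b d {e} → a ℕ.+ (b ℕ.+ d) ≡ e → X ^ a * (X ^ b * X ^ d) ≈ X ^ e
  X^3* a b d p = trans (*-congˡ (sym (^-homo-* X b d))) (trans (sym (^-homo-* X a _)) (^-congʳ X p))

  X^2* : ∀ a b {e} → a ℕ.+ b ≡ e → X ^ a * X ^ b ≈ X ^ e
  X^2* a b p = trans (sym (^-homo-* X a b)) (^-congʳ X p)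

  -- The summand of index n + 1 in ξ: 6(n+1)² - 6(n+1) + 1 = 6(n²+n) + 1, which is q times the
  -- Bailey weight in base q⁶.
  s : ℕ → ℤ⟦q⟧
  s n = X ^ suc (6 ℕ.* (n ℕ.* n ℕ.+ n)) * ι (pochInv (suc n))

  A : ℤ⟦q⟧
  A = Σ∞ s

  s-order : ∀ n → s n ≈[ suc n ] 0#
  s-order n = order-*ˡ (suc n) _ ([]-weaken (s≤s (ℕ.≤-trans (ℕ.m≤n+m n (n ℕ.* n)) (ℕ.m≤n*m _ 6))) (X^-order (suc (6 ℕ.* (n ℕ.* n ℕ.+ n)))))

  ξ≈ : ι pξ ≈ 1# + (A + A)
  ξ≈ = pointwise go
    where
    exponent : ∀ n → 6 ℕ.* suc n ℕ.* suc n ℕ.∸ 6 ℕ.* suc n ℕ.+ 1 ≡ suc (6 ℕ.* (n ℕ.* n ℕ.+ n))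
    exponent n = ≡.trans (≡.cong (λ e → e ℕ.∸ 6 ℕ.* suc n ℕ.+ 1) (lem₁ n)) (≡.trans (≡.cong (ℕ._+ 1) (ℕ.m+n∸m≡n (6 ℕ.* suc n) _)) (lem₂ n))
      where
      lem₁ : ∀ n → 6 ℕ.* suc n ℕ.* suc n ≡ 6 ℕ.* suc n ℕ.+ 6 ℕ.* suc n ℕ.* n
      lem₁ = ℕSolver.solve-∀
      lem₂ : ∀ n → 6 ℕ.* suc n ℕ.* n ℕ.+ 1 ≡ suc (6 ℕ.* (n ℕ.* n ℕ.+ n))
      lem₂ = ℕSolver.solve-∀

    term : ∀ n m → ι (summand (suc n)) m ≡ s n m
    term n m = ≡.trans (coeff (ι-shift (6 ℕ.* suc n ℕ.* suc n ℕ.∸ 6 ℕ.* suc n ℕ.+ 1) (pochInv (suc n))) m) (coeff (*-congʳ (^-congʳ X (exponent n))) m)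

    partial : ∀ M m → ℤ.+ sumTo M (λ n → if n ℕ.≡ᵇ 0 then 0 else summand n m) ≡ psum M s m
    partial zero    m = ≡.refl
    partial (suc M) m = ≡.trans (≡.cong₂ ℤ._+_ (partial M m) (term M m)) (≡.sym (+-coeff _ _ m))

    -- `A` is read off after one term more, `s m`, whose order exceeds m.
    full : ∀ m → psum m s m ≡ A m
    full m = ≡.trans (≡.sym (ℤ.+-identityʳ _)) (≡.trans (≡.cong (λ r → psum m s m ℤ.+ r) (≡.sym (coeff< (s-order m) m ℕ.≤-refl)))
      (≡.sym (+-coeff (psum m s) (s m) m)))

    go : ∀ m → ι pξ m ≡ (1# + (A + A)) m
    go m = ≡.trans (≡.cong₂ ℤ._+_ (coeff ι-one m) (≡.cong₂ ℤ._+_ half (≡.trans (ℤ.+-identityʳ _) half)))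
             (≡.sym (≡.trans (+-coeff 1# (A + A) m) (≡.cong (λ r → 1ₛ m ℤ.+ r) (+-coeff A A m))))
      where
      half = ≡.trans (partial m m) (full m)

  -- Watson's identity for A: the Bailey lemma in base q⁶ with x = q, y = q⁵
  Z : ℕ → ℤ⟦q⟧
  Z k = geo (6 ℕ.* k) * geo (6 ℕ.* k ℕ.+ 4)

  private
    5+6k : ∀ k → 5 ℕ.+ 6 ℕ.* k ≡ suc (6 ℕ.* k ℕ.+ 4)
    5+6k = ℕSolver.solve-∀

  Z-inverse : ∀ k → ((1# - X * B₆.Q ^ k) * (1# - X ^ 5 * B₆.Q ^ k)) * Z k ≈ 1#
  Z-inverse k = begin
    ((1# - X * B₆.Q ^ k) * (1# - X ^ 5 * B₆.Q ^ k)) * (geo (6 ℕ.* k) * geo (6 ℕ.* k ℕ.+ 4))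
      ≈⟨ *-congʳ (*-cong (+-congˡ (-‿cong (*-congˡ (B₆.Q^≈ k))))
                         (+-congˡ (-‿cong (trans (*-congˡ (B₆.Q^≈ k)) (X^2* 5 (6 ℕ.* k) (5+6k k)))))) ⟩
    ((1# - X ^ suc (6 ℕ.* k)) * (1# - X ^ suc (6 ℕ.* k ℕ.+ 4))) * (geo (6 ℕ.* k) * geo (6 ℕ.* k ℕ.+ 4))
      ≈⟨ solve 4 (λ a b c d → (a :* b) :* (c :* d) := (a :* c) :* (b :* d)) refl _ _ _ _ ⟩
    ((1# - X ^ suc (6 ℕ.* k)) * geo (6 ℕ.* k)) * ((1# - X ^ suc (6 ℕ.* k ℕ.+ 4)) * geo (6 ℕ.* k ℕ.+ 4))
      ≈⟨ trans (*-cong (geo-inverse (6 ℕ.* k)) (geo-inverse (6 ℕ.* k ℕ.+ 4))) (*-identityˡ 1#) ⟩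
    1# ∎

  open B₆.PartialFractions X (X ^ 5) refl Z Z-inverse

  w : ℕ → ℤ⟦q⟧
  w k = X * (B₆.Q ^ (k ℕ.* k ℕ.+ k) * pf k)

  w-order : ∀ k → w k ≈[ k ] 0#
  w-order k = order-*ʳ k X (order-*ˡ k (pf k) (B₆.Q-order (ℕ.m≤n+m k (k ℕ.* k))))

  pochInv≈ : ∀ n → ι (pochInv (suc n)) ≈ Z-prod n
  pochInv≈ zero    = trans (ι-⊛ one _) (trans (*-congʳ ι-one) (trans (*-identityˡ _) (ι-⊛ _ _)))
  pochInv≈ (suc n) = trans (ι-⊛ (pochInv (suc n)) _) (*-cong (pochInv≈ n) (ι-⊛ _ _))

  s≈ : ∀ n → s n ≈ X * (B₆.Q ^ (n ℕ.* n ℕ.+ n) * B₆.β 1 n pf)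
  s≈ n = trans (*-assoc _ _ _) (*-congˡ (*-cong (sym (B₆.Q^≈ (n ℕ.* n ℕ.+ n))) (trans (pochInv≈ n) (sym (β-pf n)))))

  A≈ : A ≈ Σ∞ w * B₆.W
  A≈ = ⟶-unique
    (⟶-id (λ N → []-trans ([]-sym (≈⇒[] (trans (psum-cong N s≈) (psum-* N X _)))) (Σ∞-close (λ k → []-weaken (ℕ.n≤1+n k) (s-order k)) N)))
    (⟶-id (λ N → []-trans ([]-* []-refl (B₆.bailey-sum pf N))
      ([]-trans (≈⇒[] (trans (sym (psum-* N X _)) (trans (psum-cong N (λ k → trans (sym (*-assoc X _ B₆.W)) (*-comm _ _)))
        (trans (psum-* N B₆.W w) (*-comm _ _)))))
      ([]-* (Σ∞-close w-order N) []-refl))))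

  watson : B₆.E * A ≈ Σ∞ w
  watson = trans (*-congˡ A≈) (trans (solve 3 (λ e s w → e :* (s :* w) := (e :* w) :* s) refl _ _ _) (trans (*-congʳ B₆.EW) (*-identityˡ _)))

  -- With a = q^(6k+1) and b = q^(6k+5) the factor of `u` is 1 - ab, and (1 - ab)/((1 - a)(1 - b)) =
  -- 1/(1 - a) + b/(1 - b).
  w≈ : ∀ k → let e = suc (18 ℕ.* choose₂ k ℕ.+ 18 ℕ.* k) in
    w k ≈ σ k * (X ^ e * geo (6 ℕ.* k) + X ^ (e ℕ.+ suc (6 ℕ.* k ℕ.+ 4)) * geo (6 ℕ.* k ℕ.+ 4))
  w≈ k = begin
    X * (B₆.Q ^ (k ℕ.* k ℕ.+ k) * ((B₆.u₀ k * (1# - B₆.Q ^ suc (k ℕ.+ k))) * (B₆.Q ^ k * (ga * gb))))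
      ≈⟨ *-congˡ (*-cong (B₆.Q^≈ (k ℕ.* k ℕ.+ k)) (*-cong (*-cong (u₀≈ 5 k) (+-congˡ (-‿cong (trans (B₆.Q^≈ (suc (k ℕ.+ k))) (sym (X^2* (suc (6 ℕ.* k)) (suc (6 ℕ.* k ℕ.+ 4)) (lem₂ k)))))))
                                     (*-congʳ (B₆.Q^≈ k)))) ⟩
    X * (p * ((σ k * r * (1# - a * b)) * (v * (ga * gb))))
      ≈⟨ solve 9 (λ x p s r a b v g h → x :* (p :* ((s :* r :* (:1 :- a :* b)) :* (v :* (g :* h)))) :=
           s :* ((x :* (p :* (r :* v))) :* (((:1 :- b) :* h) :* g) :+ ((x :* (p :* (r :* v))) :* b) :* (((:1 :- a) :* g) :* h))) refl X p (σ k) r a b v ga gb ⟩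
    σ k * ((X * (p * (r * v))) * (((1# - b) * gb) * ga) + ((X * (p * (r * v))) * b) * (((1# - a) * ga) * gb))
      ≈⟨ *-congˡ (+-cong (*-cong e≈ (one-times (geo-inverse (6 ℕ.* k ℕ.+ 4)))) (*-cong (trans (*-congʳ e≈) (sym (^-homo-* X e _))) (one-times (geo-inverse (6 ℕ.* k))))) ⟩
    σ k * (X ^ e * ga + X ^ (e ℕ.+ suc (6 ℕ.* k ℕ.+ 4)) * gb) ∎
    where
    e = suc (18 ℕ.* choose₂ k ℕ.+ 18 ℕ.* k)
    a b p r v ga gb : ℤ⟦q⟧
    a = X ^ suc (6 ℕ.* k)
    b = X ^ suc (6 ℕ.* k ℕ.+ 4)
    p = X ^ (6 ℕ.* (k ℕ.* k ℕ.+ k))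
    r = X ^ (6 ℕ.* choose₂ k)
    v = X ^ (6 ℕ.* k)
    ga = geo (6 ℕ.* k)
    gb = geo (6 ℕ.* k ℕ.+ 4)
    one-times : ∀ {f g} → f ≈ 1# → f * g ≈ g
    one-times p = trans (*-congʳ p) (*-identityˡ _)
    lem₂ : ∀ k → suc (6 ℕ.* k) ℕ.+ suc (6 ℕ.* k ℕ.+ 4) ≡ 6 ℕ.* suc (k ℕ.+ k)
    lem₂ = ℕSolver.solve-∀
    lem₁ : ∀ t k → 6 ℕ.* ((t ℕ.+ t) ℕ.+ k ℕ.+ k) ℕ.+ (6 ℕ.* t ℕ.+ 6 ℕ.* k) ≡ 18 ℕ.* t ℕ.+ 18 ℕ.* k
    lem₁ = ℕSolver.solve-∀
    e≈ : X * (p * (r * v)) ≈ X ^ e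
    e≈ = *-congˡ (X^3* (6 ℕ.* (k ℕ.* k ℕ.+ k)) (6 ℕ.* choose₂ k) (6 ℕ.* k)
      (≡.trans (≡.cong (λ z → 6 ℕ.* (z ℕ.+ k) ℕ.+ (6 ℕ.* choose₂ k ℕ.+ 6 ℕ.* k)) (choose₂-square k)) (lem₁ (choose₂ k) k)))

  ▹-σ : ∀ k → σ k ▹ σ k
  ▹-σ zero    = ▹-1
  ▹-σ (suc k) = ▹-* (▹-neg ▹-1) (▹-σ k)

  ▹-^ : ∀ {h′ h} → h′ ▹ h → ∀ n → h′ ^ n ▹ h ^ n
  ▹-^ d zero    = ▹-1
  ▹-^ d (suc n) = ▹-* d (▹-^ d n)

  -- As q⁶ is the dilation of q², the pentagonal series dilate term by term.
  E₆▹E₂ : B₆.E ▹ B₂.E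
  E₆▹E₂ = ▹-⟶ (▹-psum term) (Σ∞-⟶ B₆.euler-order) (Σ∞-⟶ B₂.euler-order)
    where
    Q▹ : B₆.Q ▹ B₂.Q
    Q▹ = ▹-X^ 2
    u₀▹ : ∀ k → B₆.u₀ k ▹ B₂.u₀ k
    u₀▹ zero    = ▹-1
    u₀▹ (suc k) = ▹-neg (▹-* (▹-^ Q▹ k) (u₀▹ k))
    term : ∀ k → B₆.euler k ▹ B₂.euler k
    term k = ▹-* (▹-^ Q▹ (k ℕ.* k ℕ.+ k)) (▹-* (u₀▹ k) (▹-+ ▹-1 (▹-neg (▹-^ Q▹ (suc (k ℕ.+ k))))))

  module _ {e : ℕ} (r : ℕ) where
    sec₀ : e ≡ 3 ℕ.* r → sec (X ^ e) ≈ X ^ r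
    sec₀ p = trans (sec-cong (^-congʳ X p)) (sec-X^0 r)

    sec₁ : e ≡ 1 ℕ.+ 3 ℕ.* r → sec (X ^ e) ≈ 0#
    sec₁ p = trans (sec-cong (^-congʳ X p)) (sec-X^1 r)

    sec₂ : e ≡ 2 ℕ.+ 3 ℕ.* r → sec (X ^ e) ≈ 0#
    sec₂ p = trans (sec-cong (^-congʳ X p)) (sec-X^2 r)

  -- After `geo-triple` the denominator is a series in q³ and leaves `sec` as `geo b`; only the
  -- three monomials of the numerator remain to be trisected.
  sec-X^-geo : ∀ e b {f₀ f₁ f₂} → sec (X ^ e) ≈ f₀ → sec (X ^ (e ℕ.+ suc b)) ≈ f₁ → sec (X ^ (e ℕ.+ (suc b ℕ.+ suc b))) ≈ f₂ →
    sec (X ^ e * geo b) ≈ geo b * (f₀ + (f₁ + f₂))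
  sec-X^-geo e b {f₀} {f₁} {f₂} p₀ p₁ p₂ = begin
    sec (X ^ e * geo b)
      ≈⟨ sec-cong (trans (*-congˡ (geo-triple b)) (solve 3 (λ x g a → x :* (g :* (:1 :+ (a :+ a :* a))) := g :* (x :+ (x :* a :+ x :* (a :* a)))) refl _ _ _)) ⟩
    sec (geo₃ b * (X ^ e + (X ^ e * X ^ suc b + X ^ e * (X ^ suc b * X ^ suc b))))
      ≈⟨ sec-* (▹-geo b) _ ⟩
    geo b * sec (X ^ e + (X ^ e * X ^ suc b + X ^ e * (X ^ suc b * X ^ suc b)))
      ≈⟨ *-congˡ (trans (sec-+ _ _) (+-congˡ (sec-+ _ _))) ⟩
    geo b * (sec (X ^ e) + (sec (X ^ e * X ^ suc b) + sec (X ^ e * (X ^ suc b * X ^ suc b))))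
      ≈⟨ *-congˡ (+-cong p₀ (+-cong (trans (sec-cong (X^2* e (suc b) ≡.refl)) p₁) (trans (sec-cong (X^3* e (suc b) (suc b) ≡.refl)) p₂))) ⟩
    geo b * (f₀ + (f₁ + f₂)) ∎

  -- Modulo 3 the exponent e is 1, while 6k + 1 is 1 and 6k + 5 is 2. In the first geometric series
  -- the monomial with e + 2(6k + 1) survives, in the second the leading one.
  sec-w : ∀ k → let t = choose₂ k in
    sec (w k) ≈ σ k * (geo (6 ℕ.* k) * X ^ (1 ℕ.+ (6 ℕ.* t ℕ.+ 10 ℕ.* k)) + geo (6 ℕ.* k ℕ.+ 4) * X ^ (2 ℕ.+ (6 ℕ.* t ℕ.+ 8 ℕ.* k)))
  sec-w k = begin
    sec (w k)
      ≈⟨ trans (sec-cong (w≈ k)) (trans (sec-* (▹-σ k) _) (*-congˡ (sec-+ _ _))) ⟩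
    σ k * (sec (X ^ e * geo (6 ℕ.* k)) + sec (X ^ (e ℕ.+ suc (6 ℕ.* k ℕ.+ 4)) * geo (6 ℕ.* k ℕ.+ 4)))
      ≈⟨ *-congˡ (+-cong
           (sec-X^-geo e (6 ℕ.* k) (sec₁ (6 ℕ.* t ℕ.+ 6 ℕ.* k) (l₁ t k)) (sec₂ (6 ℕ.* t ℕ.+ 8 ℕ.* k) (l₂ t k)) (sec₀ (1 ℕ.+ (6 ℕ.* t ℕ.+ 10 ℕ.* k)) (l₃ t k)))
           (sec-X^-geo (e ℕ.+ suc (6 ℕ.* k ℕ.+ 4)) (6 ℕ.* k ℕ.+ 4) (sec₀ (2 ℕ.+ (6 ℕ.* t ℕ.+ 8 ℕ.* k)) (l₄ t k)) (sec₂ (6 ℕ.* t ℕ.+ 10 ℕ.* k ℕ.+ 3) (l₅ t k)) (sec₁ (6 ℕ.* t ℕ.+ 12 ℕ.* k ℕ.+ 5) (l₆ t k)))) ⟩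
    σ k * (geo (6 ℕ.* k) * (0# + (0# + X ^ (1 ℕ.+ (6 ℕ.* t ℕ.+ 10 ℕ.* k)))) + geo (6 ℕ.* k ℕ.+ 4) * (X ^ (2 ℕ.+ (6 ℕ.* t ℕ.+ 8 ℕ.* k)) + (0# + 0#)))
      ≈⟨ solve 5 (λ s g h a b → s :* (g :* (:0 :+ (:0 :+ a)) :+ h :* (b :+ (:0 :+ :0))) := s :* (g :* a :+ h :* b)) refl _ _ _ _ _ ⟩
    σ k * (geo (6 ℕ.* k) * X ^ (1 ℕ.+ (6 ℕ.* t ℕ.+ 10 ℕ.* k)) + geo (6 ℕ.* k ℕ.+ 4) * X ^ (2 ℕ.+ (6 ℕ.* t ℕ.+ 8 ℕ.* k))) ∎
    where
    t = choose₂ k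
    e = suc (18 ℕ.* t ℕ.+ 18 ℕ.* k)
    l₁ : ∀ t k → suc (18 ℕ.* t ℕ.+ 18 ℕ.* k) ≡ 1 ℕ.+ 3 ℕ.* (6 ℕ.* t ℕ.+ 6 ℕ.* k)
    l₁ = ℕSolver.solve-∀
    l₂ : ∀ t k → suc (18 ℕ.* t ℕ.+ 18 ℕ.* k) ℕ.+ suc (6 ℕ.* k) ≡ 2 ℕ.+ 3 ℕ.* (6 ℕ.* t ℕ.+ 8 ℕ.* k)
    l₂ = ℕSolver.solve-∀
    l₃ : ∀ t k → suc (18 ℕ.* t ℕ.+ 18 ℕ.* k) ℕ.+ (suc (6 ℕ.* k) ℕ.+ suc (6 ℕ.* k)) ≡ 3 ℕ.* (1 ℕ.+ (6 ℕ.* t ℕ.+ 10 ℕ.* k))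
    l₃ = ℕSolver.solve-∀
    l₄ : ∀ t k → suc (18 ℕ.* t ℕ.+ 18 ℕ.* k) ℕ.+ suc (6 ℕ.* k ℕ.+ 4) ≡ 3 ℕ.* (2 ℕ.+ (6 ℕ.* t ℕ.+ 8 ℕ.* k))
    l₄ = ℕSolver.solve-∀
    l₅ : ∀ t k → suc (18 ℕ.* t ℕ.+ 18 ℕ.* k) ℕ.+ suc (6 ℕ.* k ℕ.+ 4) ℕ.+ suc (6 ℕ.* k ℕ.+ 4) ≡ 2 ℕ.+ 3 ℕ.* (6 ℕ.* t ℕ.+ 10 ℕ.* k ℕ.+ 3)
    l₅ = ℕSolver.solve-∀
    l₆ : ∀ t k → suc (18 ℕ.* t ℕ.+ 18 ℕ.* k) ℕ.+ suc (6 ℕ.* k ℕ.+ 4) ℕ.+ (suc (6 ℕ.* k ℕ.+ 4) ℕ.+ suc (6 ℕ.* k ℕ.+ 4)) ≡ 1 ℕ.+ 3 ℕ.* (6 ℕ.* t ℕ.+ 12 ℕ.* k ℕ.+ 5)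
    l₆ = ℕSolver.solve-∀

  private
    module Λ = ΨSquare

  -- With a = q^(2k+1) the factor of `u` is 1 - a², and (1 - a²)/(1 - a)² = (1 + a)/(1 - a).
  lambert-term : ∀ k → let e = 2 ℕ.* choose₂ k ℕ.+ 2 ℕ.* k in
    Λ.pf k ≈ σ k * (X ^ e * geo (2 ℕ.* k) + X ^ (e ℕ.+ suc (2 ℕ.* k)) * geo (2 ℕ.* k))
  lambert-term k = begin
    (B₂.u₀ k * (1# - B₂.Q ^ suc (k ℕ.+ k))) * (B₂.Q ^ k * (g₀ * g₀))
      ≈⟨ *-cong (*-cong (u₀≈ 1 k) (+-congˡ (-‿cong (trans (B₂.Q^≈ (suc (k ℕ.+ k))) (sym (X^2* (suc (2 ℕ.* k)) (suc (2 ℕ.* k)) (lem k)))))))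
                (*-congʳ (B₂.Q^≈ k)) ⟩
    ((σ k * X ^ (2 ℕ.* choose₂ k)) * (1# - a * a)) * (X ^ (2 ℕ.* k) * (g₀ * g₀))
      ≈⟨ solve 5 (λ s r a v g → ((s :* r) :* (:1 :- a :* a)) :* (v :* (g :* g)) := (s :* ((r :* v) :* g :+ ((r :* v) :* a) :* g)) :* ((:1 :- a) :* g)) refl (σ k) (X ^ (2 ℕ.* choose₂ k)) a (X ^ (2 ℕ.* k)) g₀ ⟩
    (σ k * ((X ^ (2 ℕ.* choose₂ k) * X ^ (2 ℕ.* k)) * g₀ + ((X ^ (2 ℕ.* choose₂ k) * X ^ (2 ℕ.* k)) * a) * g₀)) * ((1# - a) * g₀)
      ≈⟨ trans (*-congˡ (geo-inverse (2 ℕ.* k))) (*-identityʳ _) ⟩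
    σ k * ((X ^ (2 ℕ.* choose₂ k) * X ^ (2 ℕ.* k)) * g₀ + ((X ^ (2 ℕ.* choose₂ k) * X ^ (2 ℕ.* k)) * a) * g₀)
      ≈⟨ *-congˡ (+-cong (*-congʳ (X^2* (2 ℕ.* choose₂ k) (2 ℕ.* k) ≡.refl))
                         (*-congʳ (trans (*-congʳ (X^2* (2 ℕ.* choose₂ k) (2 ℕ.* k) ≡.refl)) (X^2* (2 ℕ.* choose₂ k ℕ.+ 2 ℕ.* k) (suc (2 ℕ.* k)) ≡.refl)))) ⟩
    σ k * (X ^ (2 ℕ.* choose₂ k ℕ.+ 2 ℕ.* k) * g₀ + X ^ (2 ℕ.* choose₂ k ℕ.+ 2 ℕ.* k ℕ.+ suc (2 ℕ.* k)) * g₀) ∎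
    where
    a g₀ : ℤ⟦q⟧
    a  = X ^ suc (2 ℕ.* k)
    g₀ = geo (2 ℕ.* k)
    lem : ∀ k → suc (2 ℕ.* k) ℕ.+ suc (2 ℕ.* k) ≡ 2 ℕ.* suc (k ℕ.+ k)
    lem = ℕSolver.solve-∀

  -- The coefficients 1, 2, 2, 1 are those of (1 + a)(1 + a + a²), the numerator over 1 - a³.
  sec-lambert-term : ∀ k {t f₀ f₁ f₂ f₃} → choose₂ k ≡ t → let e = 2 ℕ.* t ℕ.+ 2 ℕ.* k ; a = suc (2 ℕ.* k) in
    sec (X ^ e) ≈ f₀ → sec (X ^ (e ℕ.+ a)) ≈ f₁ → sec (X ^ (e ℕ.+ (a ℕ.+ a))) ≈ f₂ → sec (X ^ (e ℕ.+ (a ℕ.+ (a ℕ.+ a)))) ≈ f₃ →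
    sec (Λ.pf k) ≈ σ k * (geo (2 ℕ.* k) * (f₀ + (f₁ + f₁) + (f₂ + f₂) + f₃))
  sec-lambert-term k {_} {f₀} {f₁} {f₂} {f₃} ≡.refl p₀ p₁ p₂ p₃ = begin
    sec (Λ.pf k)
      ≈⟨ trans (sec-cong (lambert-term k)) (trans (sec-* (▹-σ k) _) (*-congˡ (sec-+ _ _))) ⟩
    σ k * (sec (X ^ e * geo (2 ℕ.* k)) + sec (X ^ (e ℕ.+ a) * geo (2 ℕ.* k)))
      ≈⟨ *-congˡ (+-cong (sec-X^-geo e (2 ℕ.* k) p₀ p₁ p₂)
           (sec-X^-geo (e ℕ.+ a) (2 ℕ.* k) p₁ (trans (sec-cong (^-congʳ X (ℕ.+-assoc e a a))) p₂)
                                              (trans (sec-cong (^-congʳ X (ℕ.+-assoc e a (a ℕ.+ a)))) p₃))) ⟩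
    σ k * (geo (2 ℕ.* k) * (f₀ + (f₁ + f₂)) + geo (2 ℕ.* k) * (f₁ + (f₂ + f₃)))
      ≈⟨ solve 6 (λ s g a b c d → s :* (g :* (a :+ (b :+ c)) :+ g :* (b :+ (c :+ d))) := s :* (g :* (a :+ (b :+ b) :+ (c :+ c) :+ d))) refl _ _ _ _ _ _ ⟩
    σ k * (geo (2 ℕ.* k) * (f₀ + (f₁ + f₁) + (f₂ + f₂) + f₃)) ∎
    where
    e = 2 ℕ.* choose₂ k ℕ.+ 2 ℕ.* k
    a = suc (2 ℕ.* k)

  σ-triple : ∀ m → σ (3 ℕ.* m) ≈ σ m
  σ-triple zero    = refl
  σ-triple (suc m) = trans (reflexive (≡.cong σ (ℕ.*-suc 3 m)))
    (trans (solve 1 (λ s → (:- :1) :* ((:- :1) :* ((:- :1) :* s)) := (:- :1) :* s) refl _) (*-congˡ (σ-triple m)))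

  -- Here e is 0 and 2k + 1 is 1 modulo 3, so the four exponents have residues 0, 1, 2, 0.
  sec-lambert₀ : ∀ m → let t = choose₂ m in
    sec (Λ.pf (3 ℕ.* m)) ≈ σ m * (geo (6 ℕ.* m) * (X ^ (6 ℕ.* t ℕ.+ 4 ℕ.* m) + X ^ (1 ℕ.+ (6 ℕ.* t ℕ.+ 10 ℕ.* m))))
  sec-lambert₀ m = trans (sec-lambert-term (3 ℕ.* m) (choose₂-triple m)
      (sec₀ (6 ℕ.* t ℕ.+ 4 ℕ.* m) (l₀ t m))
      (sec₁ (6 ℕ.* t ℕ.+ 6 ℕ.* m) (l₁ t m))
      (sec₂ (6 ℕ.* t ℕ.+ 8 ℕ.* m) (l₂ t m))
      (sec₀ (1 ℕ.+ (6 ℕ.* t ℕ.+ 10 ℕ.* m)) (l₃ t m)))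
    (*-cong (σ-triple m) (*-cong (reflexive (≡.cong geo (l₄ m)))
      (solve 2 (λ a b → a :+ (:0 :+ :0) :+ (:0 :+ :0) :+ b := a :+ b) refl _ _)))
    where
    t = choose₂ m
    l₀ : ∀ t m → 2 ℕ.* (9 ℕ.* t ℕ.+ 3 ℕ.* m) ℕ.+ 2 ℕ.* (3 ℕ.* m) ≡ 3 ℕ.* (6 ℕ.* t ℕ.+ 4 ℕ.* m)
    l₀ = ℕSolver.solve-∀
    l₁ : ∀ t m → 2 ℕ.* (9 ℕ.* t ℕ.+ 3 ℕ.* m) ℕ.+ 2 ℕ.* (3 ℕ.* m) ℕ.+ suc (2 ℕ.* (3 ℕ.* m)) ≡ 1 ℕ.+ 3 ℕ.* (6 ℕ.* t ℕ.+ 6 ℕ.* m)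
    l₁ = ℕSolver.solve-∀
    l₂ : ∀ t m → 2 ℕ.* (9 ℕ.* t ℕ.+ 3 ℕ.* m) ℕ.+ 2 ℕ.* (3 ℕ.* m) ℕ.+ (suc (2 ℕ.* (3 ℕ.* m)) ℕ.+ suc (2 ℕ.* (3 ℕ.* m))) ≡ 2 ℕ.+ 3 ℕ.* (6 ℕ.* t ℕ.+ 8 ℕ.* m)
    l₂ = ℕSolver.solve-∀
    l₃ : ∀ t m → 2 ℕ.* (9 ℕ.* t ℕ.+ 3 ℕ.* m) ℕ.+ 2 ℕ.* (3 ℕ.* m) ℕ.+ (suc (2 ℕ.* (3 ℕ.* m)) ℕ.+ (suc (2 ℕ.* (3 ℕ.* m)) ℕ.+ suc (2 ℕ.* (3 ℕ.* m)))) ≡ 3 ℕ.* (1 ℕ.+ (6 ℕ.* t ℕ.+ 10 ℕ.* m))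
    l₃ = ℕSolver.solve-∀
    l₄ : ∀ m → 2 ℕ.* (3 ℕ.* m) ≡ 6 ℕ.* m
    l₄ = ℕSolver.solve-∀

  -- Here 3 divides 2k + 1 and e = k² + k is 2 modulo 3, so no exponent is divisible by 3.
  sec-lambert₁ : ∀ m → sec (Λ.pf (1 ℕ.+ 3 ℕ.* m)) ≈ 0#
  sec-lambert₁ m = trans (sec-lambert-term (1 ℕ.+ 3 ℕ.* m) (≡.cong (λ z → z ℕ.+ 3 ℕ.* m) (choose₂-triple m))
      (sec₂ (6 ℕ.* t ℕ.+ 6 ℕ.* m) (l₀ t m))
      (sec₂ (6 ℕ.* t ℕ.+ 8 ℕ.* m ℕ.+ 1) (l₁ t m))
      (sec₂ (6 ℕ.* t ℕ.+ 10 ℕ.* m ℕ.+ 2) (l₂ t m))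
      (sec₂ (6 ℕ.* t ℕ.+ 12 ℕ.* m ℕ.+ 3) (l₃ t m)))
    (solve 2 (λ s g → s :* (g :* (:0 :+ (:0 :+ :0) :+ (:0 :+ :0) :+ :0)) := :0) refl _ _)
    where
    t = choose₂ m
    l₀ : ∀ t m → 2 ℕ.* (9 ℕ.* t ℕ.+ 3 ℕ.* m ℕ.+ 3 ℕ.* m) ℕ.+ 2 ℕ.* (1 ℕ.+ 3 ℕ.* m) ≡ 2 ℕ.+ 3 ℕ.* (6 ℕ.* t ℕ.+ 6 ℕ.* m)
    l₀ = ℕSolver.solve-∀
    l₁ : ∀ t m → 2 ℕ.* (9 ℕ.* t ℕ.+ 3 ℕ.* m ℕ.+ 3 ℕ.* m) ℕ.+ 2 ℕ.* (1 ℕ.+ 3 ℕ.* m) ℕ.+ suc (2 ℕ.* (1 ℕ.+ 3 ℕ.* m)) ≡ 2 ℕ.+ 3 ℕ.* (6 ℕ.* t ℕ.+ 8 ℕ.* m ℕ.+ 1)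
    l₁ = ℕSolver.solve-∀
    l₂ : ∀ t m → 2 ℕ.* (9 ℕ.* t ℕ.+ 3 ℕ.* m ℕ.+ 3 ℕ.* m) ℕ.+ 2 ℕ.* (1 ℕ.+ 3 ℕ.* m) ℕ.+ (suc (2 ℕ.* (1 ℕ.+ 3 ℕ.* m)) ℕ.+ suc (2 ℕ.* (1 ℕ.+ 3 ℕ.* m))) ≡ 2 ℕ.+ 3 ℕ.* (6 ℕ.* t ℕ.+ 10 ℕ.* m ℕ.+ 2)
    l₂ = ℕSolver.solve-∀
    l₃ : ∀ t m → 2 ℕ.* (9 ℕ.* t ℕ.+ 3 ℕ.* m ℕ.+ 3 ℕ.* m) ℕ.+ 2 ℕ.* (1 ℕ.+ 3 ℕ.* m) ℕ.+ (suc (2 ℕ.* (1 ℕ.+ 3 ℕ.* m)) ℕ.+ (suc (2 ℕ.* (1 ℕ.+ 3 ℕ.* m)) ℕ.+ suc (2 ℕ.* (1 ℕ.+ 3 ℕ.* m)))) ≡ 2 ℕ.+ 3 ℕ.* (6 ℕ.* t ℕ.+ 12 ℕ.* m ℕ.+ 3)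
    l₃ = ℕSolver.solve-∀

  -- Here e is 0 and 2k + 1 is 2 modulo 3, so the residues are 0, 2, 1, 0.
  sec-lambert₂ : ∀ m → let t = choose₂ m in
    sec (Λ.pf (2 ℕ.+ 3 ℕ.* m)) ≈ σ m * (geo (6 ℕ.* m ℕ.+ 4) * (X ^ (2 ℕ.+ (6 ℕ.* t ℕ.+ 8 ℕ.* m)) + X ^ (7 ℕ.+ (6 ℕ.* t ℕ.+ 14 ℕ.* m))))
  sec-lambert₂ m = trans (sec-lambert-term (2 ℕ.+ 3 ℕ.* m) (≡.cong (λ z → z ℕ.+ 3 ℕ.* m ℕ.+ suc (3 ℕ.* m)) (choose₂-triple m))
      (sec₀ (2 ℕ.+ (6 ℕ.* t ℕ.+ 8 ℕ.* m)) (l₀ t m))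
      (sec₂ (6 ℕ.* t ℕ.+ 10 ℕ.* m ℕ.+ 3) (l₁ t m))
      (sec₁ (6 ℕ.* t ℕ.+ 12 ℕ.* m ℕ.+ 5) (l₂ t m))
      (sec₀ (7 ℕ.+ (6 ℕ.* t ℕ.+ 14 ℕ.* m)) (l₃ t m)))
    (*-cong (trans (solve 1 (λ s → (:- :1) :* ((:- :1) :* s) := s) refl _) (σ-triple m)) (*-cong (reflexive (≡.cong geo (l₄ m)))
      (solve 2 (λ a b → a :+ (:0 :+ :0) :+ (:0 :+ :0) :+ b := a :+ b) refl _ _)))
    where
    t = choose₂ m
    l₀ : ∀ t m → 2 ℕ.* (9 ℕ.* t ℕ.+ 3 ℕ.* m ℕ.+ 3 ℕ.* m ℕ.+ suc (3 ℕ.* m)) ℕ.+ 2 ℕ.* (2 ℕ.+ 3 ℕ.* m) ≡ 3 ℕ.* (2 ℕ.+ (6 ℕ.* t ℕ.+ 8 ℕ.* m))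
    l₀ = ℕSolver.solve-∀
    l₁ : ∀ t m → 2 ℕ.* (9 ℕ.* t ℕ.+ 3 ℕ.* m ℕ.+ 3 ℕ.* m ℕ.+ suc (3 ℕ.* m)) ℕ.+ 2 ℕ.* (2 ℕ.+ 3 ℕ.* m) ℕ.+ suc (2 ℕ.* (2 ℕ.+ 3 ℕ.* m)) ≡ 2 ℕ.+ 3 ℕ.* (6 ℕ.* t ℕ.+ 10 ℕ.* m ℕ.+ 3)
    l₁ = ℕSolver.solve-∀
    l₂ : ∀ t m → 2 ℕ.* (9 ℕ.* t ℕ.+ 3 ℕ.* m ℕ.+ 3 ℕ.* m ℕ.+ suc (3 ℕ.* m)) ℕ.+ 2 ℕ.* (2 ℕ.+ 3 ℕ.* m) ℕ.+ (suc (2 ℕ.* (2 ℕ.+ 3 ℕ.* m)) ℕ.+ suc (2 ℕ.* (2 ℕ.+ 3 ℕ.* m))) ≡ 1 ℕ.+ 3 ℕ.* (6 ℕ.* t ℕ.+ 12 ℕ.* m ℕ.+ 5)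
    l₂ = ℕSolver.solve-∀
    l₃ : ∀ t m → 2 ℕ.* (9 ℕ.* t ℕ.+ 3 ℕ.* m ℕ.+ 3 ℕ.* m ℕ.+ suc (3 ℕ.* m)) ℕ.+ 2 ℕ.* (2 ℕ.+ 3 ℕ.* m) ℕ.+ (suc (2 ℕ.* (2 ℕ.+ 3 ℕ.* m)) ℕ.+ (suc (2 ℕ.* (2 ℕ.+ 3 ℕ.* m)) ℕ.+ suc (2 ℕ.* (2 ℕ.+ 3 ℕ.* m)))) ≡ 3 ℕ.* (7 ℕ.+ (6 ℕ.* t ℕ.+ 14 ℕ.* m))
    l₃ = ℕSolver.solve-∀
    l₄ : ∀ m → 2 ℕ.* (2 ℕ.+ 3 ℕ.* m) ≡ 6 ℕ.* m ℕ.+ 4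
    l₄ = ℕSolver.solve-∀

  euler₂≈ : ∀ m → let t = choose₂ m in
    B₂.euler m ≈ σ m * (X ^ (6 ℕ.* t ℕ.+ 4 ℕ.* m) - X ^ (2 ℕ.+ (6 ℕ.* t ℕ.+ 8 ℕ.* m)))
  euler₂≈ m = begin
    B₂.Q ^ (m ℕ.* m ℕ.+ m) * (B₂.u₀ m * (1# - B₂.Q ^ suc (m ℕ.+ m)))
      ≈⟨ *-cong (trans (B₂.Q^≈ (m ℕ.* m ℕ.+ m)) (^-congʳ X (≡.cong (λ z → 2 ℕ.* (z ℕ.+ m)) (choose₂-square m))))
                (*-cong (u₀≈ 1 m) (+-congˡ (-‿cong (B₂.Q^≈ (suc (m ℕ.+ m)))))) ⟩
    X ^ p * ((σ m * X ^ r) * (1# - X ^ v))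
      ≈⟨ solve 4 (λ p s r v → p :* ((s :* r) :* (:1 :- v)) := s :* (p :* r :- p :* (r :* v))) refl _ _ _ _ ⟩
    σ m * (X ^ p * X ^ r - X ^ p * (X ^ r * X ^ v))
      ≈⟨ *-congˡ (+-cong (X^2* p r (l₁ t m)) (-‿cong (X^3* p r v (l₂ t m)))) ⟩
    σ m * (X ^ (6 ℕ.* t ℕ.+ 4 ℕ.* m) - X ^ (2 ℕ.+ (6 ℕ.* t ℕ.+ 8 ℕ.* m))) ∎
    where
    t = choose₂ m
    p = 2 ℕ.* (t ℕ.+ t ℕ.+ m ℕ.+ m)
    r = 2 ℕ.* t
    v = 2 ℕ.* suc (m ℕ.+ m)
    l₁ : ∀ t m → 2 ℕ.* (t ℕ.+ t ℕ.+ m ℕ.+ m) ℕ.+ 2 ℕ.* t ≡ 6 ℕ.* t ℕ.+ 4 ℕ.* m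
    l₁ = ℕSolver.solve-∀
    l₂ : ∀ t m → 2 ℕ.* (t ℕ.+ t ℕ.+ m ℕ.+ m) ℕ.+ (2 ℕ.* t ℕ.+ 2 ℕ.* suc (m ℕ.+ m)) ≡ 2 ℕ.+ (6 ℕ.* t ℕ.+ 8 ℕ.* m)
    l₂ = ℕSolver.solve-∀

  -- The two monomials P and -R of the pentagonal term complete the two halves of `sec (w m)`: 1 +
  -- 2a/(1 - a) = (1 + a)/(1 - a) for P, and -1 + 2/(1 - b) = (1 + b)/(1 - b) for R.
  sec-terms : ∀ m → B₂.euler m + (sec (w m) + sec (w m)) ≈
    sec (Λ.pf (3 ℕ.* m)) + sec (Λ.pf (1 ℕ.+ 3 ℕ.* m)) + sec (Λ.pf (2 ℕ.+ 3 ℕ.* m))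
  sec-terms m = begin
    B₂.euler m + (sec (w m) + sec (w m))
      ≈⟨ +-cong (euler₂≈ m) (+-cong sw sw) ⟩
    σ m * (P - R) + (σ m * (ga * (a * P) + gb * R) + σ m * (ga * (a * P) + gb * R))
      ≈⟨ +-congʳ (*-congˡ (+-cong (sym (one-times (geo-inverse (6 ℕ.* m)))) (-‿cong (sym (one-times (geo-inverse (6 ℕ.* m ℕ.+ 4))))))) ⟩
    σ m * (((1# - a) * ga) * P - ((1# - b) * gb) * R) + (σ m * (ga * (a * P) + gb * R) + σ m * (ga * (a * P) + gb * R))
      ≈⟨ solve 7 (λ s p r a b g h →
           s :* (((:1 :- a) :* g) :* p :- ((:1 :- b) :* h) :* r) :+ (s :* (g :* (a :* p) :+ h :* r) :+ s :* (g :* (a :* p) :+ h :* r))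
           := s :* (g :* (p :+ a :* p)) :+ :0 :+ s :* (h :* (r :+ b :* r))) refl (σ m) P R a b ga gb ⟩
    σ m * (ga * (P + a * P)) + 0# + σ m * (gb * (R + b * R))
      ≈⟨ +-cong (+-cong (sym (trans (sec-lambert₀ m) (*-congˡ (*-congˡ (+-congˡ (sym aP)))))) (sym (sec-lambert₁ m)))
                (sym (trans (sec-lambert₂ m) (*-congˡ (*-congˡ (+-congˡ (sym bR)))))) ⟩
    sec (Λ.pf (3 ℕ.* m)) + sec (Λ.pf (1 ℕ.+ 3 ℕ.* m)) + sec (Λ.pf (2 ℕ.+ 3 ℕ.* m)) ∎
    where
    t = choose₂ m
    P R a b ga gb : ℤ⟦q⟧
    P = X ^ (6 ℕ.* t ℕ.+ 4 ℕ.* m)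
    R = X ^ (2 ℕ.+ (6 ℕ.* t ℕ.+ 8 ℕ.* m))
    a = X ^ suc (6 ℕ.* m)
    b = X ^ suc (6 ℕ.* m ℕ.+ 4)
    ga = geo (6 ℕ.* m)
    gb = geo (6 ℕ.* m ℕ.+ 4)
    one-times : ∀ {f g} → f ≈ 1# → f * g ≈ g
    one-times p = trans (*-congʳ p) (*-identityˡ _)
    aP : a * P ≈ X ^ (1 ℕ.+ (6 ℕ.* t ℕ.+ 10 ℕ.* m))
    aP = X^2* (suc (6 ℕ.* m)) (6 ℕ.* t ℕ.+ 4 ℕ.* m) (lem t m)
      where
      lem : ∀ t m → suc (6 ℕ.* m) ℕ.+ (6 ℕ.* t ℕ.+ 4 ℕ.* m) ≡ 1 ℕ.+ (6 ℕ.* t ℕ.+ 10 ℕ.* m)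
      lem = ℕSolver.solve-∀
    bR : b * R ≈ X ^ (7 ℕ.+ (6 ℕ.* t ℕ.+ 14 ℕ.* m))
    bR = X^2* (suc (6 ℕ.* m ℕ.+ 4)) (2 ℕ.+ (6 ℕ.* t ℕ.+ 8 ℕ.* m)) (lem t m)
      where
      lem : ∀ t m → suc (6 ℕ.* m ℕ.+ 4) ℕ.+ (2 ℕ.+ (6 ℕ.* t ℕ.+ 8 ℕ.* m)) ≡ 7 ℕ.+ (6 ℕ.* t ℕ.+ 14 ℕ.* m)
      lem = ℕSolver.solve-∀
    sw : sec (w m) ≈ σ m * (ga * (a * P) + gb * R)
    sw = trans (sec-w m) (*-congˡ (+-congʳ (*-congˡ (sym aP))))

  sec-psum : ∀ n f → sec (psum n f) ≈ psum n (λ k → sec (f k))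
  sec-psum zero    f = pointwise (λ _ → ≡.refl)
  sec-psum (suc n) f = trans (sec-+ _ _) (+-congʳ (sec-psum n f))

  -- The constant 1 of ξ times E_2 supplies the pentagonal terms of `sec-terms`, and the Lambert
  -- series of ψ² is summed in blocks of three.
  sec-ξ*E₂≈sec-lambert : sec (ι pξ) * B₂.E ≈ sec Λ.lambert
  sec-ξ*E₂≈sec-lambert = begin
    sec (ι pξ) * B₂.E
      ≈⟨ *-congʳ (trans (sec-cong ξ≈) (trans (sec-+ _ _) (+-cong sec-1 (sec-+ A A)))) ⟩
    (1# + (sec A + sec A)) * B₂.E
      ≈⟨ solve 2 (λ a e → (:1 :+ (a :+ a)) :* e := e :+ (e :* a :+ e :* a)) refl _ _ ⟩
    B₂.E + (B₂.E * sec A + B₂.E * sec A)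
      ≈⟨ +-congˡ (+-cong E₂*secA E₂*secA) ⟩
    B₂.E + (sec (Σ∞ w) + sec (Σ∞ w))
      ≈⟨ ⟶-unique (⟶-+ (Σ∞-⟶ B₂.euler-order) (⟶-+ sec-w-sum sec-w-sum))
           (⟶-cong regroup refl (sec-⟶ (⟶-subsequence (3 ℕ.*_) (λ n → ℕ.m≤n*m n 3) (Σ∞-⟶ Λ.pf-order)))) ⟩
    sec Λ.lambert ∎
    where
    E₂*secA : B₂.E * sec A ≈ sec (Σ∞ w)
    E₂*secA = trans (sym (sec-* E₆▹E₂ A)) (sec-cong watson)
    sec-w-sum : (λ n → psum n (λ k → sec (w k))) ⟶ sec (Σ∞ w)
    sec-w-sum = ⟶-cong (λ n → sec-psum n w) refl (sec-⟶ (Σ∞-⟶ w-order))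
    regroup : ∀ n → sec (psum (3 ℕ.* n) Λ.pf) ≈ psum n B₂.euler + (psum n (λ k → sec (w k)) + psum n (λ k → sec (w k)))
    regroup n = begin
      sec (psum (3 ℕ.* n) Λ.pf)
        ≈⟨ trans (sec-psum (3 ℕ.* n) Λ.pf) (psum-triples n _) ⟩
      psum n (λ k → sec (Λ.pf (3 ℕ.* k)) + sec (Λ.pf (1 ℕ.+ 3 ℕ.* k)) + sec (Λ.pf (2 ℕ.+ 3 ℕ.* k)))
        ≈⟨ psum-cong n sec-terms ⟨
      psum n (λ k → B₂.euler k + (sec (w k) + sec (w k)))
        ≈⟨ trans (psum-+ n _ _) (+-congˡ (psum-+ n _ _)) ⟩
      psum n B₂.euler + (psum n (λ k → sec (w k)) + psum n (λ k → sec (w k))) ∎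

-- The quotient (1 + 2t)²/(1 + 2s) modulo 8

module ThetaAlgebra {c ℓ} (K : CommutativeRing c ℓ) where
  open CommutativeRing K
  open IntegerCoefficients K
  open Relation.Binary.Reasoning.Setoid setoid

  -- Both sides are left doubled, since halving is possible only over the integers; there it yields
  -- a + s + 2as = 2(t + t²).
  quotient-double : ∀ a s t → (1# + (a + a)) * (1# + (s + s)) ≈ (1# + (t + t)) * (1# + (t + t)) →
    (a + s + (a * s + a * s)) + (a + s + (a * s + a * s)) ≈ ((t + t * t) + (t + t * t)) + ((t + t * t) + (t + t * t))
  quotient-double a s t eq = begin
    (a + s + (a * s + a * s)) + (a + s + (a * s + a * s))
      ≈⟨ solve 2 (λ a s → (a :+ s :+ (a :* s :+ a :* s)) :+ (a :+ s :+ (a :* s :+ a :* s)) := (:1 :+ (a :+ a)) :* (:1 :+ (s :+ s)) :- :1) refl a s ⟩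
    (1# + (a + a)) * (1# + (s + s)) - 1#
      ≈⟨ +-congʳ eq ⟩
    (1# + (t + t)) * (1# + (t + t)) - 1#
      ≈⟨ solve 1 (λ s → (:1 :+ (s :+ s)) :* (:1 :+ (s :+ s)) :- :1 := ((s :+ s :* s) :+ (s :+ s :* s)) :+ ((s :+ s :* s) :+ (s :+ s :* s))) refl t ⟩
    ((t + t * t) + (t + t * t)) + ((t + t * t) + (t + t * t)) ∎

  collect : ∀ {t s r₂ r₃ r₆ x y z} → t ≈ r₃ + (y + y) → t * t ≈ r₆ + (z + z) → s * s ≈ r₂ + (x + x) →
    (t + t * t) + s * s ≈ (r₂ + r₃ + r₆) + ((x + y + z) + (x + y + z))
  collect p q r = trans (+-cong (+-cong p q) r)
    (solve 6 (λ r₂ r₃ r₆ x y z → (r₃ :+ (y :+ y) :+ (r₆ :+ (z :+ z))) :+ (r₂ :+ (x :+ x)) :=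
      (r₂ :+ r₃ :+ r₆) :+ ((x :+ y :+ z) :+ (x :+ y :+ z))) refl _ _ _ _ _ _)

  -- Multiplying by 1 - 2s, the inverse of 1 + 2s modulo 4, isolates a: (a + s + 2as)(1 - 2s) = a +
  -- s - 2s² - 4as². Hence a is -s + 2(u + s²) modulo 4, and u + s² matters modulo 2 only.
  quotient-mod-4 : ∀ a s u {r c} → a + s + (a * s + a * s) ≈ u + u → u + s * s ≈ r + (c + c) →
    let y = (a * (s * s) - s * u) + c in a ≈ (- s + (r + r)) + ((y + y) + (y + y))
  quotient-mod-4 a s u {r} {c} linear square = begin
    a
      ≈⟨ solve 2 (λ a s → let b = a :* (s :* s) in
           a := (:- s) :+ ((a :+ s :+ (a :* s :+ a :* s)) :* (:1 :- (s :+ s)) :+ ((s :* s :+ s :* s) :+ ((b :+ b) :+ (b :+ b))))) refl a s ⟩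
    - s + ((a + s + (a * s + a * s)) * (1# - (s + s)) + ((s * s + s * s) + ((b + b) + (b + b))))
      ≈⟨ +-congˡ (+-congʳ (*-congʳ linear)) ⟩
    - s + ((u + u) * (1# - (s + s)) + ((s * s + s * s) + ((b + b) + (b + b))))
      ≈⟨ solve 4 (λ s u q b → let d = b :- s :* u in
           (:- s) :+ ((u :+ u) :* (:1 :- (s :+ s)) :+ ((q :+ q) :+ ((b :+ b) :+ (b :+ b)))) :=
           (:- s) :+ ((u :+ q) :+ (u :+ q)) :+ ((d :+ d) :+ (d :+ d))) refl s u (s * s) b ⟩
    - s + ((u + s * s) + (u + s * s)) + ((d + d) + (d + d))
      ≈⟨ +-congʳ (+-congˡ (+-cong square square)) ⟩
    - s + ((r + (c + c)) + (r + (c + c))) + ((d + d) + (d + d))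
      ≈⟨ solve 4 (λ s r c d → (:- s) :+ ((r :+ (c :+ c)) :+ (r :+ (c :+ c))) :+ ((d :+ d) :+ (d :+ d)) :=
           ((:- s) :+ (r :+ r)) :+ (((d :+ c) :+ (d :+ c)) :+ ((d :+ c) :+ (d :+ c)))) refl s r c d ⟩
    (- s + (r + r)) + (((d + c) + (d + c)) + ((d + c) + (d + c))) ∎
    where
    b d : Carrier
    b = a * (s * s)
    d = b - s * u

-- The identity T φ_1 = φ_3² and its reduction modulo 8

module ThetaQuotient where
  open Series using (ℤ⟦q⟧; pointwise; coeff; +-coeff; X)
  open CommutativeRing Series.ring hiding (zero)
  open Algebra.Properties.CommutativeSemiring.Exp commutativeSemiring using (_^_; ^-congʳ)
  open IntegerCoefficients Series.ring using (solve; _:=_; _:+_; _:*_; _:-_; :-_; :0; :1)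
  open FiniteSums Series.ring
  open Limits
  open Geometric
  open Trisection
  open EtaQuotients
  open Watson using (σ; X^2*; sec-ξ*E₂≈sec-lambert; A; ξ≈)
  open Relation.Binary.Reasoning.Setoid setoid

  1^ : ∀ k f → 1# ^ k * f ≈ f
  1^ zero    f = *-identityˡ f
  1^ (suc k) f = trans (*-congʳ (*-identityˡ _)) (1^ k f)

  module ΨDissection where
    τ : ℕ → ℤ⟦q⟧
    τ j = X ^ choose₂ (suc j)

    τ-order : ∀ {N} j → N ℕ.≤ j → τ j ≈[ N ] 0#
    τ-order j N≤j = []-weaken (ℕ.≤-trans N≤j (ℕ.m≤n+m j (choose₂ j))) (X^-order (choose₂ (suc j)))

    ψ≈τ : ψ ≈ Σ∞ τ
    ψ≈τ = ⟶-unique (Σ∞-⟶ ΨTheta.θ-order)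
      (⟶-cong (λ n → trans (psum-pairs n τ) (psum-cong n pair)) refl
        (⟶-subsequence (λ n → n ℕ.+ n) (λ n → ℕ.m≤m+n n n) (Σ∞-⟶ (λ j → τ-order j ℕ.≤-refl))))
      where
      l₁ : ∀ t k → 4 ℕ.* t ℕ.+ k ℕ.+ (k ℕ.+ k) ≡ 4 ℕ.* t ℕ.+ 3 ℕ.* k
      l₁ = ℕSolver.solve-∀
      l₂ : ∀ t k → 4 ℕ.* t ℕ.+ k ℕ.+ (k ℕ.+ k) ℕ.+ suc (k ℕ.+ k) ≡ 4 ℕ.* (t ℕ.+ k) ℕ.+ 1 ℕ.* suc k
      l₂ = ℕSolver.solve-∀
      pair : ∀ k → τ (k ℕ.+ k) + τ (suc (k ℕ.+ k)) ≈ ΨTheta.θ k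
      pair k = +-cong
        (trans (^-congʳ X (≡.trans (≡.cong (ℕ._+ (k ℕ.+ k)) (choose₂-pair k)) (l₁ (choose₂ k) k))) (sym (1^ k _)))
        (trans (^-congʳ X (≡.trans (≡.cong (λ z → z ℕ.+ (k ℕ.+ k) ℕ.+ suc (k ℕ.+ k)) (choose₂-pair k)) (l₂ (choose₂ k) k))) (sym (1^ (suc k) _)))

    -- The triangular number j(j+1)/2 is divisible by 3 for j = 3k and j = 3k + 2, and equals 1 +
    -- 9k(k+1)/2 for j = 3k + 1.
    h l l′ : ℕ → ℤ⟦q⟧
    h k = τ (3 ℕ.* k) + τ (2 ℕ.+ 3 ℕ.* k)
    l k = X ^ (3 ℕ.* (3 ℕ.* choose₂ (suc k)))
    l′ k = X ^ (3 ℕ.* choose₂ (suc k))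

    h-order : ∀ k → h k ≈[ k ] 0#
    h-order k = []-trans ([]-+ (τ-order (3 ℕ.* k) (ℕ.m≤n*m k 3)) (τ-order (2 ℕ.+ 3 ℕ.* k) (ℕ.m≤n⇒m≤o+n 2 (ℕ.m≤n*m k 3)))) (≈⇒[] (+-identityˡ _))

    l′-order : ∀ k → l′ k ≈[ k ] 0#
    l′-order k = []-weaken (ℕ.≤-trans (ℕ.m≤n+m k (choose₂ k)) (ℕ.m≤n*m _ 3)) (X^-order (3 ℕ.* choose₂ (suc k)))

    l-order : ∀ k → l k ≈[ k ] 0#
    l-order k = []-weaken (ℕ.≤-trans (ℕ.m≤n+m k (choose₂ k)) (ℕ.≤-trans (ℕ.m≤n*m _ 3) (ℕ.m≤n*m _ 3))) (X^-order (3 ℕ.* (3 ℕ.* choose₂ (suc k))))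

    H▹g : Σ∞ h ▹ g
    H▹g = ▹-⟶ (▹-psum term) (Σ∞-⟶ h-order) (Σ∞-⟶ GTheta.θ-order)
      where
      l₁ : ∀ t k → 9 ℕ.* t ℕ.+ 3 ℕ.* k ℕ.+ 3 ℕ.* k ≡ 3 ℕ.* (3 ℕ.* t ℕ.+ 2 ℕ.* k)
      l₁ = ℕSolver.solve-∀
      l₂ : ∀ t k → 9 ℕ.* t ℕ.+ 3 ℕ.* suc k ≡ 3 ℕ.* (3 ℕ.* t ℕ.+ 1 ℕ.* suc k)
      l₂ = ℕSolver.solve-∀
      term : ∀ k → h k ▹ GTheta.θ k
      term k = ▹-+
        (▹-cong (^-congʳ X (≡.sym (≡.trans (≡.cong (ℕ._+ 3 ℕ.* k) (choose₂-triple k)) (l₁ (choose₂ k) k))))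
                (sym (1^ k _)) (▹-X^ (3 ℕ.* choose₂ k ℕ.+ 2 ℕ.* k)))
        (▹-cong (^-congʳ X (≡.sym (≡.trans (≡.cong choose₂ (≡.sym (ℕ.*-suc 3 k))) (≡.trans (choose₂-triple (suc k)) (l₂ (choose₂ (suc k)) k)))))
                (sym (1^ (suc k) _)) (▹-X^ (3 ℕ.* choose₂ (suc k) ℕ.+ 1 ℕ.* suc k)))

    L▹ : Σ∞ l ▹ Σ∞ l′
    L▹ = ▹-⟶ (▹-psum (λ k → ▹-X^ (3 ℕ.* choose₂ (suc k)))) (Σ∞-⟶ l-order) (Σ∞-⟶ l′-order)

    ψ≈ₜ : ψ ≈ Σ∞ h + X * Σ∞ l
    ψ≈ₜ = ⟶-unique
      (⟶-cong (λ n → refl) (sym ψ≈τ) (⟶-subsequence (3 ℕ.*_) (λ n → ℕ.m≤n*m n 3) (Σ∞-⟶ (λ j → τ-order j ℕ.≤-refl))))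
      (⟶-cong (λ n → sym (triples n)) refl (⟶-+ (Σ∞-⟶ h-order) (⟶-* (⟶-const X) (Σ∞-⟶ l-order))))
      where
      l₁ : ∀ t k → 9 ℕ.* t ℕ.+ 3 ℕ.* k ℕ.+ 3 ℕ.* k ℕ.+ suc (3 ℕ.* k) ≡ suc (3 ℕ.* (3 ℕ.* (t ℕ.+ k)))
      l₁ = ℕSolver.solve-∀
      middle : ∀ k → τ (1 ℕ.+ 3 ℕ.* k) ≈ X * l k
      middle k = ^-congʳ X (≡.trans (≡.cong (λ z → z ℕ.+ 3 ℕ.* k ℕ.+ suc (3 ℕ.* k)) (choose₂-triple k)) (l₁ (choose₂ k) k))
      triples : ∀ n → psum (3 ℕ.* n) τ ≈ psum n h + X * psum n l
      triples n = begin
        psum (3 ℕ.* n) τ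
          ≈⟨ psum-triples n τ ⟩
        psum n (λ k → τ (3 ℕ.* k) + τ (1 ℕ.+ 3 ℕ.* k) + τ (2 ℕ.+ 3 ℕ.* k))
          ≈⟨ psum-cong n (λ k → trans (solve 3 (λ a b c → a :+ b :+ c := (a :+ c) :+ b) refl _ _ _) (+-congˡ (middle k))) ⟩
        psum n (λ k → h k + X * l k)
          ≈⟨ trans (psum-+ n h _) (+-congˡ (psum-* n X l)) ⟩
        psum n h + X * psum n l ∎

    -- In (H + qL)² with H and L series in q³, the terms 2qHL and q²L² have only exponents congruent
    -- to 1 and 2 modulo 3.
    sec-ψ² : sec (ψ * ψ) ≈ g * g
    sec-ψ² = begin
      sec (ψ * ψ)
        ≈⟨ sec-cong (trans (*-cong ψ≈ₜ ψ≈ₜ) (solve 3 (λ h x l → (h :+ x :* l) :* (h :+ x :* l) :=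
             h :* (h :* :1) :+ (h :* (l :* (x :+ x)) :+ l :* (l :* (x :* x)))) refl (Σ∞ h) X (Σ∞ l))) ⟩
      sec (Σ∞ h * (Σ∞ h * 1#) + (Σ∞ h * (Σ∞ l * (X + X)) + Σ∞ l * (Σ∞ l * (X * X))))
        ≈⟨ trans (sec-+ _ _) (+-congˡ (sec-+ _ _)) ⟩
      sec (Σ∞ h * (Σ∞ h * 1#)) + (sec (Σ∞ h * (Σ∞ l * (X + X))) + sec (Σ∞ l * (Σ∞ l * (X * X))))
        ≈⟨ +-cong (trans (sec-cong (sym (*-assoc _ _ _))) (trans (sec-* (▹-* H▹g H▹g) 1#) (*-congˡ sec-1)))
             (+-cong (trans (sec-cong (sym (*-assoc _ _ _))) (trans (sec-* (▹-* H▹g L▹) (X + X)) (*-congˡ (trans (sec-+ X X) (+-cong sec-X sec-X)))))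
                     (trans (sec-cong (sym (*-assoc _ _ _))) (trans (sec-* (▹-* L▹ L▹) (X * X)) (*-congˡ sec-X²)))) ⟩
      (g * g) * 1# + ((g * Σ∞ l′) * (0# + 0#) + (Σ∞ l′ * Σ∞ l′) * 0#)
        ≈⟨ solve 2 (λ g l → (g :* g) :* :1 :+ ((g :* l) :* (:0 :+ :0) :+ (l :* l) :* :0) := g :* g) refl _ _ ⟩
      g * g ∎

  sec-ξ*φ₁≈φ₃² : sec (ι pξ) * φ₁ ≈ φ₃ * φ₃
  sec-ξ*φ₁≈φ₃² = begin
    T * φ₁
      ≈⟨ trans (sym (*-identityˡ _)) (*-congʳ (sym (trans (*-cong B₂.EW B₂.EW) (*-identityˡ 1#)))) ⟩
    ((B₂.E * B₂.W) * (B₂.E * B₂.W)) * (T * φ₁)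
      ≈⟨ solve 4 (λ e w t p → ((e :* w) :* (e :* w)) :* (t :* p) := (w :* w) :* ((t :* e) :* (e :* p))) refl _ _ _ _ ⟩
    (B₂.W * B₂.W) * ((T * B₂.E) * (B₂.E * φ₁))
      ≈⟨ *-congˡ (*-cong (trans sec-ξ*E₂≈sec-lambert (trans (sec-cong ΨSquare.lambert≈ψ²) ΨDissection.sec-ψ²)) (sym E₁²≈)) ⟩
    (B₂.W * B₂.W) * ((g * g) * (B₁.E * B₁.E))
      ≈⟨ *-congˡ (trans (solve 2 (λ g e → (g :* g) :* (e :* e) := (g :* e) :* (g :* e)) refl _ _) (*-cong gE₁≈ gE₁≈)) ⟩
    (B₂.W * B₂.W) * ((φ₃ * B₂.E) * (φ₃ * B₂.E))
      ≈⟨ solve 3 (λ e w p → (w :* w) :* ((p :* e) :* (p :* e)) := ((e :* w) :* (e :* w)) :* (p :* p)) refl _ _ _ ⟩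
    ((B₂.E * B₂.W) * (B₂.E * B₂.W)) * (φ₃ * φ₃)
      ≈⟨ trans (*-congʳ (trans (*-cong B₂.EW B₂.EW) (*-identityˡ 1#))) (*-identityˡ _) ⟩
    φ₃ * φ₃ ∎
    where
    T : ℤ⟦q⟧
    T = sec (ι pξ)

  square-term signed-term : ℕ → ℕ → ℤ⟦q⟧
  square-term c k = X ^ (c ℕ.* (suc k ℕ.* suc k))
  signed-term c k = σ (suc k) * square-term c k

  square-order : ∀ c′ k → square-term (suc c′) k ≈[ suc k ] 0#
  square-order c′ k = []-weaken (ℕ.≤-trans (ℕ.m≤m*n (suc k) (suc k)) (ℕ.m≤n*m (suc k ℕ.* suc k) (suc c′))) (X^-order (suc c′ ℕ.* (suc k ℕ.* suc k)))

  signed-order : ∀ c′ k → signed-term (suc c′) k ≈[ suc k ] 0#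
  signed-order c′ k = order-*ʳ (suc k) (σ (suc k)) (square-order c′ k)

  private
    down : ∀ {f : ℕ → ℤ⟦q⟧} → (∀ k → f k ≈[ suc k ] 0#) → ∀ k → f k ≈[ k ] 0#
    down p k = []-weaken (ℕ.n≤1+n k) (p k)

  R S : ℕ → ℤ⟦q⟧
  R c = Σ∞ (square-term c)
  S c = Σ∞ (signed-term c)

  -- The first halves of the terms of θ run over k = 0, 1, 2, ... and the second halves over k = -1,
  -- -2, ...; as k² is even in k, they agree after a shift by one, up to the term k = 0.
  φ≈1+2S : ∀ c′ → Φ.φ c′ ≈ 1# + (S (suc c′) + S (suc c′))
  φ≈1+2S c′ = trans (⟶-unique (⟶-subsequence suc ℕ.n≤1+n (Σ∞-⟶ Th.θ-order))
    (⟶-cong (λ n → sym (split n)) refl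
      (⟶-+ (⟶-+ (⟶-const 1#) S-sum) (⟶-subsequence suc ℕ.n≤1+n S-sum)))) (+-assoc _ _ _)
    where
    module Th = Φ.Th c′
    c = suc c′
    S-sum : (λ n → psum n (signed-term c)) ⟶ S c
    S-sum = Σ∞-⟶ {signed-term c} (down {signed-term (suc c′)} (signed-order c′))
    first second : ℕ → ℤ⟦q⟧
    first k  = σ k * X ^ (suc (c′ ℕ.+ suc c′) ℕ.* choose₂ k ℕ.+ suc c′ ℕ.* k)
    second k = σ (suc k) * X ^ (suc (c′ ℕ.+ suc c′) ℕ.* choose₂ (suc k) ℕ.+ suc c′ ℕ.* suc k)
    exponent : ∀ k → suc (c′ ℕ.+ suc c′) ℕ.* choose₂ k ℕ.+ suc c′ ℕ.* k ≡ c ℕ.* (k ℕ.* k)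
    exponent k = ≡.trans (lem (choose₂ k) k c′) (≡.cong (c ℕ.*_) (≡.sym (choose₂-square k)))
      where
      lem : ∀ t k c′ → suc (c′ ℕ.+ suc c′) ℕ.* t ℕ.+ suc c′ ℕ.* k ≡ suc c′ ℕ.* ((t ℕ.+ t) ℕ.+ k)
      lem = ℕSolver.solve-∀
    second≈ : ∀ k → second k ≈ signed-term c k
    second≈ k = *-congˡ (^-congʳ X (exponent (suc k)))
    first₀ : first 0 ≈ 1#
    first₀ = trans (*-identityˡ _) (^-congʳ X (≡.trans (exponent 0) (ℕ.*-zeroʳ c)))
    split : ∀ n → psum (suc n) Th.θ ≈ 1# + psum n (signed-term c) + psum (suc n) (signed-term c)
    split n = begin
      psum (suc n) (λ k → first k + second k)
        ≈⟨ psum-+ (suc n) first second ⟩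
      psum (suc n) first + psum (suc n) second
        ≈⟨ +-cong (trans (psum-head n first) (+-cong first₀ (psum-cong n second≈))) (psum-cong (suc n) second≈) ⟩
      1# + psum n (signed-term c) + psum (suc n) (signed-term c) ∎

  double-injective : ∀ {f g} → f + f ≈ g + g → f ≈ g
  double-injective {f} {g} p = pointwise (λ n → ℤ.*-cancelˡ-≡ (ℤ.+ 2) (f n) (g n)
    (≡.trans (≡.sym (2* (f n))) (≡.trans (≡.sym (+-coeff f f n)) (≡.trans (coeff p n) (≡.trans (+-coeff g g n) (2* (g n)))))))
    where
    2* : ∀ i → i ℤ.+ i ≡ ℤ.+ 2 ℤ.* i
    2* i = ≡.sym (≡.trans (ℤ.*-distribʳ-+ i (ℤ.+ 1) (ℤ.+ 1)) (≡.cong₂ ℤ._+_ (ℤ.*-identityˡ i) (ℤ.*-identityˡ i)))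

  -- Each pair of distinct indices occurs twice, so the cross terms collect into 2 Σ_k f_k Σ_(j<k)
  -- f_j, which converges because f_k has order at least k.
  square-sum : ∀ (f : ℕ → ℤ⟦q⟧) → (∀ k → f k ≈[ k ] 0#) → ∃[ C ] Σ∞ f * Σ∞ f ≈ Σ∞ (λ k → f k * f k) + (C + C)
  square-sum f f-order = Σ∞ cross , ⟶-unique (⟶-* (Σ∞-⟶ f-order) (Σ∞-⟶ f-order))
    (⟶-cong (λ n → sym (expand n)) refl (⟶-+ (Σ∞-⟶ (λ k → order-*ˡ k (f k) (f-order k))) (⟶-+ cross-sum cross-sum)))
    where
    cross : ℕ → ℤ⟦q⟧
    cross k = f k * psum k f
    cross-sum = Σ∞-⟶ {cross} (λ k → order-*ˡ k (psum k f) (f-order k))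
    expand : ∀ n → psum n f * psum n f ≈ psum n (λ k → f k * f k) + (psum n cross + psum n cross)
    expand zero    = solve 1 (λ z → :0 :* :0 := :0 :+ (:0 :+ :0)) refl 1#
    expand (suc n) = trans (solve 2 (λ p f → (p :+ f) :* (p :+ f) := p :* p :+ (f :* f :+ (f :* p :+ f :* p))) refl (psum n f) (f n))
      (trans (+-congʳ (expand n)) (solve 4 (λ a b c d → (a :+ (b :+ b)) :+ (c :+ (d :+ d)) := (a :+ c) :+ ((b :+ d) :+ (b :+ d))) refl _ _ _ _))

  signed-square : ∀ c k → signed-term c k * signed-term c k ≈ square-term (2 ℕ.* c) k
  signed-square c k = trans (solve 2 (λ s x → (s :* x) :* (s :* x) := (s :* s) :* (x :* x)) refl _ _)
    (trans (*-congʳ (σ² (suc k))) (trans (*-identityˡ _) (X^2* (c ℕ.* (suc k ℕ.* suc k)) _ (lem c k))))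
    where
    σ² : ∀ k → σ k * σ k ≈ 1#
    σ² zero    = *-identityˡ 1#
    σ² (suc k) = trans (solve 1 (λ s → ((:- :1) :* s) :* ((:- :1) :* s) := s :* s) refl _) (σ² k)
    lem : ∀ c k → c ℕ.* (suc k ℕ.* suc k) ℕ.+ c ℕ.* (suc k ℕ.* suc k) ≡ 2 ℕ.* c ℕ.* (suc k ℕ.* suc k)
    lem = ℕSolver.solve-∀

  S² : ∀ c′ → ∃[ C ] S (suc c′) * S (suc c′) ≈ R (2 ℕ.* suc c′) + (C + C)
  S² c′ = let C , p = square-sum (signed-term (suc c′)) (down {signed-term (suc c′)} (signed-order c′)) in
    C , trans p (+-congʳ (Σ∞-cong (signed-square (suc c′))))

  S-parity : ∀ c′ → ∃[ C ] S (suc c′) ≈ R (suc c′) + (C + C)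
  S-parity c′ = Σ∞ y , ⟶-unique (Σ∞-⟶ {signed-term (suc c′)} (down {signed-term (suc c′)} (signed-order c′)))
    (⟶-cong (λ n → sym (trans (psum-cong n term) (trans (psum-+ n _ _) (+-congˡ (psum-+ n y y))))) refl
      (⟶-+ (Σ∞-⟶ {square-term (suc c′)} (down {square-term (suc c′)} (square-order c′))) (⟶-+ y-sum y-sum)))
    where
    -- z k is ((-1)^k - 1)/2, which makes the congruence of signs with 1 modulo 2 explicit.
    z : ℕ → ℤ⟦q⟧
    z zero    = 0#
    z (suc k) = - 1# - z k
    σ≈ : ∀ k → σ k ≈ 1# + (z k + z k)
    σ≈ zero    = solve 1 (λ w → :1 := :1 :+ (:0 :+ :0)) refl 1#
    σ≈ (suc k) = trans (*-congˡ (σ≈ k)) (solve 1 (λ z → (:- :1) :* (:1 :+ (z :+ z)) := :1 :+ ((:- :1 :- z) :+ (:- :1 :- z))) refl _)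
    y : ℕ → ℤ⟦q⟧
    y k = z (suc k) * square-term (suc c′) k
    y-sum = Σ∞-⟶ {y} (λ k → order-*ʳ k (z (suc k)) (down {square-term (suc c′)} (square-order c′) k))
    term : ∀ k → signed-term (suc c′) k ≈ square-term (suc c′) k + (y k + y k)
    term k = trans (*-congʳ (σ≈ (suc k))) (solve 2 (λ z x → (:1 :+ (z :+ z)) :* x := x :+ (z :* x :+ z :* x)) refl _ _)

  -- As T = 1 + 2v, the series v is needed modulo 4. There S 1 has coefficient -1 and keeps its
  -- signs, whereas S 3 + S 3² + S 1² occurs doubled and may be replaced by the unsigned sum of the
  -- same parity.
  sec-ξ-mod-8 : ∃[ y ] let v = (- S 1 + ((R 2 + R 3 + R 6) + (R 2 + R 3 + R 6))) + ((y + y) + (y + y)) in sec (ι pξ) ≈ 1# + (v + v)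
  sec-ξ-mod-8 =
    let _ , S₁²≈ = S² 0 ; _ , S₃≈ = S-parity 2 ; _ , S₃²≈ = S² 2
        a≈ = quotient-mod-4 _ _ _ (double-injective (quotient-double _ _ _ quotient)) (collect S₃≈ S₃²≈ S₁²≈)
    in _ , trans T≈ (+-congˡ (+-cong a≈ a≈))
    where
    open ThetaAlgebra Series.ring
    T≈ : sec (ι pξ) ≈ 1# + (sec A + sec A)
    T≈ = trans (sec-cong ξ≈) (trans (sec-+ _ _) (+-cong sec-1 (sec-+ A A)))
    quotient : (1# + (sec A + sec A)) * (1# + (S 1 + S 1)) ≈ (1# + (S 3 + S 3)) * (1# + (S 3 + S 3))
    quotient = trans (*-cong (sym T≈) (sym (φ≈1+2S 0))) (trans sec-ξ*φ₁≈φ₃² (*-cong (φ≈1+2S 2) (φ≈1+2S 2)))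

-- Disjointness of the exponent families

∣square⇒∣ : ∀ {q} → Prime q → ∀ a → q ℕ.∣ a ℕ.* a → q ℕ.∣ a
∣square⇒∣ q-prime a d = reduce (euclidsLemma a a q-prime d)

-- Infinite descent: q divides a, hence r b², hence b; dividing a and b by q gives a smaller
-- solution. The cofactor r is there for 6 = 2 · 3.
√-irrational : ∀ {q} r → Prime q → ¬ (q ℕ.∣ r) → ∀ b a → a ℕ.* a ≡ q ℕ.* r ℕ.* (b ℕ.* b) → b ≡ 0
√-irrational {q} r q-prime q∤r = <-rec _ descend
  where
  instance
    q≢0 = prime⇒nonZero q-prime
    q≢1 = prime⇒nonTrivial q-prime

  descend : ∀ b → (∀ {b′} → b′ ℕ.< b → ∀ a → a ℕ.* a ≡ q ℕ.* r ℕ.* (b′ ℕ.* b′) → b′ ≡ 0) →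
            ∀ a → a ℕ.* a ≡ q ℕ.* r ℕ.* (b ℕ.* b) → b ≡ 0
  descend zero    rec a eq = ≡.refl
  descend b@(suc _) rec a eq
    with ∣square⇒∣ q-prime a (ℕ.divides (r ℕ.* (b ℕ.* b)) (≡.trans eq (lem q r (b ℕ.* b))))
    where
    lem : ∀ q r z → q ℕ.* r ℕ.* z ≡ r ℕ.* z ℕ.* q
    lem = ℕSolver.solve-∀
  ... | ℕ.divides a′ ≡.refl = quotient (reduce′ (euclidsLemma r (b ℕ.* b) q-prime (ℕ.divides (a′ ℕ.* a′) eq′)))
    where
    lem₁ : ∀ a q → a ℕ.* q ℕ.* (a ℕ.* q) ≡ q ℕ.* (a ℕ.* a ℕ.* q)
    lem₁ = ℕSolver.solve-∀
    lem₂ : ∀ q r z → q ℕ.* r ℕ.* z ≡ q ℕ.* (r ℕ.* z)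
    lem₂ = ℕSolver.solve-∀
    eq′ : r ℕ.* (b ℕ.* b) ≡ a′ ℕ.* a′ ℕ.* q
    eq′ = ℕ.*-cancelˡ-≡ _ _ q (≡.trans (≡.sym (lem₂ q r (b ℕ.* b))) (≡.trans (≡.sym eq) (lem₁ a′ q)))
    reduce′ : q ℕ.∣ r ⊎ q ℕ.∣ b ℕ.* b → q ℕ.∣ b
    reduce′ (inj₁ q∣r) = contradiction q∣r q∤r
    reduce′ (inj₂ q∣b²) = ∣square⇒∣ q-prime b q∣b²
    quotient : q ℕ.∣ b → b ≡ 0
    quotient (ℕ.divides b′ b≡) = ≡.trans b≡ (≡.cong (ℕ._* q) (rec b′<b a′ a′²≡))
      where
      b′<b : b′ ℕ.< b
      b′<b = smaller b′ b≡
        where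
        smaller : ∀ c → b ≡ c ℕ.* q → c ℕ.< b
        smaller (suc c) p = ≡.subst (suc c ℕ.<_) (≡.sym p) (ℕ.m<m*n (suc c) q (ℕ.nonTrivial⇒n>1 q))
      lem₃ : ∀ q r b → r ℕ.* (b ℕ.* q ℕ.* (b ℕ.* q)) ≡ (q ℕ.* r ℕ.* (b ℕ.* b)) ℕ.* q
      lem₃ = ℕSolver.solve-∀
      a′²≡ : a′ ℕ.* a′ ≡ q ℕ.* r ℕ.* (b′ ℕ.* b′)
      a′²≡ = ℕ.*-cancelʳ-≡ _ _ q (≡.trans (≡.sym eq′) (≡.trans (≡.cong (λ z → r ℕ.* (z ℕ.* z)) b≡) (lem₃ q r b′)))

√2 : ∀ a b → a ℕ.* a ≢ 2 ℕ.* (suc b ℕ.* suc b)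
√2 a b eq with √-irrational 1 prime[2] (from-no (2 ℕ.∣? 1)) (suc b) a eq
... | ()

√3 : ∀ a b → a ℕ.* a ≢ 3 ℕ.* (suc b ℕ.* suc b)
√3 a b eq with √-irrational 1 (from-yes (prime? 3)) (from-no (3 ℕ.∣? 1)) (suc b) a eq
... | ()

√6 : ∀ a b → a ℕ.* a ≢ 6 ℕ.* (suc b ℕ.* suc b)
√6 a b eq with √-irrational 3 prime[2] (from-no (2 ℕ.∣? 3)) (suc b) a eq
... | ()

sq : ℕ → ℕ
sq k = suc k ℕ.* suc k

-- Doubling 2a² = 3b² gives (2a)² = 6b².
2sq≢3sq : ∀ a b → 2 ℕ.* sq a ≢ 3 ℕ.* sq b
2sq≢3sq a b eq = √6 (2 ℕ.* suc a) b (≡.trans (l₁ (suc a)) (≡.trans (≡.cong (2 ℕ.*_) eq) (l₂ (sq b))))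
  where
  l₁ : ∀ a → 2 ℕ.* a ℕ.* (2 ℕ.* a) ≡ 2 ℕ.* (2 ℕ.* (a ℕ.* a))
  l₁ = ℕSolver.solve-∀
  l₂ : ∀ z → 2 ℕ.* (3 ℕ.* z) ≡ 6 ℕ.* z
  l₂ = ℕSolver.solve-∀

2sq≢6sq : ∀ a b → 2 ℕ.* sq a ≢ 6 ℕ.* sq b
2sq≢6sq a b eq = √3 (suc a) b (ℕ.*-cancelˡ-≡ _ _ 2 (≡.trans eq (l (sq b))))
  where
  l : ∀ z → 6 ℕ.* z ≡ 2 ℕ.* (3 ℕ.* z)
  l = ℕSolver.solve-∀

3sq≢6sq : ∀ a b → 3 ℕ.* sq a ≢ 6 ℕ.* sq b
3sq≢6sq a b eq = √2 (suc a) b (ℕ.*-cancelˡ-≡ _ _ 3 (≡.trans eq (l (sq b))))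
  where
  l : ∀ z → 6 ℕ.* z ≡ 3 ℕ.* (2 ℕ.* z)
  l = ℕSolver.solve-∀

sq-injective : ∀ j k → sq j ≡ sq k → j ≡ k
sq-injective j k eq = ℕ.suc-injective (ℕ.≤-antisym (le j k eq) (le k j (≡.sym eq)))
  where
  le : ∀ j k → sq j ≡ sq k → suc j ℕ.≤ suc k
  le j k eq = ℕ.≮⇒≥ (λ k<j → ℕ.<⇒≢ (ℕ.*-mono-< k<j k<j) (≡.sym eq))

-- Coefficients of the theta series and the cases of the congruence

module Coefficients where
  open Series using (ℤ⟦q⟧; coeff; +-coeff; neg-coeff; 1ₛ)
  open CommutativeRing Series.ring hiding (zero)
  open Algebra.Properties.CommutativeSemiring.Exp commutativeSemiring using (_^_)
  open IntegerCoefficients Series.ring using (solve; _:=_; _:*_; _:-_; :-_; :1)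
  open FiniteSums Series.ring
  open Limits
  open Geometric
  open Watson using (σ)
  open ThetaQuotient

  psum-miss : ∀ (f : ℕ → ℤ⟦q⟧) n M → (∀ j → j ℕ.< M → f j n ≡ ℤ.+ 0) → psum M f n ≡ ℤ.+ 0
  psum-miss f n zero    p = ≡.refl
  psum-miss f n (suc M) p = ≡.trans (+-coeff (psum M f) (f M) n)
    (≡.cong₂ ℤ._+_ (psum-miss f n M (λ j l → p j (ℕ.m≤n⇒m≤1+n l))) (p M ℕ.≤-refl))

  psum-hit : ∀ (f : ℕ → ℤ⟦q⟧) n k M → k ℕ.< M → (∀ j → j ≢ k → f j n ≡ ℤ.+ 0) → psum M f n ≡ f k n
  psum-hit f n k (suc M) (s≤s k≤M) p with k ℕ.≟ M
  ... | yes ≡.refl = ≡.trans (+-coeff (psum M f) (f M) n)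
    (≡.trans (≡.cong (λ r → r ℤ.+ f M n) (psum-miss f n M (λ j l → p j (ℕ.<⇒≢ l)))) (ℤ.+-identityˡ _))
  ... | no k≢M = ≡.trans (+-coeff (psum M f) (f M) n)
    (≡.trans (≡.cong₂ ℤ._+_ (psum-hit f n k M (ℕ.≤∧≢⇒< k≤M k≢M) p) (p M (k≢M ∘ ≡.sym))) (ℤ.+-identityʳ _))

  signed-coeff : ∀ k f n → (σ k * f) n ≡ (ℤ.- ℤ.+ 1) ℤ.^ k ℤ.* f n
  signed-coeff zero    f n = ≡.trans (coeff (*-identityˡ f) n) (≡.sym (ℤ.*-identityˡ (f n)))
  signed-coeff (suc k) f n = ≡.trans (coeff (solve 2 (λ s f → ((:- :1) :* s) :* f := :- (s :* f)) refl (σ k) f) n)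
    (≡.trans (neg-coeff _ n) (≡.trans (≡.cong (λ r → ℤ.- r) (signed-coeff k f n)) (lem ((ℤ.- ℤ.+ 1) ℤ.^ k) (f n))))
    where
    lem : ∀ a b → ℤ.- (a ℤ.* b) ≡ (ℤ.- ℤ.+ 1) ℤ.* a ℤ.* b
    lem = ℤSolver.solve-∀

  R-miss : ∀ c n → (∀ j → n ≢ c ℕ.* sq j) → R c n ≡ ℤ.+ 0
  R-miss c n p = psum-miss (square-term c) n (suc n) (λ j _ → X^-≢ (c ℕ.* sq j) n (p j))

  S-miss : ∀ c n → (∀ j → n ≢ c ℕ.* sq j) → S c n ≡ ℤ.+ 0
  S-miss c n p = psum-miss (signed-term c) n (suc n) (λ j _ → ≡.trans (signed-coeff (suc j) (square-term c j) n)
    (≡.trans (≡.cong (λ r → (ℤ.- ℤ.+ 1) ℤ.^ suc j ℤ.* r) (X^-≢ (c ℕ.* sq j) n (p j))) (ℤ.*-zeroʳ ((ℤ.- ℤ.+ 1) ℤ.^ suc j))))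

  private
    other : ∀ c′ k j → j ≢ k → suc c′ ℕ.* sq k ≢ suc c′ ℕ.* sq j
    other c′ k j j≢k p = j≢k (≡.sym (sq-injective k j (ℕ.*-cancelˡ-≡ (sq k) (sq j) (suc c′) p)))

    -- The coefficient of qⁿ in an infinite sum is taken from its first n + 1 terms, so the
    -- contributing index must be at most n.
    early : ∀ c′ k → k ℕ.< suc (suc c′ ℕ.* sq k)
    early c′ k = s≤s (ℕ.≤-trans (ℕ.≤-trans (ℕ.n≤1+n k) (ℕ.m≤m*n (suc k) (suc k))) (ℕ.m≤n*m (sq k) (suc c′)))

  R-hit : ∀ c′ k → R (suc c′) (suc c′ ℕ.* sq k) ≡ ℤ.+ 1
  R-hit c′ k = ≡.trans (psum-hit (square-term (suc c′)) _ k _ (early c′ k) (λ j j≢k → X^-≢ (suc c′ ℕ.* sq j) _ (other c′ k j j≢k)))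
    (X^-≡ (suc c′ ℕ.* sq k))

  S-hit : ∀ c′ k → S (suc c′) (suc c′ ℕ.* sq k) ≡ (ℤ.- ℤ.+ 1) ℤ.^ suc k
  S-hit c′ k = ≡.trans (psum-hit (signed-term (suc c′)) _ k _ (early c′ k)
      (λ j j≢k → ≡.trans (signed-coeff (suc j) _ _) (≡.trans (≡.cong (λ r → (ℤ.- ℤ.+ 1) ℤ.^ suc j ℤ.* r) (X^-≢ (suc c′ ℕ.* sq j) _ (other c′ k j j≢k))) (ℤ.*-zeroʳ ((ℤ.- ℤ.+ 1) ℤ.^ suc j)))))
    (≡.trans (signed-coeff (suc k) _ _) (≡.trans (≡.cong (λ r → (ℤ.- ℤ.+ 1) ℤ.^ suc k ℤ.* r) (X^-≡ (suc c′ ℕ.* sq k))) (ℤ.*-identityʳ _)))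

  pξ-mod-8 : ∀ n → ∃[ y ] ℤ.+ pξ (3 ℕ.* n) ≡
    1ₛ n ℤ.- ℤ.+ 2 ℤ.* S 1 n ℤ.+ ℤ.+ 4 ℤ.* (R 2 n ℤ.+ R 3 n ℤ.+ R 6 n) ℤ.+ y ℤ.* ℤ.+ 8
  pξ-mod-8 n = y n , ≡.trans (coeff p n) (≡.trans (at+ 1# (v + v)) (≡.trans (≡.cong (λ r → 1ₛ n ℤ.+ r) (≡.trans (at+ v v) (≡.cong₂ ℤ._+_ v≡ v≡)))
      (lem (1ₛ n) (S 1 n) (R 2 n ℤ.+ R 3 n ℤ.+ R 6 n) (y n))))
    where
    y r v : ℤ⟦q⟧
    y = proj₁ sec-ξ-mod-8
    p = proj₂ sec-ξ-mod-8
    r = R 2 + R 3 + R 6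
    v = (- S 1 + (r + r)) + ((y + y) + (y + y))
    at+ : ∀ f g → (f + g) n ≡ f n ℤ.+ g n
    at+ f g = +-coeff f g n
    r≡ : r n ≡ R 2 n ℤ.+ R 3 n ℤ.+ R 6 n
    r≡ = ≡.trans (at+ (R 2 + R 3) (R 6)) (≡.cong (λ z → z ℤ.+ R 6 n) (at+ (R 2) (R 3)))
    v≡ : v n ≡ (ℤ.- S 1 n ℤ.+ ((R 2 n ℤ.+ R 3 n ℤ.+ R 6 n) ℤ.+ (R 2 n ℤ.+ R 3 n ℤ.+ R 6 n))) ℤ.+ ((y n ℤ.+ y n) ℤ.+ (y n ℤ.+ y n))
    v≡ = ≡.trans (at+ _ _) (≡.cong₂ ℤ._+_
      (≡.trans (at+ _ _) (≡.cong₂ ℤ._+_ (neg-coeff (S 1) n) (≡.trans (at+ r r) (≡.cong₂ ℤ._+_ r≡ r≡))))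
      (≡.trans (at+ (y + y) (y + y)) (≡.cong₂ ℤ._+_ (at+ y y) (at+ y y))))
    lem : ∀ o s r y → o ℤ.+ (((ℤ.- s ℤ.+ (r ℤ.+ r)) ℤ.+ ((y ℤ.+ y) ℤ.+ (y ℤ.+ y))) ℤ.+ ((ℤ.- s ℤ.+ (r ℤ.+ r)) ℤ.+ ((y ℤ.+ y) ℤ.+ (y ℤ.+ y))))
      ≡ o ℤ.- ℤ.+ 2 ℤ.* s ℤ.+ ℤ.+ 4 ℤ.* r ℤ.+ y ℤ.* ℤ.+ 8
    lem = ℤSolver.solve-∀

  evaluate : ∀ n {o s a b d} → 1ₛ n ≡ o → S 1 n ≡ s → R 2 n ≡ a → R 3 n ≡ b → R 6 n ≡ d →
    ∃[ y ] ℤ.+ pξ (3 ℕ.* n) ≡ o ℤ.- ℤ.+ 2 ℤ.* s ℤ.+ ℤ.+ 4 ℤ.* (a ℤ.+ b ℤ.+ d) ℤ.+ y ℤ.* ℤ.+ 8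
  evaluate n ≡.refl ≡.refl ≡.refl ≡.refl ≡.refl = pξ-mod-8 n

  private
    8∣ : ∀ i z y → i ℤ.- z ≡ y ℤ.* ℤ.+ 8 → ℤ.+ 8 ℤᵤ.∣ i ℤ.- z
    8∣ i z y eq = ℤ.∣⇒∣ᵤ (ℤ.divides y eq)

  at-zero : ℤ.+ 8 ℤᵤ.∣ ℤ.+ pξ 0 ℤ.- ℤ.+ 1
  at-zero = let y , p = evaluate 0 ≡.refl (S-miss 1 0 (λ _ ())) (R-miss 2 0 (λ _ ())) (R-miss 3 0 (λ _ ())) (R-miss 6 0 (λ _ ())) in
    8∣ (ℤ.+ pξ 0) (ℤ.+ 1) y (≡.trans (≡.cong (λ z → z ℤ.- ℤ.+ 1) p) (lem y))
    where
    lem : ∀ y → ℤ.+ 1 ℤ.- ℤ.+ 2 ℤ.* ℤ.+ 0 ℤ.+ ℤ.+ 4 ℤ.* (ℤ.+ 0 ℤ.+ ℤ.+ 0 ℤ.+ ℤ.+ 0) ℤ.+ y ℤ.* ℤ.+ 8 ℤ.- ℤ.+ 1 ≡ y ℤ.* ℤ.+ 8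
    lem = ℤSolver.solve-∀

  at-square : ∀ k → ℤ.+ 8 ℤᵤ.∣ ℤ.+ pξ (3 ℕ.* sq k) ℤ.- ℤ.+ 6 ℤ.* (ℤ.- ℤ.+ 1) ℤ.^ suc k
  at-square k = let y , p = evaluate (sq k) ≡.refl
                                  (≡.trans (≡.cong (S 1) (≡.sym (ℕ.*-identityˡ (sq k)))) (S-hit 0 k))
                                  (R-miss 2 (sq k) (√2 (suc k))) (R-miss 3 (sq k) (√3 (suc k))) (R-miss 6 (sq k) (√6 (suc k))) in
    -- With s the sign, -2s - 6s = -8s, which accounts for the witness y - s.
    8∣ (ℤ.+ pξ (3 ℕ.* sq k)) (ℤ.+ 6 ℤ.* (ℤ.- ℤ.+ 1) ℤ.^ suc k) (y ℤ.- (ℤ.- ℤ.+ 1) ℤ.^ suc k) (≡.trans (≡.cong (λ z → z ℤ.- ℤ.+ 6 ℤ.* (ℤ.- ℤ.+ 1) ℤ.^ suc k) p) (lem y ((ℤ.- ℤ.+ 1) ℤ.^ suc k)))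
    where
    lem : ∀ y s → ℤ.+ 0 ℤ.- ℤ.+ 2 ℤ.* s ℤ.+ ℤ.+ 4 ℤ.* (ℤ.+ 0 ℤ.+ ℤ.+ 0 ℤ.+ ℤ.+ 0) ℤ.+ y ℤ.* ℤ.+ 8 ℤ.- ℤ.+ 6 ℤ.* s ≡ (y ℤ.- s) ℤ.* ℤ.+ 8
    lem = ℤSolver.solve-∀

  private
    four : ∀ n {a b d} → 1ₛ n ≡ ℤ.+ 0 → S 1 n ≡ ℤ.+ 0 → R 2 n ≡ a → R 3 n ≡ b → R 6 n ≡ d → a ℤ.+ b ℤ.+ d ≡ ℤ.+ 1 →
           ℤ.+ 8 ℤᵤ.∣ ℤ.+ pξ (3 ℕ.* n) ℤ.- ℤ.+ 4
    four n o s a b d one = let y , p = evaluate n o s a b d in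
      8∣ (ℤ.+ pξ (3 ℕ.* n)) (ℤ.+ 4) y (≡.trans (≡.cong (λ z → z ℤ.- ℤ.+ 4) (≡.trans p (≡.cong (λ r → ℤ.+ 0 ℤ.- ℤ.+ 2 ℤ.* ℤ.+ 0 ℤ.+ ℤ.+ 4 ℤ.* r ℤ.+ y ℤ.* ℤ.+ 8) one))) (lem y))
      where
      lem : ∀ y → ℤ.+ 0 ℤ.- ℤ.+ 2 ℤ.* ℤ.+ 0 ℤ.+ ℤ.+ 4 ℤ.* ℤ.+ 1 ℤ.+ y ℤ.* ℤ.+ 8 ℤ.- ℤ.+ 4 ≡ y ℤ.* ℤ.+ 8
      lem = ℤSolver.solve-∀

    1*sq : ∀ j → 1 ℕ.* sq j ≡ sq j
    1*sq j = ℕ.*-identityˡ (sq j)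

  at-2square : ∀ k → ℤ.+ 8 ℤᵤ.∣ ℤ.+ pξ (3 ℕ.* (2 ℕ.* sq k)) ℤ.- ℤ.+ 4
  at-2square k = four (2 ℕ.* sq k) ≡.refl
    (S-miss 1 _ (λ j p → √2 (suc j) k (≡.sym (≡.trans p (1*sq j)))))
    (R-hit 1 k) (R-miss 3 _ (2sq≢3sq k)) (R-miss 6 _ (2sq≢6sq k)) ≡.refl

  at-3square : ∀ k → ℤ.+ 8 ℤᵤ.∣ ℤ.+ pξ (3 ℕ.* (3 ℕ.* sq k)) ℤ.- ℤ.+ 4
  at-3square k = four (3 ℕ.* sq k) ≡.refl
    (S-miss 1 _ (λ j p → √3 (suc j) k (≡.sym (≡.trans p (1*sq j)))))
    (R-miss 2 _ (λ j p → 2sq≢3sq j k (≡.sym p))) (R-hit 2 k) (R-miss 6 _ (3sq≢6sq k)) ≡.refl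

  at-6square : ∀ k → ℤ.+ 8 ℤᵤ.∣ ℤ.+ pξ (3 ℕ.* (6 ℕ.* sq k)) ℤ.- ℤ.+ 4
  at-6square k = four (6 ℕ.* sq k) ≡.refl
    (S-miss 1 _ (λ j p → √6 (suc j) k (≡.sym (≡.trans p (1*sq j)))))
    (R-miss 2 _ (λ j p → 2sq≢6sq j k (≡.sym p))) (R-miss 3 _ (λ j p → 3sq≢6sq j k (≡.sym p))) (R-hit 5 k) ≡.refl

  elsewhere : ∀ n → n ≢ 0 → (∀ j → n ≢ sq j) → (∀ j → n ≢ 2 ℕ.* sq j) → (∀ j → n ≢ 3 ℕ.* sq j) → (∀ j → n ≢ 6 ℕ.* sq j) →
    ℤ.+ 8 ℤᵤ.∣ ℤ.+ pξ (3 ℕ.* n)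
  elsewhere zero      n≢0 _ _ _ _ = contradiction ≡.refl n≢0
  elsewhere n@(suc _) n≢0 p₁ p₂ p₃ p₆ = let y , p = evaluate n ≡.refl (S-miss 1 n (λ j p → p₁ j (≡.trans p (1*sq j)))) (R-miss 2 n p₂) (R-miss 3 n p₃) (R-miss 6 n p₆) in
    ℤ.∣⇒∣ᵤ {ℤ.+ 8} {ℤ.+ pξ (3 ℕ.* n)} (ℤ.divides y (≡.trans p (lem y)))
    where
    lem : ∀ y → ℤ.+ 0 ℤ.- ℤ.+ 2 ℤ.* ℤ.+ 0 ℤ.+ ℤ.+ 4 ℤ.* (ℤ.+ 0 ℤ.+ ℤ.+ 0 ℤ.+ ℤ.+ 0) ℤ.+ y ℤ.* ℤ.+ 8 ≡ y ℤ.* ℤ.+ 8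
    lem = ℤSolver.solve-∀

open import Data.Nat using (ℕ; _≥_)
open import Data.Integer using (ℤ; +_; -_; _-_; _^_)
open import Data.Integer.Divisibility using (_∣_)
open import Data.Product using (_×_; ∃-syntax)
open import Data.Sum using (_⊎_)
open import Relation.Binary.PropositionalEquality using (_≡_; _≢_; refl)
open import Relation.Nullary using (¬_)

open Coefficients using (at-zero; at-square; at-2square; at-3square; at-6square; elsewhere)

theorem4p7 : (n : ℕ) →
    ((n ≡ 0) → (+ 8) ∣ ((+ pξ (3 Data.Nat.* n)) - + 1))
    × ((k : ℕ) → k ≥ 1 → n ≡ k Data.Nat.* k →
    (+ 8) ∣ ((+ pξ (3 Data.Nat.* n)) - (+ 6) Data.Integer.* ((- + 1) ^ k)))
    × ((k : ℕ) → k ≥ 1 →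
    (n ≡ 2 Data.Nat.* (k Data.Nat.* k) ⊎ n ≡ 3 Data.Nat.* (k Data.Nat.* k) ⊎ n ≡ 6 Data.Nat.* (k Data.Nat.* k)) →
    (+ 8) ∣ ((+ pξ (3 Data.Nat.* n)) - + 4))
    × ((n ≢ 0) →
    ¬ (∃[ k ] (k ≥ 1 × (n ≡ k Data.Nat.* k ⊎ n ≡ 2 Data.Nat.* (k Data.Nat.* k) ⊎ n ≡ 3 Data.Nat.* (k Data.Nat.* k) ⊎ n ≡ 6 Data.Nat.* (k Data.Nat.* k)))) →
    (+ 8) ∣ (+ pξ (3 Data.Nat.* n)))
theorem4p7 n =
    (λ { refl → at-zero })
  , (λ { (suc k) _ refl → at-square k })
  , (λ { (suc k) _ (inj₁ refl) → at-2square k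
       ; (suc k) _ (inj₂ (inj₁ refl)) → at-3square k
       ; (suc k) _ (inj₂ (inj₂ refl)) → at-6square k })
  , (λ n≢0 none → elsewhere n n≢0
      (λ j p → none (suc j , s≤s z≤n , inj₁ p))
      (λ j p → none (suc j , s≤s z≤n , inj₂ (inj₁ p)))
      (λ j p → none (suc j , s≤s z≤n , inj₂ (inj₂ (inj₁ p))))
      (λ j p → none (suc j , s≤s z≤n , inj₂ (inj₂ (inj₂ p)))))
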